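{- Let $d \in \mathbb{N}$, let $S \in \mathcal{S}^d(1)$, and let $i \in \{1, \ldots, d+1\}$. Let $\beta_1 \ge \beta_2 \ge \cdots \ge \beta_{d+1}$ be the barycentric coordinates of the unique interior integral point of $S$ with respect to the vertices of $S$, ordered decreasingly. Then \[ \beta_i \ge \frac{1}{(d-i+2)(s_i - 1)}. \] Moreover: (a) If $S$ is unimodularly equivalent to $T^d_{1,i}$, then equality holds. (b) Equality holds if and only if \[ (\beta_1, \ldots, \beta_{d+1}) = \Big(\tfrac{1}{s_1}, \ldots, \tfrac{1}{s_{i-1}}, \tfrac{1}{(d-i+2)(s_i-1)}, \ldots, \tfrac{1}{(d-i+2)(s_i-1)}\Big). \] (c) For $i = d+1$, equality holds if and only if $S$ is unimodularly equivalent to $T^d_{1,d+1} = \operatorname{conv}(\{0, s_1 e_1, \ldots, s_d e_d\})$.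
   Context: The Sylvester sequence is defined by $s_1 = 2$ and $s_i = \prod_{j=1}^{i-1} s_j + 1$ for $i \ge 2$ (so $s_2=3, s_3=7, s_4=43,\dots$). For $k \ge 0$, $\mathcal{P}^d(k)$ denotes the set of $d$-dimensional polytopes $P \subseteq \mathbb{R}^d$ with all vertices in $\mathbb{Z}^d$ and exactly $k$ integral points in their interior, and $\mathcal{S}^d(k)$ is the set of simplices in $\mathcal{P}^d(k)$. Two integral polytopes $P,Q$ are unimodularly equivalent if there is an affine bijection $\phi$ of $\mathbb{R}^d$ with $\phi(\mathbb{Z}^d)=\mathbb{Z}^d$ and $\phi(P)=Q$. For a $d$-simplex with vertices $v_1,\dots,v_{d+1}$, the barycentric coordinates of $x$ are the unique reals $\beta_1,\dots,\beta_{d+1}$ with $\sum \beta_i = 1$ and $x=\sum \beta_i v_i$. For $j \in \{1,\ldots,d+1\}$, $T^d_{1,j} := \operatorname{conv}(\{0, s_1 e_1, \ldots, s_{j-1} e_{j-1}, (d-j+2)(s_j-1)e_j, \ldots, (d-j+2)(s_j-1) e_d\})$ (so $T^d_{1,1} = \operatorname{conv}(\{0,(d+1)e_1,\ldots,(d+1)e_d\})$ and $T^d_{1,d+1}=\operatorname{conv}(\{0,s_1e_1,\ldots,s_de_d\})$), where $e_i$ are the standard unit vectors. -}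

module Defs where

-- Every polytope below has integral vertices, so its geometry is carried out
-- in ℚᵈ instead of ℝᵈ: affine independence of integral points and membership
-- of rational points in their hull do not depend on which field is used, the
-- barycentric coordinates of an integral point are rational, and an affine
-- bijection of ℝᵈ preserving ℤᵈ restricts to ℚᵈ.

open import Algebra.Properties.CommutativeMonoid.Sum using (sum)
open import Data.Bool using (if_then_else_; true; false)
open import Data.Fin using (Fin; zero; suc; toℕ)
import Data.Fin as Fin
open import Data.Integer using (ℤ; +_)
open import Data.List using (List; length)
open import Data.List.Membership.Propositional using (_∈_)
open import Data.List.Relation.Unary.Unique.Propositional using (Unique)
open import Data.Nat using (ℕ; zero; suc; NonZero)
import Data.Nat as ℕ
import Data.Nat.Properties as ℕₚ
open import Data.Product using (Σ; ∃; _×_; _,_)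
open import Data.Rational using (ℚ; 0ℚ; 1ℚ; _/_; _+_; _*_; _-_; ∣_∣; _≤_; _<_)
import Data.Rational.Properties as ℚₚ
open import Data.Vec using (Vec; lookup; map; tabulate; replicate; zipWith)
open import Function.Bundles using (_⇔_)
open import Function.Definitions using (Bijective)
open import Level using (0ℓ)
open import Relation.Binary.PropositionalEquality using (_≡_; subst; sym)
open import Relation.Nullary.Decidable using (does)
open import Relation.Unary using (Pred; _≐_)

∑ : ∀ {n} → (Fin n → ℚ) → ℚ
∑ = sum ℚₚ.+-0-commutativeMonoid

ℚ^_ ℤ^_ : ℕ → Set
ℚ^ d = Vec ℚ d
ℤ^ d = Vec ℤ d

ι : ∀ {d} → ℤ^ d → ℚ^ d
ι = map (_/ 1)

Subset : ℕ → Set₁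
Subset d = Pred (ℚ^ d) 0ℓ

ℤ-lattice : ∀ d → Subset d
ℤ-lattice d x = ∃ λ (z : ℤ^ d) → ι z ≡ x

combination : ∀ {n d} → (Fin n → ℚ) → (Fin n → ℚ^ d) → ℚ^ d
combination c v = tabulate λ k → ∑ λ i → c i * lookup (v i) k

IsBarycentric : ∀ {n d} → (Fin n → ℚ^ d) → (Fin n → ℚ) → ℚ^ d → Set
IsBarycentric v b x = (∑ b ≡ 1ℚ) × (combination b v ≡ x)

conv : ∀ {n d} → (Fin n → ℚ^ d) → Subset d
conv v x = ∃ λ c → (∀ i → 0ℚ ≤ c i) × IsBarycentric v c x

AffinelyIndependent : ∀ {n d} → (Fin n → ℚ^ d) → Set
AffinelyIndependent {n} {d} v =
  ∀ (c : Fin n → ℚ) → ∑ c ≡ 0ℚ → combination c v ≡ replicate d 0ℚ → ∀ i → c i ≡ 0ℚ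

-- Topological interior; the neighbourhoods are balls of the maximum norm.
Interior : ∀ {d} → Subset d → Subset d
Interior P x =
  ∃ λ ε → (0ℚ < ε) × (∀ y → (∀ k → ∣ lookup y k - lookup x k ∣ ≤ ε) → P y)

HasInteriorIntegralPoints : ∀ {d} → ℕ → Subset d → Set
HasInteriorIntegralPoints {d} k P =
  ∃ λ (zs : List (ℤ^ d)) →
    Unique zs × (length zs ≡ k) × (∀ z → (z ∈ zs) ⇔ Interior P (ι z))

record 𝒮 (d k : ℕ) : Set where
  field
    vertexℤ : Fin (suc d) → ℤ^ d

  vertex : Fin (suc d) → ℚ^ d
  vertex j = ι (vertexℤ j)

  points : Subset d
  points = conv vertex

  field
    independent    : AffinelyIndependent vertex
    interiorPoints : HasInteriorIntegralPoints k points

image : ∀ {d} → (ℚ^ d → ℚ^ d) → Subset d → Subset d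
image φ P y = ∃ λ x → P x × (φ x ≡ y)

IsAffine : ∀ {d} → (ℚ^ d → ℚ^ d) → Set
IsAffine {d} φ =
  Σ (Fin d → Fin d → ℚ) λ A → Σ (ℚ^ d) λ t →
    ∀ x → φ x ≡ zipWith _+_ (tabulate λ r → ∑ λ c → A r c * lookup x c) t

UnimodularlyEquivalent : ∀ {d} → Subset d → Subset d → Set
UnimodularlyEquivalent {d} P Q =
  Σ (ℚ^ d → ℚ^ d) λ φ →
    IsAffine φ × Bijective _≡_ _≡_ φ
    × (image φ (ℤ-lattice d) ≐ ℤ-lattice d)
    × (image φ P ≐ Q)

-- Indices start at 0: s n is the Sylvester number sₙ₊₁, and ∏s n = s₁ ⋯ sₙ.
s ∏s : ℕ → ℕ
s n = ∏s n ℕ.+ 1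
∏s zero    = 1
∏s (suc n) = ∏s n ℕ.* s n

-- For the 0-based index i this is (d - i' + 2)(s_{i'} - 1) with i' = i + 1.
D : (d : ℕ) → Fin (suc d) → ℕ
D d i = (d ℕ.∸ toℕ i ℕ.+ 1) ℕ.* (s (toℕ i) ℕ.∸ 1)

-- The sequence s₁, …, s_{i'-1}, D, D, D, … with i' = i + 1.
scale : (d : ℕ) → Fin (suc d) → ℕ → ℕ
scale d i j = if j ℕ.<ᵇ toℕ i then s j else D d i

T₁-vertex : (d : ℕ) → Fin (suc d) → Fin (suc d) → ℤ^ d
T₁-vertex d i zero    = replicate d (+ 0)
T₁-vertex d i (suc j) =
  tabulate λ k → if does (k Fin.≟ j) then + scale d i (toℕ j) else + 0

T₁ : (d : ℕ) → Fin (suc d) → Subset d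
T₁ d i = conv λ j → ι (T₁-vertex d i j)

+1-nonZero : ∀ n → NonZero (n ℕ.+ 1)
+1-nonZero n = subst NonZero (ℕₚ.+-comm 1 n) _

∏s-nonZero : ∀ {n} → NonZero (∏s n)
∏s-nonZero {zero}  = _
∏s-nonZero {suc n} =
  ℕₚ.m*n≢0 (∏s n) (s n) ⦃ ∏s-nonZero {n} ⦄ ⦃ +1-nonZero (∏s n) ⦄

D-nonZero : ∀ {d i} → NonZero (D d i)
D-nonZero {d} {i} =
  ℕₚ.m*n≢0 (d ℕ.∸ toℕ i ℕ.+ 1) (s (toℕ i) ℕ.∸ 1)
    ⦃ +1-nonZero (d ℕ.∸ toℕ i) ⦄
    ⦃ subst NonZero (sym (ℕₚ.m+n∸n≡m (∏s (toℕ i)) 1)) (∏s-nonZero {toℕ i}) ⦄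

scale-nonZero : ∀ {d i j} → NonZero (scale d i j)
scale-nonZero {d} {i} {j} with j ℕ.<ᵇ toℕ i
... | true  = +1-nonZero (∏s j)
... | false = D-nonZero {d} {i}

bound : (d : ℕ) → Fin (suc d) → ℚ
bound d i = _/_ (+ 1) (D d i) ⦃ D-nonZero {d} {i} ⦄

extremal : (d : ℕ) → Fin (suc d) → Fin (suc d) → ℚ
extremal d i j = _/_ (+ 1) (scale d i (toℕ j)) ⦃ scale-nonZero {d} {i} {toℕ j} ⦄

{-# OPTIONS --safe #-}

-- Let β be the sorted barycentric coordinates of the interior point p.  The points with
-- coordinates (1 + m) β − c, with m a natural number and c integral of sum m, are integral,
-- so p is the only interior one among them.  Counting the box ∏ [0, b j) modulo the lattice
-- {N c − (∑ c) b : c ∈ ℤᵏ}, where β j = b j / N for j < k, this yields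
-- ∏_{j<k} β j ≤ 1 − ∑_{j<k} β j.  Comparing with the numbers 1 / s j, for which these are
-- equalities, summation by parts and the equality case of AM-GM give
-- ∑_{j<i} β j ≤ ∑_{j<i} 1 / s j, and the remaining d − i + 1 coordinates are at most β i.
-- For (a), an equivalence maps vertices to vertices and p to (1, …, 1).  For (c), the s j
-- being pairwise coprime, multiples of β and integral vectors realize all coordinate vectors
-- with entries in (1 / s j) ℤ for j < d; an integral point outside this lattice could be
-- translated by it to a second interior integral point.
module Submission where

open import Algebra.Properties.CommutativeMonoid.Sum as CommutativeMonoidSum using ()
open import Data.Bool using (T; false; if_then_else_; true)
open import Data.Empty using (⊥-elim)
open import Data.Fin using (Fin; combine; finToFun; fromℕ; fromℕ<; funToFin; inject≤; punchIn; remQuot; suc; toℕ; zero) renaming (_≤_ to _≤ᶠ_)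
import Data.Fin as Fin
open import Data.Fin.Permutation using (Permutation′; _⟨$⟩ʳ_; _⟨$⟩ˡ_; insert; insert-punchIn; inverseˡ) renaming (id to idₚ)
import Data.Fin.Properties as Fin
open import Data.Integer using (ℤ; +_; -[1+_])
import Data.Integer as ℤ
import Data.Integer.DivMod as ℤ
import Data.Integer.Properties as ℤ
open import Data.List using ([]; _∷_)
open import Data.List.Membership.Propositional using (_∈_)
open import Data.List.Relation.Unary.Any using (here)
open import Data.Nat using (ℕ; suc; zero)
import Data.Nat as ℕ
import Data.Nat.DivMod as ℕ
import Data.Nat.Properties as ℕ
open import Data.Product using (Σ; _,_; _×_; proj₁; proj₂; ∃)
open import Data.Rational using (0ℚ; 1/_; 1ℚ; _*_; _+_; _-_; _/_; _<_; _≤_; _≥_; _⊓_; -_; nonNegative; positive; toℚᵘ; ℚ; ∣_∣; ≢-nonZero)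
import Data.Rational as ℚ
import Data.Rational.Properties as ℚ
open import Data.Rational.Solver using (module +-*-Solver)
import Data.Rational.Unnormalised as ℚᵘ
import Data.Rational.Unnormalised.Properties as ℚᵘ
open import Data.Sum using (_⊎_; inj₁; inj₂)
open import Data.Unit using (tt)
open import Data.Vec using (Vec; lookup; replicate; tabulate; zipWith)
open import Data.Vec.Functional using (insertAt)
open import Data.Vec.Functional.Properties using (insertAt-lookup; insertAt-punchIn)
open import Data.Vec.Properties using (lookup-map; lookup-replicate; lookup-zipWith; lookup∘tabulate; tabulate-cong; tabulate∘lookup)
open import Function using (Equivalence; _∘_)
open import Function.Bundles using (_⇔_; mk⇔)
open import Function.Definitions using (Injective; Surjective)
open import Relation.Binary.PropositionalEquality using (_≡_; _≢_; cong; cong₂; module ≡-Reasoning; refl; subst; subst₂; sym; trans)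
open import Relation.Nullary using (does; no; yes; ¬_)
open import Relation.Nullary.Decidable using (dec-false; dec-true; decidable-stable; ¬?)
open import Relation.Unary using (_≐_)
open import Defs

open +-*-Solver using (_:*_; _:+_; _:-_; _:=_; :-_; con; solve)
open CommutativeMonoidSum ℚ.+-0-commutativeMonoid using (sum-permute) renaming (sum-cong-≗ to ∑-cong; sum-remove to ∑-remove; ∑-comm to ∑-swap; ∑-distrib-+ to ∑-+)

-- Rational arithmetic

-- The map `c ↦ N c − (∑ c) b` on ℤᵏ has determinant `N^(k−1) (N − ∑ b)`, and `N^k` times the
-- product-sum inequality says that the box has at most that many points; hence no two box points
-- may be congruent. If u and u′ differ by `N c − m b` with `m = ∑ c`, then `(1 + m) β − c` equals
-- `β − (u − u′) / N` on the k chosen indices, which is positive because u lies in the box. On the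
-- other indices it is `(1 + m) β`, and exchanging u and u′ makes `m ≥ 0`. Uniqueness of the
-- interior point now gives u = u′. At least one index has to stay outside, since otherwise
-- `N − ∑ b = 0`. The order of the coordinates matters twice: the reciprocals must increase for the
-- summation by parts, and β i must dominate the tail. The comparison with Sylvester's sequence
-- needs AM-GM in its equality form only: a prefix sum that reaches its bound is forced to have the
-- terms `1 / s j`, so it can never exceed the bound.

0≤-⇒≤ : ∀ {p q} → 0ℚ ≤ q - p → p ≤ q
0≤-⇒≤ {p} {q} h = begin
  p            ≡⟨ ℚ.+-identityˡ p ⟨
  0ℚ + p       ≤⟨ ℚ.+-monoˡ-≤ p h ⟩
  (q - p) + p  ≡⟨ solve 2 (λ p q → (q :- p) :+ p := q) refl p q ⟩
  q            ∎
  where open ℚ.≤-Reasoning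

≤⇒0≤- : ∀ {p q} → p ≤ q → 0ℚ ≤ q - p
≤⇒0≤- {p} {q} h = subst (_≤ q - p) (ℚ.+-inverseʳ p) (ℚ.+-monoˡ-≤ (- p) h)

<⇒0<- : ∀ {p q} → p < q → 0ℚ < q - p
<⇒0<- {p} {q} h = subst (_< q - p) (ℚ.+-inverseʳ p) (ℚ.+-monoˡ-< (- p) h)

-⇒≡ : ∀ {p q} → p - q ≡ 0ℚ → p ≡ q
-⇒≡ {p} {q} h = begin
  p            ≡⟨ solve 2 (λ p q → p := (p :- q) :+ q) refl p q ⟩
  (p - q) + q  ≡⟨ cong (_+ q) h ⟩
  0ℚ + q       ≡⟨ ℚ.+-identityˡ q ⟩
  q            ∎
  where open ≡-Reasoning

≡⇒- : ∀ {p q} → p ≡ q → p - q ≡ 0ℚ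
≡⇒- {p} refl = ℚ.+-inverseʳ p

0≤+ : ∀ {p q} → 0ℚ ≤ p → 0ℚ ≤ q → 0ℚ ≤ p + q
0≤+ = ℚ.+-mono-≤

0<+ : ∀ {p q} → 0ℚ < p → 0ℚ ≤ q → 0ℚ < p + q
0<+ = ℚ.+-mono-<-≤

p≤q+p : ∀ p {q} → 0ℚ ≤ q → p ≤ q + p
p≤q+p p {q} 0≤q = subst (_≤ q + p) (ℚ.+-identityˡ p) (ℚ.+-monoˡ-≤ p 0≤q)

*-mono-≤ˡ : ∀ {r p q} → 0ℚ ≤ r → p ≤ q → r * p ≤ r * q
*-mono-≤ˡ {r} 0≤r = ℚ.*-monoˡ-≤-nonNeg r ⦃ nonNegative 0≤r ⦄

*-mono-≤ʳ : ∀ {r p q} → 0ℚ ≤ r → p ≤ q → p * r ≤ q * r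
*-mono-≤ʳ {r} 0≤r = ℚ.*-monoʳ-≤-nonNeg r ⦃ nonNegative 0≤r ⦄

*-mono-<ˡ : ∀ {r p q} → 0ℚ < r → p < q → r * p < r * q
*-mono-<ˡ {r} 0<r = ℚ.*-monoʳ-<-pos r ⦃ positive 0<r ⦄

*-cancel-≤ˡ : ∀ {r p q} → 0ℚ < r → r * p ≤ r * q → p ≤ q
*-cancel-≤ˡ {r} 0<r = ℚ.*-cancelˡ-≤-pos r ⦃ positive 0<r ⦄

*-cancel-<ˡ : ∀ {r p q} → 0ℚ < r → r * p < r * q → p < q
*-cancel-<ˡ {r} 0<r = ℚ.*-cancelˡ-<-nonNeg r ⦃ nonNegative (ℚ.<⇒≤ 0<r) ⦄

0≤* : ∀ {p q} → 0ℚ ≤ p → 0ℚ ≤ q → 0ℚ ≤ p * q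
0≤* {p} {q} 0≤p 0≤q = subst (_≤ p * q) (ℚ.*-zeroʳ p) (*-mono-≤ˡ 0≤p 0≤q)

0<* : ∀ {p q} → 0ℚ < p → 0ℚ < q → 0ℚ < p * q
0<* {p} {q} 0<p 0<q = subst (_< p * q) (ℚ.*-zeroʳ p) (*-mono-<ˡ 0<p 0<q)

0≤p*p : ∀ p → 0ℚ ≤ p * p
0≤p*p p with ℚ.≤-total 0ℚ p
... | inj₁ 0≤p = 0≤* 0≤p 0≤p
... | inj₂ p≤0 = subst (0ℚ ≤_) (solve 1 (λ p → (:- p) :* (:- p) := p :* p) refl p)
                   (0≤* (ℚ.neg-antimono-≤ p≤0) (ℚ.neg-antimono-≤ p≤0))

0<1 : 0ℚ < 1ℚ
0<1 = ℚ.positive⁻¹ 1ℚ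

abstract
  inverse : ∀ {p} → p ≢ 0ℚ → ∃ λ q → p * q ≡ 1ℚ
  inverse {p} p≢0 = (1/ p) ⦃ ≢-nonZero p≢0 ⦄ , ℚ.*-inverseʳ p ⦃ ≢-nonZero p≢0 ⦄

>⇒≢ : ∀ {p} → 0ℚ < p → p ≢ 0ℚ
>⇒≢ 0<p p≡0 = ℚ.<-irrefl (sym p≡0) 0<p

abstract
  pos-inverse : ∀ {p} → 0ℚ < p → ∃ λ q → 0ℚ < q × p * q ≡ 1ℚ
  pos-inverse {p} 0<p with q , pq≡1 ← inverse (>⇒≢ 0<p) =
    q , *-cancel-<ˡ 0<p (begin-strict
      p * 0ℚ ≡⟨ ℚ.*-zeroʳ p ⟩ 0ℚ <⟨ 0<1 ⟩ 1ℚ ≡⟨ pq≡1 ⟨ p * q ∎) , pq≡1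
    where open ℚ.≤-Reasoning

*≡0 : ∀ {p q} → p ≢ 0ℚ → p * q ≡ 0ℚ → q ≡ 0ℚ
*≡0 {p} {q} p≢0 pq≡0 with r , pr≡1 ← inverse p≢0 = begin
  q            ≡⟨ ℚ.*-identityˡ q ⟨
  1ℚ * q       ≡⟨ cong (_* q) pr≡1 ⟨
  (p * r) * q  ≡⟨ solve 3 (λ p q r → (p :* r) :* q := r :* (p :* q)) refl p q r ⟩
  r * (p * q)  ≡⟨ cong (r *_) pq≡0 ⟩
  r * 0ℚ       ≡⟨ ℚ.*-zeroʳ r ⟩
  0ℚ           ∎
  where open ≡-Reasoning

p*p≤0⇒p≡0 : ∀ p → p * p ≤ 0ℚ → p ≡ 0ℚ
p*p≤0⇒p≡0 p h with p ℚ.≟ 0ℚ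
... | yes p≡0 = p≡0
... | no  p≢0 = *≡0 p≢0 (ℚ.≤-antisym h (0≤p*p p))

-- The integers inside the rationals, and floors

toℚᵘ-/ : ∀ z n .⦃ _ : ℕ.NonZero n ⦄ → toℚᵘ (z / n) ℚᵘ.≃ (z ℚᵘ./ n)
toℚᵘ-/ z (suc n) = ℚ.toℚᵘ-fromℚᵘ (z ℚᵘ./ suc n)

opaque
  fromℤ : ℤ → ℚ
  fromℤ z = z / 1

  fromℤ≡/1 : ∀ z → fromℤ z ≡ z / 1
  fromℤ≡/1 z = refl

  fromℤ-0 : fromℤ (+ 0) ≡ 0ℚ
  fromℤ-0 = refl

  fromℤ-1 : fromℤ (+ 1) ≡ 1ℚ
  fromℤ-1 = refl

  fromℤ-+ : ∀ a b → fromℤ (a ℤ.+ b) ≡ fromℤ a + fromℤ b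
  fromℤ-+ a b = ℚ.toℚᵘ-injective (begin-equality
    toℚᵘ (fromℤ (a ℤ.+ b))             ≃⟨ toℚᵘ-/ (a ℤ.+ b) 1 ⟩
    (a ℤ.+ b) ℚᵘ./ 1                   ≃⟨ ℚᵘ.*≡* (cong (ℤ._* + 1) (cong₂ ℤ._+_ (sym (ℤ.*-identityʳ a)) (sym (ℤ.*-identityʳ b)))) ⟩
    (a ℚᵘ./ 1) ℚᵘ.+ (b ℚᵘ./ 1)         ≃⟨ ℚᵘ.+-cong (toℚᵘ-/ a 1) (toℚᵘ-/ b 1) ⟨
    toℚᵘ (fromℤ a) ℚᵘ.+ toℚᵘ (fromℤ b) ≃⟨ ℚ.toℚᵘ-homo-+ (fromℤ a) (fromℤ b) ⟨
    toℚᵘ (fromℤ a + fromℤ b)           ∎)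
    where open ℚᵘ.≤-Reasoning

  fromℤ-* : ∀ a b → fromℤ (a ℤ.* b) ≡ fromℤ a * fromℤ b
  fromℤ-* a b = ℚ.toℚᵘ-injective (begin-equality
    toℚᵘ (fromℤ (a ℤ.* b))             ≃⟨ toℚᵘ-/ (a ℤ.* b) 1 ⟩
    (a ℚᵘ./ 1) ℚᵘ.* (b ℚᵘ./ 1)         ≃⟨ ℚᵘ.*-cong (toℚᵘ-/ a 1) (toℚᵘ-/ b 1) ⟨
    toℚᵘ (fromℤ a) ℚᵘ.* toℚᵘ (fromℤ b) ≃⟨ ℚ.toℚᵘ-homo-* (fromℤ a) (fromℤ b) ⟨
    toℚᵘ (fromℤ a * fromℤ b)           ∎)
    where open ℚᵘ.≤-Reasoning

  fromℤ-mono-≤ : ∀ {a b} → a ℤ.≤ b → fromℤ a ≤ fromℤ b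
  fromℤ-mono-≤ {a} {b} a≤b = ℚ.toℚᵘ-cancel-≤ (begin
    toℚᵘ (fromℤ a) ≃⟨ toℚᵘ-/ a 1 ⟩
    a ℚᵘ./ 1       ≤⟨ ℚᵘ.*≤* (ℤ.*-monoʳ-≤-nonNeg (+ 1) a≤b) ⟩
    b ℚᵘ./ 1       ≃⟨ toℚᵘ-/ b 1 ⟨
    toℚᵘ (fromℤ b) ∎)
    where open ℚᵘ.≤-Reasoning

  fromℤ-mono-< : ∀ {a b} → a ℤ.< b → fromℤ a < fromℤ b
  fromℤ-mono-< {a} {b} a<b = ℚ.toℚᵘ-cancel-< (begin-strict
    toℚᵘ (fromℤ a) ≃⟨ toℚᵘ-/ a 1 ⟩
    a ℚᵘ./ 1       <⟨ ℚᵘ.*<* (ℤ.*-monoʳ-<-pos (+ 1) a<b) ⟩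
    b ℚᵘ./ 1       ≃⟨ toℚᵘ-/ b 1 ⟨
    toℚᵘ (fromℤ b) ∎)
    where open ℚᵘ.≤-Reasoning

  /-*-cancel : ∀ z n .⦃ _ : ℕ.NonZero n ⦄ → fromℤ (+ n) * (z / n) ≡ fromℤ z
  /-*-cancel z n@(suc _) = ℚ.toℚᵘ-injective (begin-equality
    toℚᵘ (fromℤ (+ n) * (z / n))           ≃⟨ ℚ.toℚᵘ-homo-* (fromℤ (+ n)) (z / n) ⟩
    toℚᵘ (fromℤ (+ n)) ℚᵘ.* toℚᵘ (z / n)     ≃⟨ ℚᵘ.*-cong (toℚᵘ-/ (+ n) 1) (toℚᵘ-/ z n) ⟩
    (+ n ℚᵘ./ 1) ℚᵘ.* (z ℚᵘ./ n)     ≃⟨ ℚᵘ.*≡* (trans (ℤ.*-identityʳ _) (trans (ℤ.*-comm (+ n) z) (cong (λ k → z ℤ.* + k) (sym (ℕ.*-identityˡ n))))) ⟩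
    z ℚᵘ./ 1                         ≃⟨ toℚᵘ-/ z 1 ⟨
    toℚᵘ (fromℤ z)                   ∎)
    where open ℚᵘ.≤-Reasoning

⟦_⟧ : ℕ → ℚ
⟦ n ⟧ = fromℤ (+ n)

fromℤ-neg : ∀ a → fromℤ (ℤ.- a) ≡ - fromℤ a
fromℤ-neg a = begin
  fromℤ (ℤ.- a)                            ≡⟨ solve 2 (λ x y → x := (x :+ y) :- y) refl (fromℤ (ℤ.- a)) (fromℤ a) ⟩
  (fromℤ (ℤ.- a) + fromℤ a) - fromℤ a      ≡⟨ cong (_- fromℤ a) (fromℤ-+ (ℤ.- a) a) ⟨
  fromℤ (ℤ.- a ℤ.+ a) - fromℤ a            ≡⟨ cong (λ z → fromℤ z - fromℤ a) (ℤ.+-inverseˡ a) ⟩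
  fromℤ (+ 0) - fromℤ a                    ≡⟨ cong (_- fromℤ a) fromℤ-0 ⟩
  0ℚ - fromℤ a                             ≡⟨ ℚ.+-identityˡ _ ⟩
  - fromℤ a                                ∎
  where open ≡-Reasoning

⟦⟧-+ : ∀ m n → ⟦ m ℕ.+ n ⟧ ≡ ⟦ m ⟧ + ⟦ n ⟧
⟦⟧-+ m n = fromℤ-+ (+ m) (+ n)

⟦⟧-* : ∀ m n → ⟦ m ℕ.* n ⟧ ≡ ⟦ m ⟧ * ⟦ n ⟧
⟦⟧-* m n = trans (cong fromℤ (ℤ.pos-* m n)) (fromℤ-* (+ m) (+ n))

⟦⟧-mono-≤ : ∀ {m n} → m ℕ.≤ n → ⟦ m ⟧ ≤ ⟦ n ⟧
⟦⟧-mono-≤ m≤n = fromℤ-mono-≤ (ℤ.+≤+ m≤n)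

⟦⟧-mono-< : ∀ {m n} → m ℕ.< n → ⟦ m ⟧ < ⟦ n ⟧
⟦⟧-mono-< m<n = fromℤ-mono-< (ℤ.+<+ m<n)

⟦⟧-cancel-≤ : ∀ {m n} → ⟦ m ⟧ ≤ ⟦ n ⟧ → m ℕ.≤ n
⟦⟧-cancel-≤ {m} {n} h with m ℕ.≤? n
... | yes m≤n = m≤n
... | no  m≰n = ⊥-elim (ℚ.<-irrefl refl (ℚ.<-≤-trans (⟦⟧-mono-< (ℕ.≰⇒> m≰n)) h))

⟦⟧-injective : ∀ {m n} → ⟦ m ⟧ ≡ ⟦ n ⟧ → m ≡ n
⟦⟧-injective eq = ℕ.≤-antisym (⟦⟧-cancel-≤ (ℚ.≤-reflexive eq)) (⟦⟧-cancel-≤ (ℚ.≤-reflexive (sym eq)))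

0≤⟦⟧ : ∀ n → 0ℚ ≤ ⟦ n ⟧
0≤⟦⟧ n = subst (_≤ ⟦ n ⟧) fromℤ-0 (⟦⟧-mono-≤ ℕ.z≤n)

0<⟦⟧ : ∀ n .⦃ _ : ℕ.NonZero n ⦄ → 0ℚ < ⟦ n ⟧
0<⟦⟧ n = subst (_< ⟦ n ⟧) fromℤ-0 (⟦⟧-mono-< (ℕ.n≢0⇒n>0 (ℕ.≢-nonZero⁻¹ n)))

1/-inverse : ∀ n .⦃ _ : ℕ.NonZero n ⦄ → ⟦ n ⟧ * (+ 1 / n) ≡ 1ℚ
1/-inverse n = trans (/-*-cancel (+ 1) n) fromℤ-1

0<1/ : ∀ n .⦃ _ : ℕ.NonZero n ⦄ → 0ℚ < + 1 / n
0<1/ n = *-cancel-<ˡ (0<⟦⟧ n) (begin-strict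
  ⟦ n ⟧ * 0ℚ        ≡⟨ ℚ.*-zeroʳ ⟦ n ⟧ ⟩
  0ℚ                <⟨ 0<1 ⟩
  1ℚ                ≡⟨ 1/-inverse n ⟨
  ⟦ n ⟧ * (+ 1 / n) ∎)
  where open ℚ.≤-Reasoning

*↧≡↥ : ∀ p → ⟦ ℚ.↧ₙ p ⟧ * p ≡ fromℤ (ℚ.↥ p)
*↧≡↥ p = trans (cong (⟦ ℚ.↧ₙ p ⟧ *_) (sym (ℚ.↥p/↧p≡p p))) (/-*-cancel (ℚ.↥ p) (ℚ.↧ₙ p))

IsInt : ℚ → Set
IsInt x = ∃ λ z → fromℤ z ≡ x

int-⟦⟧ : ∀ n → IsInt ⟦ n ⟧
int-⟦⟧ n = + n , refl

int-+ : ∀ {x y} → IsInt x → IsInt y → IsInt (x + y)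
int-+ (a , refl) (b , refl) = a ℤ.+ b , fromℤ-+ a b

int-* : ∀ {x y} → IsInt x → IsInt y → IsInt (x * y)
int-* (a , refl) (b , refl) = a ℤ.* b , fromℤ-* a b

int-neg : ∀ {x} → IsInt x → IsInt (- x)
int-neg (a , refl) = ℤ.- a , fromℤ-neg a

int-- : ∀ {x y} → IsInt x → IsInt y → IsInt (x - y)
int-- i j = int-+ i (int-neg j)

abstract
  integer-part : ∀ p → ∃ λ f → IsInt f × f ≤ p × p < f + 1ℚ
  integer-part p = fromℤ q , (q , refl) , f≤p , p<f+1
    where
    n : ℕ
    n = ℚ.↧ₙ p
    q : ℤ
    q = ℚ.↥ p ℤ./ℕ n
    r : ℕ
    r = ℚ.↥ p ℤ.%ℕ n
    n>0 : 0ℚ < ⟦ n ⟧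
    n>0 = 0<⟦⟧ n
    eq : ⟦ n ⟧ * p ≡ ⟦ r ⟧ + fromℤ q * ⟦ n ⟧
    eq = begin
      ⟦ n ⟧ * p                   ≡⟨ *↧≡↥ p ⟩
      fromℤ (ℚ.↥ p)               ≡⟨ cong fromℤ (ℤ.a≡a%ℕn+[a/ℕn]*n (ℚ.↥ p) n) ⟩
      fromℤ (+ r ℤ.+ q ℤ.* + n)   ≡⟨ fromℤ-+ (+ r) (q ℤ.* + n) ⟩
      ⟦ r ⟧ + fromℤ (q ℤ.* + n)   ≡⟨ cong (λ x → ⟦ r ⟧ + x) (fromℤ-* q (+ n)) ⟩
      ⟦ r ⟧ + fromℤ q * ⟦ n ⟧     ∎
      where open ≡-Reasoning
    open ℚ.≤-Reasoning
    f≤p : fromℤ q ≤ p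
    f≤p = *-cancel-≤ˡ n>0 (begin
      ⟦ n ⟧ * fromℤ q           ≡⟨ solve 2 (λ n q → n :* q := con 0ℚ :+ q :* n) refl ⟦ n ⟧ (fromℤ q) ⟩
      0ℚ + fromℤ q * ⟦ n ⟧      ≤⟨ ℚ.+-monoˡ-≤ _ (0≤⟦⟧ r) ⟩
      ⟦ r ⟧ + fromℤ q * ⟦ n ⟧   ≡⟨ eq ⟨
      ⟦ n ⟧ * p                 ∎)
    p<f+1 : p < fromℤ q + 1ℚ
    p<f+1 = *-cancel-<ˡ n>0 (begin-strict
      ⟦ n ⟧ * p                 ≡⟨ eq ⟩
      ⟦ r ⟧ + fromℤ q * ⟦ n ⟧   <⟨ ℚ.+-monoˡ-< _ (⟦⟧-mono-< (ℤ.n%ℕd<d (ℚ.↥ p) n)) ⟩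
      ⟦ n ⟧ + fromℤ q * ⟦ n ⟧   ≡⟨ solve 2 (λ n q → n :+ q :* n := n :* (q :+ con 1ℚ)) refl ⟦ n ⟧ (fromℤ q) ⟩
      ⟦ n ⟧ * (fromℤ q + 1ℚ)    ∎)

-- Finite sums and linear algebra

∑-*ˡ : ∀ {n} c (f : Fin n → ℚ) → ∑ (λ i → c * f i) ≡ c * ∑ f
∑-*ˡ {zero}  c f = sym (ℚ.*-zeroʳ c)
∑-*ˡ {suc n} c f = trans (cong (λ x → c * f zero + x) (∑-*ˡ c (f ∘ suc))) (sym (ℚ.*-distribˡ-+ c _ _))

∑-*ʳ : ∀ {n} (f : Fin n → ℚ) c → ∑ (λ i → f i * c) ≡ ∑ f * c
∑-*ʳ f c = trans (∑-cong (λ i → ℚ.*-comm (f i) c)) (trans (∑-*ˡ c f) (ℚ.*-comm c _))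

∑-0 : ∀ n → ∑ {n} (λ _ → 0ℚ) ≡ 0ℚ
∑-0 zero    = refl
∑-0 (suc n) = trans (ℚ.+-identityˡ _) (∑-0 n)

∑-neg : ∀ {n} (f : Fin n → ℚ) → ∑ (λ i → - f i) ≡ - ∑ f
∑-neg {zero}  f = refl
∑-neg {suc n} f = trans (cong (λ x → - f zero + x) (∑-neg (f ∘ suc))) (sym (ℚ.neg-distrib-+ (f zero) _))

∑-- : ∀ {n} (f g : Fin n → ℚ) → ∑ (λ i → f i - g i) ≡ ∑ f - ∑ g
∑-- f g = trans (∑-+ f (λ i → - g i)) (cong (λ x → ∑ f + x) (∑-neg g))

∑-mono-≤ : ∀ {n} {f g : Fin n → ℚ} → (∀ i → f i ≤ g i) → ∑ f ≤ ∑ g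
∑-mono-≤ {zero}  h = ℚ.≤-refl
∑-mono-≤ {suc n} h = ℚ.+-mono-≤ (h zero) (∑-mono-≤ (h ∘ suc))

∑-nonNeg : ∀ {n} {f : Fin n → ℚ} → (∀ i → 0ℚ ≤ f i) → 0ℚ ≤ ∑ f
∑-nonNeg {n} {f} h = subst (_≤ ∑ f) (∑-0 n) (∑-mono-≤ h)

f≤∑f : ∀ {n} {f : Fin n → ℚ} → (∀ i → 0ℚ ≤ f i) → ∀ i → f i ≤ ∑ f
f≤∑f {suc n} {f} h zero    = subst (_≤ ∑ f) (ℚ.+-identityʳ _) (ℚ.+-monoʳ-≤ (f zero) (∑-nonNeg (h ∘ suc)))
f≤∑f {suc n} {f} h (suc i) = ℚ.≤-trans (f≤∑f (h ∘ suc) i)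
  (subst (_≤ ∑ f) (ℚ.+-identityˡ _) (ℚ.+-monoˡ-≤ _ (h zero)))

∑-∣∣ : ∀ {n} (f : Fin n → ℚ) → ∣ ∑ f ∣ ≤ ∑ (λ i → ∣ f i ∣)
∑-∣∣ {zero}  f = ℚ.≤-refl
∑-∣∣ {suc n} f = ℚ.≤-trans (ℚ.∣p+q∣≤∣p∣+∣q∣ (f zero) _) (ℚ.+-monoʳ-≤ ∣ f zero ∣ (∑-∣∣ (f ∘ suc)))

∑-int : ∀ {n} {f : Fin n → ℚ} → (∀ i → IsInt (f i)) → IsInt (∑ f)
∑-int {zero}  h = ℤ.+ 0 , fromℤ-0
∑-int {suc n} h = int-+ (h zero) (∑-int (h ∘ suc))

δ : ∀ {n} → Fin n → Fin n → ℚ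
δ i j = if does (i Fin.≟ j) then 1ℚ else 0ℚ

δ-≡ : ∀ {n} (i : Fin n) → δ i i ≡ 1ℚ
δ-≡ i rewrite dec-true (i Fin.≟ i) refl = refl

δ-≢ : ∀ {n} {i j : Fin n} → i ≢ j → δ i j ≡ 0ℚ
δ-≢ {_} {i} {j} i≢j rewrite dec-false (i Fin.≟ j) i≢j = refl

δ-nonNeg : ∀ {n} (i j : Fin n) → 0ℚ ≤ δ i j
δ-nonNeg i j with does (i Fin.≟ j)
... | true  = ℚ.<⇒≤ 0<1
... | false = ℚ.≤-refl

∑-single : ∀ {n} (f : Fin n → ℚ) i → (∀ j → i ≢ j → f j ≡ 0ℚ) → ∑ f ≡ f i
∑-single {suc n} f i h = begin
  ∑ f                                   ≡⟨ ∑-remove {i = i} f ⟩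
  f i + ∑ (λ j → f (punchIn i j))       ≡⟨ cong (λ x → f i + x) (∑-cong λ j → h (punchIn i j) λ eq → Fin.punchInᵢ≢i i j (sym eq)) ⟩
  f i + ∑ {n} (λ _ → 0ℚ)                ≡⟨ cong (λ x → f i + x) (∑-0 n) ⟩
  f i + 0ℚ                              ≡⟨ ℚ.+-identityʳ (f i) ⟩
  f i                                   ∎
  where open ≡-Reasoning

∑-δ : ∀ {n} i (f : Fin n → ℚ) → ∑ (λ j → δ i j * f j) ≡ f i
∑-δ i f = trans
  (∑-single (λ j → δ i j * f j) i λ j i≢j → trans (cong (_* f j) (δ-≢ i≢j)) (ℚ.*-zeroˡ (f j)))
  (trans (cong (_* f i) (δ-≡ i)) (ℚ.*-identityˡ (f i)))

abstract
  -- Gaussian elimination on column `zero`. Without a pivot that column vanishes, and the induction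
  -- hypothesis relates all rows but the first on the remaining columns; with a pivot row `p`,
  -- subtracting multiples of it clears the column from the other rows.
  dependent : ∀ n (f : Fin (suc n) → Fin n → ℚ) →
    ∃ λ (c : Fin (suc n) → ℚ) → (∃ λ i → c i ≢ 0ℚ) × (∀ k → ∑ (λ i → c i * f i k) ≡ 0ℚ)
  dependent zero    f = (λ _ → 1ℚ) , (zero , λ ()) , λ ()
  dependent (suc n) f with Fin.any? (λ i → ¬? (f i zero ℚ.≟ 0ℚ))
  ... | no ¬pivot with c′ , (i , c′i≢0) , rel ← dependent n (λ i k → f (suc i) (suc k)) =
    c , (suc i , c′i≢0) , rel′
    where
    c : Fin (suc (suc n)) → ℚ
    c zero    = 0ℚ
    c (suc i) = c′ i
    column-0 : ∀ i → f i zero ≡ 0ℚ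
    column-0 i = decidable-stable (f i zero ℚ.≟ 0ℚ) λ h → ¬pivot (i , h)
    rel′ : ∀ k → ∑ (λ i → c i * f i k) ≡ 0ℚ
    rel′ zero    = trans (∑-cong λ i → trans (cong (c i *_) (column-0 i)) (ℚ.*-zeroʳ (c i))) (∑-0 (suc (suc n)))
    rel′ (suc k) = trans (cong₂ _+_ (ℚ.*-zeroˡ (f zero (suc k))) (rel k)) refl
  ... | yes (p , pivot) with r , fr≡1 ← inverse pivot
      with c′ , (i , c′i≢0) , rel ← dependent n (λ i k → f (punchIn p i) (suc k) - (f (punchIn p i) zero * r) * f p (suc k)) =
    c , (punchIn p i , λ eq → c′i≢0 (trans (sym (insertAt-punchIn c′ p x i)) eq)) , rel′
    where
    ratio : Fin (suc n) → ℚ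
    ratio i = f (punchIn p i) zero * r
    -- The coefficient of the pivot row, which compensates for the multiples of it subtracted from
    -- the other rows.
    x : ℚ
    x = - ∑ (λ i → c′ i * ratio i)
    c : Fin (suc (suc n)) → ℚ
    c = insertAt c′ p x
    open ≡-Reasoning
    eliminate : ∀ k (h : Fin (suc n) → ℚ) → (∀ i → f (punchIn p i) k ≡ h i + ratio i * f p k) →
      ∑ (λ i → c′ i * h i) ≡ 0ℚ → ∑ (λ i → c i * f i k) ≡ 0ℚ
    eliminate k h split ∑h≡0 = begin
      ∑ (λ i → c i * f i k)
        ≡⟨ ∑-remove {i = p} (λ i → c i * f i k) ⟩
      c p * f p k + ∑ (λ i → c (punchIn p i) * f (punchIn p i) k)
        ≡⟨ cong₂ _+_ (cong (_* f p k) (insertAt-lookup c′ p x))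
            (∑-cong λ i → trans (cong₂ _*_ (insertAt-punchIn c′ p x i) (split i))
              (solve 4 (λ c h r f → c :* (h :+ r :* f) := c :* h :+ (c :* r) :* f) refl (c′ i) (h i) (ratio i) (f p k))) ⟩
      x * f p k + ∑ (λ i → c′ i * h i + (c′ i * ratio i) * f p k)
        ≡⟨ cong (λ y → x * f p k + y) (trans (∑-+ (λ i → c′ i * h i) (λ i → (c′ i * ratio i) * f p k)) (cong₂ _+_ ∑h≡0 (∑-*ʳ (λ i → c′ i * ratio i) (f p k)))) ⟩
      x * f p k + (0ℚ + ∑ (λ i → c′ i * ratio i) * f p k)
        ≡⟨ solve 2 (λ s f → (:- s) :* f :+ (con 0ℚ :+ s :* f) := con 0ℚ) refl (∑ (λ i → c′ i * ratio i)) (f p k) ⟩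
      0ℚ ∎
    rel′ : ∀ k → ∑ (λ i → c i * f i k) ≡ 0ℚ
    rel′ zero    = eliminate zero (λ _ → 0ℚ)
      (λ i → sym (begin
        0ℚ + (f (punchIn p i) zero * r) * f p zero ≡⟨ solve 3 (λ a r b → con 0ℚ :+ (a :* r) :* b := a :* (b :* r)) refl (f (punchIn p i) zero) r (f p zero) ⟩
        f (punchIn p i) zero * (f p zero * r)      ≡⟨ cong (f (punchIn p i) zero *_) fr≡1 ⟩
        f (punchIn p i) zero * 1ℚ                  ≡⟨ ℚ.*-identityʳ _ ⟩
        f (punchIn p i) zero                       ∎))
      (trans (∑-cong λ i → ℚ.*-zeroʳ (c′ i)) (∑-0 (suc n)))
    rel′ (suc k) = eliminate (suc k) (λ i → f (punchIn p i) (suc k) - ratio i * f p (suc k))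
      (λ i → solve 2 (λ a b → a := (a :- b) :+ b) refl (f (punchIn p i) (suc k)) (ratio i * f p (suc k)))
      (rel k)

abstract
  -- Together with `e` there is one vector too many, hence a relation; independence of `f` makes the
  -- coefficient of `e` in it nonzero, so the relation can be solved for `e`.
  independent⇒spanning : ∀ {n} (f : Fin n → Fin n → ℚ) →
    (∀ (c : Fin n → ℚ) → (∀ k → ∑ (λ i → c i * f i k) ≡ 0ℚ) → ∀ i → c i ≡ 0ℚ) →
    ∀ (e : Fin n → ℚ) → ∃ λ (w : Fin n → ℚ) → ∀ k → ∑ (λ i → w i * f i k) ≡ e k
  independent⇒spanning {n} f indep e with dependent n g
    where
    g : Fin (suc n) → Fin n → ℚ
    g zero    = e
    g (suc i) = f i
  ... | c , (i , ci≢0) , rel = w , span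
    where
    c0≢0 : c zero ≢ 0ℚ
    c0≢0 c0≡0 = ci≢0 (all-0 i)
      where
      all-0 : ∀ i → c i ≡ 0ℚ
      all-0 zero    = c0≡0
      all-0 (suc i) = indep (c ∘ suc) (λ k → trans (sym (trans
        (cong (_+ ∑ (λ i → c (suc i) * f i k)) (trans (cong (_* e k) c0≡0) (ℚ.*-zeroˡ (e k)))) (ℚ.+-identityˡ _))) (rel k)) i
    r : ℚ
    r = proj₁ (inverse c0≢0)
    w : Fin n → ℚ
    w i = - r * c (suc i)
    open ≡-Reasoning
    span : ∀ k → ∑ (λ i → w i * f i k) ≡ e k
    span k = begin
      ∑ (λ i → w i * f i k)                          ≡⟨ ∑-cong (λ i → ℚ.*-assoc (- r) (c (suc i)) (f i k)) ⟩
      ∑ (λ i → - r * (c (suc i) * f i k))            ≡⟨ ∑-*ˡ (- r) (λ i → c (suc i) * f i k) ⟩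
      - r * ∑ (λ i → c (suc i) * f i k)              ≡⟨ solve 4 (λ r c e s → (:- r) :* s := (c :* r) :* e :- r :* (c :* e :+ s)) refl r (c zero) (e k) (∑ (λ i → c (suc i) * f i k)) ⟩
      (c zero * r) * e k - r * (c zero * e k + ∑ (λ i → c (suc i) * f i k))
                                                     ≡⟨ cong₂ (λ x y → x * e k - r * y) (proj₂ (inverse c0≢0)) (rel k) ⟩
      1ℚ * e k - r * 0ℚ                              ≡⟨ solve 2 (λ e r → con 1ℚ :* e :- r :* con 0ℚ := e) refl (e k) r ⟩
      e k                                            ∎

-- Barycentric coordinates and interiors

lookup-ext : ∀ {A : Set} {n} {x y : Vec A n} → (∀ k → lookup x k ≡ lookup y k) → x ≡ y
lookup-ext {x = x} {y} h = trans (sym (tabulate∘lookup x)) (trans (tabulate-cong h) (tabulate∘lookup y))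

combination-lookup : ∀ {n d} (c : Fin n → ℚ) (v : Fin n → ℚ^ d) k →
  lookup (combination c v) k ≡ ∑ (λ i → c i * lookup (v i) k)
combination-lookup c v k = lookup∘tabulate (λ k → ∑ (λ i → c i * lookup (v i) k)) k

record Coordinates {n d} (v : Fin n → ℚ^ d) (b : Fin n → ℚ) (x : ℚ^ d) : Set where
  constructor coordinates
  field
    total : ∑ b ≡ 1ℚ
    point : ∀ k → ∑ (λ i → b i * lookup (v i) k) ≡ lookup x k

open Coordinates

fromBarycentric : ∀ {n d} (v : Fin n → ℚ^ d) b x → IsBarycentric v b x → Coordinates v b x
fromBarycentric v b x (∑b≡1 , eq) = coordinates ∑b≡1
  λ k → trans (sym (combination-lookup b v k)) (cong (λ x → lookup x k) eq)

toBarycentric : ∀ {n d} {v : Fin n → ℚ^ d} {b x} → Coordinates v b x → IsBarycentric v b x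
toBarycentric {v = v} {b} B = total B , lookup-ext λ k → trans (combination-lookup b v k) (point B k)

barycentric-unique : ∀ {n d} {v : Fin n → ℚ^ d} → AffinelyIndependent v → ∀ {a b x} →
  Coordinates v a x → Coordinates v b x → ∀ i → a i ≡ b i
barycentric-unique {d = d} {v} indep {a} {b} {x} A B i = -⇒≡ (indep (λ i → a i - b i)
  (trans (∑-- a b) (≡⇒- (trans (total A) (sym (total B)))))
  (lookup-ext λ k → begin
    lookup (combination (λ i → a i - b i) v) k
      ≡⟨ combination-lookup (λ i → a i - b i) v k ⟩
    ∑ (λ i → (a i - b i) * lookup (v i) k)
      ≡⟨ ∑-cong (λ i → solve 3 (λ a b v → (a :- b) :* v := a :* v :- b :* v) refl (a i) (b i) (lookup (v i) k)) ⟩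
    ∑ (λ i → a i * lookup (v i) k - b i * lookup (v i) k)
      ≡⟨ ∑-- (λ i → a i * lookup (v i) k) (λ i → b i * lookup (v i) k) ⟩
    ∑ (λ i → a i * lookup (v i) k) - ∑ (λ i → b i * lookup (v i) k)
      ≡⟨ ≡⇒- (trans (point A k) (sym (point B k))) ⟩
    0ℚ
      ≡⟨ lookup-replicate k 0ℚ ⟨
    lookup (replicate d 0ℚ) k ∎) i)
  where open ≡-Reasoning

-- Affine independence of v is linear independence of the vectors (1 , v j).
homogenize : ∀ {n d} → (Fin n → ℚ^ d) → Fin n → Fin (suc d) → ℚ
homogenize v j zero    = 1ℚ
homogenize v j (suc k) = lookup (v j) k

affine : ∀ {n d} → (Fin n → Fin d → ℚ) → (Fin n → ℚ) → ℚ^ d → Fin n → ℚ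
affine M m x j = ∑ (λ c → M j c * lookup x c) + m j

abstract
  -- The coordinates are the row vector `(1 , x)` times the inverse `W` of the homogenized vertex
  -- matrix, hence affine in `x`; row `zero` of `W` supplies the constant terms.
  barycentric-coordinates : ∀ {d} (v : Fin (suc d) → ℚ^ d) → AffinelyIndependent v →
    Σ (Fin (suc d) → Fin d → ℚ) λ M → Σ (Fin (suc d) → ℚ) λ m → ∀ x → Coordinates v (affine M m x) x
  barycentric-coordinates {d} v indep = M , m , λ x → coordinates
    (trans (∑-cong λ j → sym (ℚ.*-identityʳ (affine M m x j))) (trans (column x zero) (trans (cong (_+ 1ℚ)
      (trans (∑-cong λ c → ℚ.*-zeroˡ (lookup x c)) (∑-0 d))) refl)))
    (λ k → trans (column x (suc k)) (trans (ℚ.+-identityʳ _) (∑-δ k (lookup x))))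
    where
    V : Fin (suc d) → Fin (suc d) → ℚ
    V = homogenize v
    V-indep : ∀ (c : Fin (suc d) → ℚ) → (∀ k → ∑ (λ i → c i * V i k) ≡ 0ℚ) → ∀ i → c i ≡ 0ℚ
    V-indep c h = indep c
      (trans (∑-cong λ i → sym (ℚ.*-identityʳ (c i))) (h zero))
      (lookup-ext λ k → trans (combination-lookup c v k) (trans (h (suc k)) (sym (lookup-replicate k 0ℚ))))
    W : Fin (suc d) → Fin (suc d) → ℚ
    W r = proj₁ (independent⇒spanning V V-indep (λ s → δ s r))
    W-inverse : ∀ r s → ∑ (λ j → W r j * V j s) ≡ δ s r
    W-inverse r = proj₂ (independent⇒spanning V V-indep (λ s → δ s r))
    M : Fin (suc d) → Fin d → ℚ
    M j c = W (suc c) j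
    m : Fin (suc d) → ℚ
    m = W zero
    open ≡-Reasoning
    column : ∀ x s → ∑ (λ j → affine M m x j * V j s) ≡ ∑ (λ c → δ s (suc c) * lookup x c) + δ s zero
    column x s = begin
      ∑ (λ j → affine M m x j * V j s)
        ≡⟨ ∑-cong (λ j → trans (ℚ.*-distribʳ-+ (V j s) (∑ (λ c → M j c * lookup x c)) (m j))
             (cong (_+ m j * V j s) (sym (∑-*ʳ (λ c → M j c * lookup x c) (V j s))))) ⟩
      ∑ (λ j → ∑ (λ c → (M j c * lookup x c) * V j s) + m j * V j s)
        ≡⟨ ∑-+ (λ j → ∑ (λ c → (M j c * lookup x c) * V j s)) (λ j → m j * V j s) ⟩
      ∑ (λ j → ∑ (λ c → (M j c * lookup x c) * V j s)) + ∑ (λ j → m j * V j s)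
        ≡⟨ cong₂ _+_ (∑-swap (λ j c → (M j c * lookup x c) * V j s)) (W-inverse zero s) ⟩
      ∑ (λ c → ∑ (λ j → (M j c * lookup x c) * V j s)) + δ s zero
        ≡⟨ cong (_+ δ s zero) (∑-cong λ c → begin
             ∑ (λ j → (M j c * lookup x c) * V j s)
               ≡⟨ ∑-cong (λ j → solve 3 (λ m x v → (m :* x) :* v := (m :* v) :* x) refl (M j c) (lookup x c) (V j s)) ⟩
             ∑ (λ j → (M j c * V j s) * lookup x c)
               ≡⟨ ∑-*ʳ (λ j → M j c * V j s) (lookup x c) ⟩
             ∑ (λ j → M j c * V j s) * lookup x c
               ≡⟨ cong (_* lookup x c) (W-inverse (suc c) s) ⟩
             δ s (suc c) * lookup x c ∎) ⟩
      ∑ (λ c → δ s (suc c) * lookup x c) + δ s zero ∎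

abstract
  positive-lower-bound : ∀ {n} (f : Fin n → ℚ) → (∀ i → 0ℚ < f i) → ∃ λ ε → 0ℚ < ε × (∀ i → ε ≤ f i)
  positive-lower-bound {zero}  f h = 1ℚ , 0<1 , λ ()
  positive-lower-bound {suc n} f h with ε , 0<ε , ε≤ ← positive-lower-bound (f ∘ suc) (h ∘ suc) =
    f zero ⊓ ε , 0<min , λ where
      zero    → ℚ.p⊓q≤p (f zero) ε
      (suc i) → ℚ.≤-trans (ℚ.p⊓q≤q (f zero) ε) (ε≤ i)
    where
    0<min : 0ℚ < f zero ⊓ ε
    0<min with ℚ.⊓-sel (f zero) ε
    ... | inj₁ eq = subst (0ℚ <_) (sym eq) (h zero)
    ... | inj₂ eq = subst (0ℚ <_) (sym eq) 0<ε

0≤p+∣p∣ : ∀ p → 0ℚ ≤ p + ∣ p ∣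
0≤p+∣p∣ p with ℚ.∣p∣≡p∨∣p∣≡-p p
... | inj₁ eq = 0≤+ (ℚ.∣p∣≡p⇒0≤p eq) (ℚ.0≤∣p∣ p)
... | inj₂ eq = ℚ.≤-reflexive (sym (trans (cong (λ q → p + q) eq) (ℚ.+-inverseʳ p)))

-- Barycentric coordinates are affine, hence Lipschitz, functions of the point.
positive⇒interior : ∀ {d} {v : Fin (suc d) → ℚ^ d} → AffinelyIndependent v → ∀ {b x} →
  Coordinates v b x → (∀ j → 0ℚ < b j) → Interior (conv v) x
positive⇒interior {d} {v} indep {b} {x} B b>0 with M , m , coords ← barycentric-coordinates v indep =
  ε , 0<ε , λ y near → affine M m y , nonNeg y near , toBarycentric (coords y)
  where
  -- A Lipschitz constant of the coordinate `j` for the maximum norm; the summand 1 makes it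
  -- invertible even when the coordinate is constant.
  norm : Fin (suc d) → ℚ
  norm j = 1ℚ + ∑ (λ c → ∣ M j c ∣)
  norm>0 : ∀ j → 0ℚ < norm j
  norm>0 j = 0<+ 0<1 (∑-nonNeg (λ c → ℚ.0≤∣p∣ (M j c)))
  r : Fin (suc d) → ℚ
  r j = proj₁ (pos-inverse (norm>0 j))
  bound′ : ∃ λ ε → 0ℚ < ε × (∀ j → ε ≤ b j * r j)
  bound′ = positive-lower-bound (λ j → b j * r j) (λ j → 0<* (b>0 j) (proj₁ (proj₂ (pos-inverse (norm>0 j)))))
  ε : ℚ
  ε = proj₁ bound′
  0<ε : 0ℚ < ε
  0<ε = proj₁ (proj₂ bound′)
  nonNeg : ∀ y → (∀ k → ∣ lookup y k - lookup x k ∣ ≤ ε) → ∀ j → 0ℚ ≤ affine M m y j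
  nonNeg y near j = subst (0ℚ ≤_) (sym value) (ℚ.≤-trans (0≤p+∣p∣ Δ) (subst (Δ + ∣ Δ ∣ ≤_) (ℚ.+-comm Δ (b j)) (ℚ.+-monoʳ-≤ Δ ∣Δ∣≤b)))
    where
    Δ : ℚ
    Δ = ∑ (λ c → M j c * (lookup y c - lookup x c))
    value : affine M m y j ≡ b j + Δ
    value = begin
      ∑ (λ c → M j c * lookup y c) + m j
        ≡⟨ solve 3 (λ y x m → y :+ m := (x :+ m) :+ (y :- x)) refl (∑ (λ c → M j c * lookup y c)) (∑ (λ c → M j c * lookup x c)) (m j) ⟩
      affine M m x j + (∑ (λ c → M j c * lookup y c) - ∑ (λ c → M j c * lookup x c))
        ≡⟨ cong₂ _+_ (barycentric-unique indep (coords x) B j)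
             (trans (sym (∑-- (λ c → M j c * lookup y c) (λ c → M j c * lookup x c)))
               (∑-cong λ c → solve 3 (λ m y x → m :* y :- m :* x := m :* (y :- x)) refl (M j c) (lookup y c) (lookup x c))) ⟩
      b j + Δ ∎
      where open ≡-Reasoning
    open ℚ.≤-Reasoning
    ∣Δ∣≤b : ∣ Δ ∣ ≤ b j
    ∣Δ∣≤b = begin
      ∣ Δ ∣                                             ≤⟨ ∑-∣∣ (λ c → M j c * (lookup y c - lookup x c)) ⟩
      ∑ (λ c → ∣ M j c * (lookup y c - lookup x c) ∣)   ≤⟨ ∑-mono-≤ (λ c → subst (_≤ ∣ M j c ∣ * ε) (sym (ℚ.∣p*q∣≡∣p∣*∣q∣ (M j c) (lookup y c - lookup x c))) (*-mono-≤ˡ (ℚ.0≤∣p∣ (M j c)) (near c))) ⟩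
      ∑ (λ c → ∣ M j c ∣ * ε)                           ≡⟨ ∑-*ʳ (λ c → ∣ M j c ∣) ε ⟩
      ∑ (λ c → ∣ M j c ∣) * ε                           ≤⟨ *-mono-≤ʳ (ℚ.<⇒≤ 0<ε) (p≤q+p (∑ (λ c → ∣ M j c ∣)) (ℚ.<⇒≤ 0<1)) ⟩
      norm j * ε                                        ≤⟨ *-mono-≤ˡ (ℚ.<⇒≤ (norm>0 j)) (proj₂ (proj₂ bound′) j) ⟩
      norm j * (b j * r j)                              ≡⟨ solve 3 (λ n b r → n :* (b :* r) := b :* (n :* r)) refl (norm j) (b j) (r j) ⟩
      b j * (norm j * r j)                              ≡⟨ cong (b j *_) (proj₂ (proj₂ (pos-inverse (norm>0 j)))) ⟩
      b j * 1ℚ                                          ≡⟨ ℚ.*-identityʳ (b j) ⟩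
      b j                                               ∎

-- From an interior point x one can still move a little away from the vertex v j.
interior⇒positive : ∀ {n d} {v : Fin n → ℚ^ d} → AffinelyIndependent v → ∀ {b x} →
  Interior (conv v) x → Coordinates v b x → ∀ j → 0ℚ < b j
interior⇒positive {n} {d} {v} indep {b} {x} (ε , 0<ε , ball) B j = *-cancel-<ˡ (0<+ 0<1 (ℚ.<⇒≤ 0<η)) (begin-strict
    (1ℚ + η) * 0ℚ       ≡⟨ ℚ.*-zeroʳ (1ℚ + η) ⟩
    0ℚ                  <⟨ 0<η ⟩
    η                   ≡⟨ ℚ.+-identityʳ η ⟨
    η + 0ℚ              ≤⟨ ℚ.+-monoʳ-≤ η (proj₁ (proj₂ hull) j) ⟩
    η + proj₁ hull j             ≡⟨ cong (λ z → η + z) (trans (barycentric-unique indep (fromBarycentric v (proj₁ hull) y (proj₂ (proj₂ hull))) Y j) (cong (λ z → b j + η * (b j - z)) (δ-≡ j))) ⟩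
    η + (b j + η * (b j - 1ℚ)) ≡⟨ solve 2 (λ η b → η :+ (b :+ η :* (b :- con 1ℚ)) := (con 1ℚ :+ η) :* b) refl η (b j) ⟩
    (1ℚ + η) * b j      ∎)
  where
  dist : Fin d → ℚ
  dist k = ∣ lookup x k - lookup (v j) k ∣
  dist≥0 : ∀ k → 0ℚ ≤ dist k
  dist≥0 k = ℚ.0≤∣p∣ (lookup x k - lookup (v j) k)
  size : ℚ
  size = 1ℚ + ∑ dist
  size>0 : 0ℚ < size
  size>0 = 0<+ 0<1 (∑-nonNeg dist≥0)
  r : ℚ
  r = proj₁ (pos-inverse size>0)
  η : ℚ
  η = ε * r
  0<η : 0ℚ < η
  0<η = 0<* 0<ε (proj₁ (proj₂ (pos-inverse size>0)))
  y : ℚ^ d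
  y = tabulate λ k → lookup x k + η * (lookup x k - lookup (v j) k)
  y-lookup : ∀ k → lookup y k ≡ lookup x k + η * (lookup x k - lookup (v j) k)
  y-lookup k = lookup∘tabulate (λ k → lookup x k + η * (lookup x k - lookup (v j) k)) k
  open ℚ.≤-Reasoning
  near : ∀ k → ∣ lookup y k - lookup x k ∣ ≤ ε
  near k = begin
    ∣ lookup y k - lookup x k ∣                 ≡⟨ cong (λ z → ∣ z - lookup x k ∣) (y-lookup k) ⟩
    ∣ (lookup x k + η * (lookup x k - lookup (v j) k)) - lookup x k ∣
                                                ≡⟨ cong ∣_∣ (solve 2 (λ x e → (x :+ e) :- x := e) refl (lookup x k) (η * (lookup x k - lookup (v j) k))) ⟩
    ∣ η * (lookup x k - lookup (v j) k) ∣       ≡⟨ ℚ.∣p*q∣≡∣p∣*∣q∣ η (lookup x k - lookup (v j) k) ⟩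
    ∣ η ∣ * dist k                              ≡⟨ cong (_* dist k) (ℚ.0≤p⇒∣p∣≡p (ℚ.<⇒≤ 0<η)) ⟩
    η * dist k                                  ≤⟨ *-mono-≤ˡ (ℚ.<⇒≤ 0<η) (ℚ.≤-trans (f≤∑f dist≥0 k) (p≤q+p (∑ dist) (ℚ.<⇒≤ 0<1))) ⟩
    η * size                                   ≡⟨ solve 3 (λ e r t → (e :* r) :* t := e :* (t :* r)) refl ε r size ⟩
    ε * (size * r)                             ≡⟨ cong (ε *_) (proj₂ (proj₂ (pos-inverse size>0))) ⟩
    ε * 1ℚ                                      ≡⟨ ℚ.*-identityʳ ε ⟩
    ε                                           ∎
  hull : conv v y
  hull = ball y near
  -- The coordinates of `y`. Nonnegativity of the one at `j` reads `(1 + η) b j ≥ η`, which bounds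
  -- `b j` away from 0.
  a : Fin n → ℚ
  a l = b l + η * (b l - δ j l)
  linear : ∀ (u : Fin n → ℚ) → ∑ (λ l → a l * u l) ≡ ∑ (λ l → b l * u l) + η * (∑ (λ l → b l * u l) - u j)
  linear u = begin-equality
    ∑ (λ l → a l * u l)
      ≡⟨ ∑-cong (λ l → solve 4 (λ b η d u → (b :+ η :* (b :- d)) :* u := b :* u :+ η :* (b :* u :- d :* u)) refl (b l) η (δ j l) (u l)) ⟩
    ∑ (λ l → b l * u l + η * (b l * u l - δ j l * u l))
      ≡⟨ ∑-+ (λ l → b l * u l) (λ l → η * (b l * u l - δ j l * u l)) ⟩
    ∑ (λ l → b l * u l) + ∑ (λ l → η * (b l * u l - δ j l * u l))
      ≡⟨ cong (λ z → ∑ (λ l → b l * u l) + z) (trans (∑-*ˡ η (λ l → b l * u l - δ j l * u l))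
           (cong (η *_) (trans (∑-- (λ l → b l * u l) (λ l → δ j l * u l)) (cong (λ z → ∑ (λ l → b l * u l) - z) (∑-δ j u))))) ⟩
    ∑ (λ l → b l * u l) + η * (∑ (λ l → b l * u l) - u j) ∎
  ∑b*1 : ∑ (λ l → b l * 1ℚ) ≡ 1ℚ
  ∑b*1 = trans (∑-cong λ l → ℚ.*-identityʳ (b l)) (total B)
  Y : Coordinates v a y
  Y = coordinates
    (begin-equality
      ∑ a                       ≡⟨ ∑-cong (λ l → sym (ℚ.*-identityʳ (a l))) ⟩
      ∑ (λ l → a l * 1ℚ)        ≡⟨ linear (λ _ → 1ℚ) ⟩
      ∑ (λ l → b l * 1ℚ) + η * (∑ (λ l → b l * 1ℚ) - 1ℚ) ≡⟨ cong (λ z → z + η * (z - 1ℚ)) ∑b*1 ⟩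
      1ℚ + η * (1ℚ - 1ℚ)        ≡⟨ solve 1 (λ η → con 1ℚ :+ η :* (con 1ℚ :- con 1ℚ) := con 1ℚ) refl η ⟩
      1ℚ                        ∎)
    (λ k → trans (linear (λ l → lookup (v l) k))
      (trans (cong (λ z → z + η * (z - lookup (v j) k)) (point B k)) (sym (y-lookup k))))

-- Prefix sums, AM-GM and the Sylvester sequence

Σ< Π< : ℕ → (ℕ → ℚ) → ℚ
Σ< zero    f = 0ℚ
Σ< (suc n) f = Σ< n f + f n
Π< zero    f = 1ℚ
Π< (suc n) f = Π< n f * f n

Σ<-cong : ∀ n {f g} → (∀ j → j ℕ.< n → f j ≡ g j) → Σ< n f ≡ Σ< n g
Σ<-cong zero    h = refl
Σ<-cong (suc n) h = cong₂ _+_ (Σ<-cong n λ j j<n → h j (ℕ.m<n⇒m<1+n j<n)) (h n (ℕ.n<1+n n))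

Π<-cong : ∀ n {f g} → (∀ j → j ℕ.< n → f j ≡ g j) → Π< n f ≡ Π< n g
Π<-cong zero    h = refl
Π<-cong (suc n) h = cong₂ _*_ (Π<-cong n λ j j<n → h j (ℕ.m<n⇒m<1+n j<n)) (h n (ℕ.n<1+n n))

Σ<-head : ∀ n f → Σ< (suc n) f ≡ f 0 + Σ< n (f ∘ suc)
Σ<-head zero    f = trans (ℚ.+-identityˡ (f 0)) (sym (ℚ.+-identityʳ (f 0)))
Σ<-head (suc n) f = trans (cong (_+ f (suc n)) (Σ<-head n f)) (ℚ.+-assoc (f 0) (Σ< n (f ∘ suc)) (f (suc n)))

Π<-head : ∀ n f → Π< (suc n) f ≡ f 0 * Π< n (f ∘ suc)
Π<-head zero    f = trans (ℚ.*-identityˡ (f 0)) (sym (ℚ.*-identityʳ (f 0)))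
Π<-head (suc n) f = trans (cong (_* f (suc n)) (Π<-head n f)) (ℚ.*-assoc (f 0) (Π< n (f ∘ suc)) (f (suc n)))

∑-toℕ : ∀ n f → ∑ {n} (f ∘ toℕ) ≡ Σ< n f
∑-toℕ zero    f = refl
∑-toℕ (suc n) f = trans (cong (λ x → f 0 + x) (∑-toℕ n (f ∘ suc))) (sym (Σ<-head n f))

Σ<-- : ∀ n f g → Σ< n (λ j → f j - g j) ≡ Σ< n f - Σ< n g
Σ<-- zero    f g = refl
Σ<-- (suc n) f g = trans (cong (_+ (f n - g n)) (Σ<-- n f g))
  (solve 4 (λ a b c d → (a :- b) :+ (c :- d) := (a :+ c) :- (b :+ d)) refl (Σ< n f) (Σ< n g) (f n) (g n))

Σ<-*ˡ : ∀ n c f → Σ< n (λ j → c * f j) ≡ c * Σ< n f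
Σ<-*ˡ zero    c f = sym (ℚ.*-zeroʳ c)
Σ<-*ˡ (suc n) c f = trans (cong (_+ c * f n) (Σ<-*ˡ n c f)) (sym (ℚ.*-distribˡ-+ c (Σ< n f) (f n)))

Π<-* : ∀ n f g → Π< n (λ j → f j * g j) ≡ Π< n f * Π< n g
Π<-* zero    f g = refl
Π<-* (suc n) f g = trans (cong (_* (f n * g n)) (Π<-* n f g))
  (solve 4 (λ a b c d → (a :* b) :* (c :* d) := (a :* c) :* (b :* d)) refl (Π< n f) (Π< n g) (f n) (g n))

Σ<-split : ∀ m n f → Σ< (m ℕ.+ n) f ≡ Σ< m f + Σ< n (λ j → f (m ℕ.+ j))
Σ<-split m zero    f = trans (cong (λ k → Σ< k f) (ℕ.+-identityʳ m)) (sym (ℚ.+-identityʳ (Σ< m f)))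
Σ<-split m (suc n) f = trans (cong (λ k → Σ< k f) (ℕ.+-suc m n)) (trans (cong (_+ f (m ℕ.+ n)) (Σ<-split m n f))
  (ℚ.+-assoc (Σ< m f) (Σ< n (λ j → f (m ℕ.+ j))) (f (m ℕ.+ n))))

⟦suc⟧ : ∀ n → ⟦ suc n ⟧ ≡ 1ℚ + ⟦ n ⟧
⟦suc⟧ n = trans (⟦⟧-+ 1 n) (cong (_+ ⟦ n ⟧) fromℤ-1)

Σ<-const : ∀ n c → Σ< n (λ _ → c) ≡ ⟦ n ⟧ * c
Σ<-const zero    c = sym (trans (cong (_* c) fromℤ-0) (ℚ.*-zeroˡ c))
Σ<-const (suc n) c = trans (cong (_+ c) (Σ<-const n c)) (trans
  (solve 2 (λ n c → n :* c :+ c := (con 1ℚ :+ n) :* c) refl ⟦ n ⟧ c) (cong (_* c) (sym (⟦suc⟧ n))))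

Σ<-mono-≤ : ∀ n {f g} → (∀ j → j ℕ.< n → f j ≤ g j) → Σ< n f ≤ Σ< n g
Σ<-mono-≤ zero    h = ℚ.≤-refl
Σ<-mono-≤ (suc n) h = ℚ.+-mono-≤ (Σ<-mono-≤ n λ j j<n → h j (ℕ.m<n⇒m<1+n j<n)) (h n (ℕ.n<1+n n))

Σ<-pos : ∀ n {f} → (∀ j → j ℕ.< suc n → 0ℚ < f j) → 0ℚ < Σ< (suc n) f
Σ<-pos n {f} h = ℚ.+-mono-≤-< (subst (_≤ Σ< n f) (trans (Σ<-const n 0ℚ) (ℚ.*-zeroʳ ⟦ n ⟧))
  (Σ<-mono-≤ n λ j j<n → ℚ.<⇒≤ (h j (ℕ.m<n⇒m<1+n j<n)))) (h n (ℕ.n<1+n n))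

Π<-pos : ∀ n {f} → (∀ j → j ℕ.< n → 0ℚ < f j) → 0ℚ < Π< n f
Π<-pos zero    h = 0<1
Π<-pos (suc n) h = 0<* (Π<-pos n λ j j<n → h j (ℕ.m<n⇒m<1+n j<n)) (h n (ℕ.n<1+n n))

Σ<-mono-≡ : ∀ n {f g} → (∀ j → j ℕ.< n → f j ≤ g j) → Σ< n g ≤ Σ< n f → ∀ j → j ℕ.< n → f j ≡ g j
Σ<-mono-≡ (suc n) {f} {g} h total j j<1+n with ℕ.m<1+n⇒m<n∨m≡n j<1+n
... | inj₂ refl = ℚ.≤-antisym (h n j<1+n) (0≤-⇒≤ (ℚ.≤-trans (≤⇒0≤- total) (begin
    (Σ< n f + f n) - (Σ< n g + g n)  ≡⟨ solve 4 (λ a b c d → (a :+ b) :- (c :+ d) := (b :- d) :- (c :- a)) refl (Σ< n f) (f n) (Σ< n g) (g n) ⟩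
    (f n - g n) - (Σ< n g - Σ< n f)  ≤⟨ ℚ.+-monoʳ-≤ (f n - g n) (ℚ.neg-antimono-≤ (≤⇒0≤- (Σ<-mono-≤ n λ j j<n → h j (ℕ.m<n⇒m<1+n j<n)))) ⟩
    (f n - g n) - 0ℚ                 ≡⟨ ℚ.+-identityʳ (f n - g n) ⟩
    f n - g n                        ∎)))
  where open ℚ.≤-Reasoning
... | inj₁ j<n = Σ<-mono-≡ n (λ j j<n → h j (ℕ.m<n⇒m<1+n j<n)) (0≤-⇒≤ (ℚ.≤-trans (≤⇒0≤- total) (begin
    (Σ< n f + f n) - (Σ< n g + g n)  ≡⟨ solve 4 (λ a b c d → (a :+ b) :- (c :+ d) := (a :- c) :- (d :- b)) refl (Σ< n f) (f n) (Σ< n g) (g n) ⟩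
    (Σ< n f - Σ< n g) - (g n - f n)  ≤⟨ ℚ.+-monoʳ-≤ (Σ< n f - Σ< n g) (ℚ.neg-antimono-≤ (≤⇒0≤- (h n (ℕ.n<1+n n)))) ⟩
    (Σ< n f - Σ< n g) - 0ℚ           ≡⟨ ℚ.+-identityʳ (Σ< n f - Σ< n g) ⟩
    Σ< n f - Σ< n g                  ∎))) j j<n
  where open ℚ.≤-Reasoning

-- Young's inequality and the equality case of AM-GM

infixr 8 _^_
_^_ : ℚ → ℕ → ℚ
u ^ n = Π< n (λ _ → u)

0<^ : ∀ {u} n → 0ℚ < u → 0ℚ < u ^ n
0<^ n 0<u = Π<-pos n λ _ _ → 0<u

-- The defect in AM-GM for `k` copies of `v ^ suc k` and one copy of `u ^ suc k`, multiplied by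
-- `suc k`; the powers spare any root.
young-gap : ℕ → ℚ → ℚ → ℚ
young-gap k u v = (⟦ k ⟧ * v ^ suc k + u ^ suc k) - ⟦ suc k ⟧ * (u * v ^ k)

-- This recursion proves nonnegativity by induction and also settles equality: for positive `u` and
-- `v` the square has positive weight, so a nonpositive gap at `suc k` forces `v ≡ u`.
young-gap-suc : ∀ k u v →
  young-gap (suc k) u v ≡ u * young-gap k u v + (⟦ suc k ⟧ * v ^ k) * ((v - u) * (v - u))
young-gap-suc k u v = begin
  (⟦ suc k ⟧ * ((v ^ k * v) * v) + (u ^ k * u) * u) - ⟦ suc (suc k) ⟧ * (u * (v ^ k * v))
    ≡⟨ cong₂ (λ x y → (x * ((v ^ k * v) * v) + (u ^ k * u) * u) - y * (u * (v ^ k * v))) (⟦suc⟧ k) (trans (⟦suc⟧ (suc k)) (cong (λ z → 1ℚ + z) (⟦suc⟧ k))) ⟩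
  ((1ℚ + ⟦ k ⟧) * ((v ^ k * v) * v) + (u ^ k * u) * u) - (1ℚ + (1ℚ + ⟦ k ⟧)) * (u * (v ^ k * v))
    ≡⟨ solve 5 (λ K U V u v → ((con 1ℚ :+ K) :* ((V :* v) :* v) :+ (U :* u) :* u) :- (con 1ℚ :+ (con 1ℚ :+ K)) :* (u :* (V :* v))
         := u :* ((K :* (V :* v) :+ U :* u) :- (con 1ℚ :+ K) :* (u :* V)) :+ ((con 1ℚ :+ K) :* V) :* ((v :- u) :* (v :- u)))
         refl ⟦ k ⟧ (u ^ k) (v ^ k) u v ⟩
  u * ((⟦ k ⟧ * (v ^ k * v) + u ^ k * u) - (1ℚ + ⟦ k ⟧) * (u * v ^ k)) + ((1ℚ + ⟦ k ⟧) * v ^ k) * ((v - u) * (v - u))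
    ≡⟨ cong (λ x → u * ((⟦ k ⟧ * (v ^ k * v) + u ^ k * u) - x * (u * v ^ k)) + (x * v ^ k) * ((v - u) * (v - u))) (⟦suc⟧ k) ⟨
  u * young-gap k u v + (⟦ suc k ⟧ * v ^ k) * ((v - u) * (v - u)) ∎
  where open ≡-Reasoning

young : ∀ k {u v} → 0ℚ < u → 0ℚ < v → 0ℚ ≤ young-gap k u v
young zero    {u} {v} 0<u 0<v = ℚ.≤-reflexive (sym (trans
  (cong₂ (λ x y → (x * (1ℚ * v) + 1ℚ * u) - y * (u * 1ℚ)) fromℤ-0 fromℤ-1)
  (solve 2 (λ u v → (con 0ℚ :* (con 1ℚ :* v) :+ con 1ℚ :* u) :- con 1ℚ :* (u :* con 1ℚ) := con 0ℚ) refl u v)))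
young (suc k) {u} {v} 0<u 0<v = subst (0ℚ ≤_) (sym (young-gap-suc k u v))
  (0≤+ (0≤* (ℚ.<⇒≤ 0<u) (young k 0<u 0<v)) (0≤* (0≤* (0≤⟦⟧ (suc k)) (ℚ.<⇒≤ (0<^ k 0<v))) (0≤p*p (v - u))))

-- The number `u` is at least the arithmetic and at most the geometric mean, which states equality
-- of the means without an `m`-th root. It is left arbitrary because the induction applies the
-- hypothesis both to `u` and to the mean of the terms but the last.
AMGM-Equality : ℕ → Set
AMGM-Equality m = ∀ {t u} → 0ℚ < u → (∀ j → j ℕ.< m → 0ℚ < t j) →
  Σ< m t ≤ ⟦ m ⟧ * u → u ^ m ≤ Π< m t → ∀ j → j ℕ.< m → t j ≡ u

-- v is the mean of all the numbers but the last; Young's inequality forces v = u.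
amgm-step : ∀ k → AMGM-Equality (suc k) → AMGM-Equality (suc (suc k))
amgm-step k IH {t} {u} 0<u t>0 sum≤ ≤prod j j<1+n = conclude (ℕ.m<1+n⇒m<n∨m≡n j<1+n)
  where
  open ℚ.≤-Reasoning
  n : ℕ
  n = suc k
  t>0′ : ∀ j → j ℕ.< n → 0ℚ < t j
  t>0′ j j<n = t>0 j (ℕ.m<n⇒m<1+n j<n)
  a P r v : ℚ
  a = t n
  P = Π< n t
  r = proj₁ (pos-inverse (0<⟦⟧ n))
  v = Σ< n t * r
  0<v : 0ℚ < v
  0<v = 0<* (Σ<-pos k t>0′) (proj₁ (proj₂ (pos-inverse (0<⟦⟧ n))))
  sum≡ : Σ< n t ≡ ⟦ n ⟧ * v
  sum≡ = begin-equality
    Σ< n t                  ≡⟨ ℚ.*-identityʳ (Σ< n t) ⟨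
    Σ< n t * 1ℚ             ≡⟨ cong (Σ< n t *_) (proj₂ (proj₂ (pos-inverse (0<⟦⟧ n)))) ⟨
    Σ< n t * (⟦ n ⟧ * r)    ≡⟨ solve 3 (λ s n r → s :* (n :* r) := n :* (s :* r)) refl (Σ< n t) ⟦ n ⟧ r ⟩
    ⟦ n ⟧ * v               ∎
  -- The equality case also yields the inequality: if the product reaches `v ^ n`, the induction
  -- hypothesis with `v` in place of `u` makes every term equal to `v`.
  P≤v^n : P ≤ v ^ n
  P≤v^n with ℚ.≤-total P (v ^ n)
  ... | inj₁ le = le
  ... | inj₂ ge = ℚ.≤-reflexive (Π<-cong n (IH 0<v t>0′ (ℚ.≤-reflexive sum≡) ge))
  a≤ : a ≤ (1ℚ + ⟦ n ⟧) * u - ⟦ n ⟧ * v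
  a≤ = begin
    a                               ≡⟨ solve 2 (λ a s → a := (s :+ a) :- s) refl a (Σ< n t) ⟩
    (Σ< n t + a) - Σ< n t           ≤⟨ ℚ.+-monoˡ-≤ (- Σ< n t) sum≤ ⟩
    ⟦ suc n ⟧ * u - Σ< n t          ≡⟨ cong₂ (λ x y → x * u - y) (⟦suc⟧ n) sum≡ ⟩
    (1ℚ + ⟦ n ⟧) * u - ⟦ n ⟧ * v    ∎
  u^n*u≤v^n*a : u ^ n * u ≤ v ^ n * a
  u^n*u≤v^n*a = ℚ.≤-trans ≤prod (*-mono-≤ʳ (ℚ.<⇒≤ (t>0 n (ℕ.n<1+n n))) P≤v^n)
  gap≤0 : young-gap n u v ≤ 0ℚ
  gap≤0 = begin
    (⟦ n ⟧ * (v ^ n * v) + u ^ n * u) - ⟦ suc n ⟧ * (u * v ^ n)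
      ≡⟨ cong (λ x → (⟦ n ⟧ * (v ^ n * v) + u ^ n * u) - x * (u * v ^ n)) (⟦suc⟧ n) ⟩
    (⟦ n ⟧ * (v ^ n * v) + u ^ n * u) - (1ℚ + ⟦ n ⟧) * (u * v ^ n)
      ≡⟨ solve 5 (λ N V v U u → (N :* (V :* v) :+ U) :- (con 1ℚ :+ N) :* (u :* V) := U :- V :* ((con 1ℚ :+ N) :* u :- N :* v)) refl ⟦ n ⟧ (v ^ n) v (u ^ n * u) u ⟩
    u ^ n * u - v ^ n * ((1ℚ + ⟦ n ⟧) * u - ⟦ n ⟧ * v)
      ≤⟨ ℚ.+-mono-≤ u^n*u≤v^n*a (ℚ.neg-antimono-≤ (*-mono-≤ˡ (ℚ.<⇒≤ (0<^ n 0<v)) a≤)) ⟩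
    v ^ n * a - v ^ n * a
      ≡⟨ ℚ.+-inverseʳ (v ^ n * a) ⟩
    0ℚ ∎
  weight : ℚ
  weight = ⟦ n ⟧ * v ^ k
  weight>0 : 0ℚ < weight
  weight>0 = 0<* (0<⟦⟧ n) (0<^ k 0<v)
  v≡u : v ≡ u
  v≡u = -⇒≡ (p*p≤0⇒p≡0 (v - u) (*-cancel-≤ˡ weight>0 (begin
    weight * ((v - u) * (v - u))                          ≤⟨ p≤q+p (weight * ((v - u) * (v - u))) (0≤* (ℚ.<⇒≤ 0<u) (young k 0<u 0<v)) ⟩
    u * young-gap k u v + weight * ((v - u) * (v - u))    ≡⟨ young-gap-suc k u v ⟨
    young-gap n u v                                       ≤⟨ gap≤0 ⟩
    0ℚ                                                    ≡⟨ ℚ.*-zeroʳ weight ⟨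
    weight * 0ℚ                                           ∎)))
  a≡u : a ≡ u
  a≡u = ℚ.≤-antisym
    (begin
      a                              ≤⟨ a≤ ⟩
      (1ℚ + ⟦ n ⟧) * u - ⟦ n ⟧ * v   ≡⟨ cong (λ v → (1ℚ + ⟦ n ⟧) * u - ⟦ n ⟧ * v) v≡u ⟩
      (1ℚ + ⟦ n ⟧) * u - ⟦ n ⟧ * u   ≡⟨ solve 2 (λ n u → (con 1ℚ :+ n) :* u :- n :* u := u) refl ⟦ n ⟧ u ⟩
      u                              ∎)
    (*-cancel-≤ˡ (0<^ n 0<u) (subst (λ v → u ^ n * u ≤ v ^ n * a) v≡u u^n*u≤v^n*a))
  u^n≤P : u ^ n ≤ P
  u^n≤P = *-cancel-≤ˡ 0<u (begin
    u * u ^ n  ≡⟨ ℚ.*-comm u (u ^ n) ⟩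
    u ^ n * u  ≤⟨ ≤prod ⟩
    P * a      ≡⟨ cong (P *_) a≡u ⟩
    P * u      ≡⟨ ℚ.*-comm P u ⟩
    u * P      ∎)
  conclude : j ℕ.< n ⊎ j ≡ n → t j ≡ u
  conclude (inj₁ j<n)  = IH 0<u t>0′ (ℚ.≤-reflexive (trans sum≡ (cong (⟦ n ⟧ *_) v≡u))) u^n≤P j j<n
  conclude (inj₂ refl) = a≡u

amgm-equality : ∀ m → AMGM-Equality m
amgm-equality (suc zero) {t} {u} 0<u t>0 sum≤ ≤prod zero _ = ℚ.≤-antisym
  (begin
    t 0        ≡⟨ ℚ.+-identityˡ (t 0) ⟨
    0ℚ + t 0   ≤⟨ sum≤ ⟩
    ⟦ 1 ⟧ * u  ≡⟨ cong (_* u) fromℤ-1 ⟩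
    1ℚ * u     ≡⟨ ℚ.*-identityˡ u ⟩
    u          ∎)
  (begin
    u          ≡⟨ ℚ.*-identityˡ u ⟨
    1ℚ * u     ≤⟨ ≤prod ⟩
    1ℚ * t 0   ≡⟨ ℚ.*-identityˡ (t 0) ⟩
    t 0        ∎)
  where open ℚ.≤-Reasoning
amgm-equality (suc zero) _ _ _ _ (suc j) (ℕ.s≤s ())
amgm-equality (suc (suc k)) = amgm-step k (amgm-equality (suc k))

-- Each proper partial sum of `c` is nonnegative, so raising its factor from `y j` to `y (suc j)`
-- cannot decrease it. The full sum is left free in sign: in the application it is at most 0.
abel-≤ : ∀ k {c y : ℕ → ℚ} → (∀ j → j ℕ.≤ k → 0ℚ ≤ Σ< j c) → (∀ j → j ℕ.< k → y j ≤ y (suc j)) →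
  Σ< (suc k) (λ j → c j * y j) ≤ Σ< (suc k) c * y k
abel-≤ zero {c} {y} _ _ = ℚ.≤-reflexive (trans (ℚ.+-identityˡ (c 0 * y 0)) (cong (_* y 0) (sym (ℚ.+-identityˡ (c 0)))))
abel-≤ (suc k) {c} {y} C≥0 y-mono = begin
  Σ< (suc k) (λ j → c j * y j) + c (suc k) * y (suc k)
    ≤⟨ ℚ.+-monoˡ-≤ (c (suc k) * y (suc k)) (abel-≤ k (λ j j≤k → C≥0 j (ℕ.m≤n⇒m≤1+n j≤k)) (λ j j<k → y-mono j (ℕ.m<n⇒m<1+n j<k))) ⟩
  Σ< (suc k) c * y k + c (suc k) * y (suc k)
    ≤⟨ ℚ.+-monoˡ-≤ (c (suc k) * y (suc k)) (*-mono-≤ˡ (C≥0 (suc k) ℕ.≤-refl) (y-mono k (ℕ.n<1+n k))) ⟩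
  Σ< (suc k) c * y (suc k) + c (suc k) * y (suc k)
    ≡⟨ ℚ.*-distribʳ-+ (y (suc k)) (Σ< (suc k) c) (c (suc k)) ⟨
  Σ< (suc (suc k)) c * y (suc k) ∎
  where open ℚ.≤-Reasoning

-- Sylvester's sequence as the extremal case

1/s : ℕ → ℚ
1/s j = _/_ (+ 1) (s j) ⦃ +1-nonZero (∏s j) ⦄

s*1/s : ∀ j → ⟦ s j ⟧ * 1/s j ≡ 1ℚ
s*1/s j = 1/-inverse (s j) ⦃ +1-nonZero (∏s j) ⦄

0<1/s : ∀ j → 0ℚ < 1/s j
0<1/s j = 0<1/ (s j) ⦃ +1-nonZero (∏s j) ⦄

∏s*Π1/s : ∀ m → ⟦ ∏s m ⟧ * Π< m 1/s ≡ 1ℚ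
∏s*Π1/s zero    = cong (_* 1ℚ) fromℤ-1
∏s*Π1/s (suc m) = begin
  ⟦ ∏s m ℕ.* s m ⟧ * (Π< m 1/s * 1/s m)         ≡⟨ cong (_* (Π< m 1/s * 1/s m)) (⟦⟧-* (∏s m) (s m)) ⟩
  (⟦ ∏s m ⟧ * ⟦ s m ⟧) * (Π< m 1/s * 1/s m)     ≡⟨ solve 4 (λ a b c d → (a :* b) :* (c :* d) := (a :* c) :* (b :* d)) refl ⟦ ∏s m ⟧ ⟦ s m ⟧ (Π< m 1/s) (1/s m) ⟩
  (⟦ ∏s m ⟧ * Π< m 1/s) * (⟦ s m ⟧ * 1/s m)     ≡⟨ cong₂ _*_ (∏s*Π1/s m) (s*1/s m) ⟩
  1ℚ ∎
  where open ≡-Reasoning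

⟦s⟧ : ∀ m → ⟦ s m ⟧ ≡ ⟦ ∏s m ⟧ + 1ℚ
⟦s⟧ m = trans (⟦⟧-+ (∏s m) 1) (cong (λ x → ⟦ ∏s m ⟧ + x) fromℤ-1)

-- The remainder after `m` terms is `1 / A` with `A = ∏s m`, and
-- `1 / A = 1 / (A + 1) + 1 / (A (A + 1))` splits off the next term, as `s m = A + 1`.
Σ1/s+Π1/s≡1 : ∀ m → Σ< m 1/s + Π< m 1/s ≡ 1ℚ
Σ1/s+Π1/s≡1 zero    = refl
Σ1/s+Π1/s≡1 (suc m) = begin
  (S + e) + P * e                 ≡⟨ cong (λ x → (S + x) + P * e) (ℚ.*-identityˡ e) ⟨
  (S + 1ℚ * e) + P * e            ≡⟨ cong (λ x → (S + x * e) + P * e) (∏s*Π1/s m) ⟨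
  (S + (A * P) * e) + P * e       ≡⟨ solve 4 (λ S A P e → (S :+ (A :* P) :* e) :+ P :* e := S :+ P :* ((A :+ con 1ℚ) :* e)) refl S A P e ⟩
  S + P * ((A + 1ℚ) * e)          ≡⟨ cong (λ x → S + P * (x * e)) (⟦s⟧ m) ⟨
  S + P * (⟦ s m ⟧ * e)           ≡⟨ cong (λ x → S + P * x) (s*1/s m) ⟩
  S + P * 1ℚ                      ≡⟨ cong (λ x → S + x) (ℚ.*-identityʳ P) ⟩
  S + P                           ≡⟨ Σ1/s+Π1/s≡1 m ⟩
  1ℚ                              ∎
  where
  open ≡-Reasoning
  S P e A : ℚ
  S = Σ< m 1/s
  P = Π< m 1/s
  e = 1/s m
  A = ⟦ ∏s m ⟧

-- Junk value: recip 0 = 0.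
abstract
  recip : ℚ → ℚ
  recip p with p ℚ.≟ 0ℚ
  ... | yes _   = 0ℚ
  ... | no  p≢0 = proj₁ (inverse p≢0)

  recip-inverse : ∀ {p} → 0ℚ < p → p * recip p ≡ 1ℚ
  recip-inverse {p} 0<p with p ℚ.≟ 0ℚ
  ... | yes p≡0 = ⊥-elim (>⇒≢ 0<p p≡0)
  ... | no  p≢0 = proj₂ (inverse p≢0)

recip-pos : ∀ {p} → 0ℚ < p → 0ℚ < recip p
recip-pos {p} 0<p = *-cancel-<ˡ 0<p (begin-strict
  p * 0ℚ      ≡⟨ ℚ.*-zeroʳ p ⟩
  0ℚ          <⟨ 0<1 ⟩
  1ℚ          ≡⟨ recip-inverse 0<p ⟨
  p * recip p ∎)
  where open ℚ.≤-Reasoning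

recip-antimono : ∀ {p q} → 0ℚ < p → p ≤ q → recip q ≤ recip p
recip-antimono {p} {q} 0<p p≤q = *-cancel-≤ˡ 0<p (*-cancel-≤ˡ 0<q (begin
  q * (p * recip q)  ≡⟨ solve 3 (λ q p r → q :* (p :* r) := p :* (q :* r)) refl q p (recip q) ⟩
  p * (q * recip q)  ≡⟨ cong (p *_) (recip-inverse 0<q) ⟩
  p * 1ℚ             ≡⟨ ℚ.*-identityʳ p ⟩
  p                  ≤⟨ p≤q ⟩
  q                  ≡⟨ ℚ.*-identityʳ q ⟨
  q * 1ℚ             ≡⟨ cong (q *_) (recip-inverse 0<p) ⟨
  q * (p * recip p)  ∎))
  where
  open ℚ.≤-Reasoning
  0<q : 0ℚ < q
  0<q = ℚ.<-≤-trans 0<p p≤q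

record ProductSum (m : ℕ) (x : ℕ → ℚ) : Set where
  field
    pos         : ∀ j → j ℕ.< m → 0ℚ < x j
    decreasing  : ∀ j → suc j ℕ.< m → x (suc j) ≤ x j
    product-sum : ∀ k → k ℕ.≤ m → Π< k x ≤ 1ℚ - Σ< k x

productSum-pred : ∀ {m x} → ProductSum (suc m) x → ProductSum m x
productSum-pred ps = record
  { pos         = λ j j<m → pos j (ℕ.m<n⇒m<1+n j<m)
  ; decreasing  = λ j j<m → decreasing j (ℕ.m<n⇒m<1+n j<m)
  ; product-sum = λ k k≤m → product-sum k (ℕ.m≤n⇒m≤1+n k≤m)
  }
  where open ProductSum ps

-- If ∑ x ≥ ∑ 1/s then ∏ x ≤ ∏ 1/s, so the quotients 1/(s x) have product at least 1,
-- while summation by parts bounds their mean by 1.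
sylvester-equality : ∀ m {x} → ProductSum m x → (∀ k → k ℕ.< m → Σ< k x ≤ Σ< k 1/s) →
  Σ< m 1/s ≤ Σ< m x → ∀ j → j ℕ.< m → x j ≡ 1/s j
sylvester-equality (suc k) {x} ps prefix ≥ j j<m = begin-equality
  x j                    ≡⟨ ℚ.*-identityʳ (x j) ⟨
  x j * 1ℚ               ≡⟨ cong (x j *_) (amgm-equality m 0<1 t>0 sum≤ ≤prod j j<m) ⟨
  x j * (1/s j * y j)    ≡⟨ solve 3 (λ x e y → x :* (e :* y) := e :* (x :* y)) refl (x j) (1/s j) (y j) ⟩
  1/s j * (x j * y j)    ≡⟨ cong (1/s j *_) (recip-inverse (pos j j<m)) ⟩
  1/s j * 1ℚ             ≡⟨ ℚ.*-identityʳ (1/s j) ⟩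
  1/s j                  ∎
  where
  open ProductSum ps
  open ℚ.≤-Reasoning
  m : ℕ
  m = suc k
  y t c : ℕ → ℚ
  y j = recip (x j)
  t j = 1/s j * y j
  c j = 1/s j - x j
  t>0 : ∀ j → j ℕ.< m → 0ℚ < t j
  t>0 j j<m = 0<* (0<1/s j) (recip-pos (pos j j<m))
  C≥0 : ∀ j → j ℕ.≤ k → 0ℚ ≤ Σ< j c
  C≥0 j j≤k = subst (0ℚ ≤_) (sym (Σ<-- j 1/s x)) (≤⇒0≤- (prefix j (ℕ.s≤s j≤k)))
  C≤0 : Σ< m c ≤ 0ℚ
  C≤0 = begin
    Σ< m c                 ≡⟨ Σ<-- m 1/s x ⟩
    Σ< m 1/s - Σ< m x      ≤⟨ ℚ.+-monoˡ-≤ (- Σ< m x) ≥ ⟩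
    Σ< m x - Σ< m x        ≡⟨ ℚ.+-inverseʳ (Σ< m x) ⟩
    0ℚ                     ∎
  sum≤ : Σ< m t ≤ ⟦ m ⟧ * 1ℚ
  sum≤ = 0≤-⇒≤ (ℚ.≤-trans (ℚ.neg-antimono-≤ excess≤0) (ℚ.≤-reflexive (trans (cong -_ excess) (solve 2 (λ a b → :- (a :- b) := b :- a) refl (Σ< m t) (⟦ m ⟧ * 1ℚ)))))
    where
    -- Since `x j * y j = 1`, each `c j * y j` is `t j - 1`, so the sum estimated by parts measures
    -- how far the mean of `t` lies above 1.
    excess : Σ< m (λ j → c j * y j) ≡ Σ< m t - ⟦ m ⟧ * 1ℚ
    excess = begin-equality
      Σ< m (λ j → c j * y j)        ≡⟨ Σ<-cong m (λ j j<m → trans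
                                         (solve 3 (λ e x y → (e :- x) :* y := e :* y :- x :* y) refl (1/s j) (x j) (y j))
                                         (cong (λ z → t j - z) (recip-inverse (pos j j<m)))) ⟩
      Σ< m (λ j → t j - 1ℚ)         ≡⟨ Σ<-- m t (λ _ → 1ℚ) ⟩
      Σ< m t - Σ< m (λ _ → 1ℚ)      ≡⟨ cong (λ z → Σ< m t - z) (Σ<-const m 1ℚ) ⟩
      Σ< m t - ⟦ m ⟧ * 1ℚ           ∎
    excess≤0 : Σ< m (λ j → c j * y j) ≤ 0ℚ
    excess≤0 = begin
      Σ< m (λ j → c j * y j)        ≤⟨ abel-≤ k C≥0 (λ j j<k → recip-antimono (pos (suc j) (ℕ.s≤s j<k)) (decreasing j (ℕ.s≤s j<k))) ⟩
      Σ< m c * y k                  ≤⟨ *-mono-≤ʳ (ℚ.<⇒≤ (recip-pos (pos k (ℕ.n<1+n k)))) C≤0 ⟩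
      0ℚ * y k                      ≡⟨ ℚ.*-zeroˡ (y k) ⟩
      0ℚ                            ∎
  Πx≤Π1/s : Π< m x ≤ Π< m 1/s
  Πx≤Π1/s = begin
    Π< m x              ≤⟨ product-sum m ℕ.≤-refl ⟩
    1ℚ - Σ< m x         ≤⟨ ℚ.+-monoʳ-≤ 1ℚ (ℚ.neg-antimono-≤ ≥) ⟩
    1ℚ - Σ< m 1/s       ≡⟨ cong (_- Σ< m 1/s) (Σ1/s+Π1/s≡1 m) ⟨
    (Σ< m 1/s + Π< m 1/s) - Σ< m 1/s ≡⟨ solve 2 (λ a b → (a :+ b) :- a := b) refl (Σ< m 1/s) (Π< m 1/s) ⟩
    Π< m 1/s            ∎
  1^ : ∀ n → 1ℚ ^ n ≡ 1ℚ
  1^ zero    = refl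
  1^ (suc n) = trans (ℚ.*-identityʳ (1ℚ ^ n)) (1^ n)
  ≤prod : 1ℚ ^ m ≤ Π< m t
  ≤prod = begin
    1ℚ ^ m                     ≡⟨ trans (1^ m) (sym (1^ m)) ⟩
    Π< m (λ _ → 1ℚ)            ≡⟨ Π<-cong m (λ j j<m → recip-inverse (pos j j<m)) ⟨
    Π< m (λ j → x j * y j)     ≡⟨ Π<-* m x y ⟩
    Π< m x * Π< m y            ≤⟨ *-mono-≤ʳ (ℚ.<⇒≤ (Π<-pos m (λ j j<m → recip-pos (pos j j<m)))) Πx≤Π1/s ⟩
    Π< m 1/s * Π< m y          ≡⟨ Π<-* m 1/s y ⟨
    Π< m t                     ∎

-- The shorter prefixes obey the bound by induction, which is what the equality case asks for; if
-- the longest sum reached or exceeded its bound, that case would make the two sums equal.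
sylvester-≤ : ∀ m {x} → ProductSum m x → ∀ k → k ℕ.≤ m → Σ< k x ≤ Σ< k 1/s
sylvester-≤ zero    ps zero ℕ.z≤n = ℚ.≤-refl
sylvester-≤ (suc m) {x} ps k k≤1+m with ℕ.m≤n⇒m<n∨m≡n k≤1+m
... | inj₁ (ℕ.s≤s k≤m) = sylvester-≤ m (productSum-pred ps) k k≤m
... | inj₂ refl with ℚ.≤-total (Σ< (suc m) x) (Σ< (suc m) 1/s)
...   | inj₁ le = le
...   | inj₂ ge = ℚ.≤-reflexive (Σ<-cong (suc m)
        (sylvester-equality (suc m) ps (λ { k (ℕ.s≤s k≤m) → sylvester-≤ m (productSum-pred ps) k k≤m }) ge))

-- The product-sum inequality

int-0 : IsInt 0ℚ
int-0 = + 0 , fromℤ-0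

int-1 : IsInt 1ℚ
int-1 = + 1 , fromℤ-1

Σ<-int : ∀ n {f} → (∀ j → j ℕ.< n → IsInt (f j)) → IsInt (Σ< n f)
Σ<-int zero    h = int-0
Σ<-int (suc n) h = int-+ (Σ<-int n λ j j<n → h j (ℕ.m<n⇒m<1+n j<n)) (h n (ℕ.n<1+n n))

nonNeg-int : ∀ {x} → IsInt x → 0ℚ ≤ x → ∃ λ k → ⟦ k ⟧ ≡ x
nonNeg-int (+ k      , eq) 0≤x = k , eq
nonNeg-int (-[1+ k ] , eq) 0≤x = ⊥-elim (ℚ.<-irrefl refl (ℚ.<-≤-trans
  (subst (fromℤ -[1+ k ] <_) fromℤ-0 (fromℤ-mono-< ℤ.-<+)) (subst (0ℚ ≤_) (sym eq) 0≤x)))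

common-denominator : ∀ n (β : ℕ → ℚ) → ∃ λ N → ℕ.NonZero N × (∀ j → j ℕ.< n → IsInt (⟦ N ⟧ * β j))
common-denominator zero    β = 1 , _ , λ _ ()
common-denominator (suc n) β with N , N≢0 , ints ← common-denominator n β =
  N ℕ.* den , ℕ.m*n≢0 N den ⦃ N≢0 ⦄ , ints′
  where
  den : ℕ
  den = ℚ.↧ₙ (β n)
  ints′ : ∀ j → j ℕ.< suc n → IsInt (⟦ N ℕ.* den ⟧ * β j)
  ints′ j j<1+n with ℕ.m<1+n⇒m<n∨m≡n j<1+n
  ... | inj₁ j<n = subst IsInt (trans (solve 3 (λ den N b → den :* (N :* b) := (N :* den) :* b) refl ⟦ den ⟧ ⟦ N ⟧ (β j)) (cong (_* β j) (sym (⟦⟧-* N den))))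
                     (int-* (int-⟦⟧ den) (ints j j<n))
  ... | inj₂ refl = subst IsInt (trans (sym (ℚ.*-assoc ⟦ N ⟧ ⟦ den ⟧ (β n))) (cong (_* β n) (sym (⟦⟧-* N den))))
                     (int-* (int-⟦⟧ N) (ℚ.↥ (β n) , sym (*↧≡↥ (β n))))

truncate : ℕ → (ℕ → ℚ) → ℕ → ℚ
truncate k f j with j ℕ.<? k
... | yes _ = f j
... | no  _ = 0ℚ

truncate-< : ∀ {k} f {j} → j ℕ.< k → truncate k f j ≡ f j
truncate-< {k} f {j} j<k with j ℕ.<? k
... | yes _   = refl
... | no  j≮k = ⊥-elim (j≮k j<k)

truncate-≥ : ∀ {k} f {j} → k ℕ.≤ j → truncate k f j ≡ 0ℚ
truncate-≥ {k} f {j} k≤j with j ℕ.<? k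
... | yes j<k = ⊥-elim (ℕ.<⇒≱ j<k k≤j)
... | no  _   = refl

truncate-int : ∀ k {f} → (∀ j → IsInt (f j)) → ∀ j → IsInt (truncate k f j)
truncate-int k h j with j ℕ.<? k
... | yes _ = h j
... | no  _ = int-0

Σ<-truncate : ∀ {k n} f → k ℕ.≤ n → Σ< n (truncate k f) ≡ Σ< k f
Σ<-truncate {k} {n} f k≤n = begin
  Σ< n (truncate k f)                           ≡⟨ cong (λ n → Σ< n (truncate k f)) (ℕ.m+[n∸m]≡n k≤n) ⟨
  Σ< (k ℕ.+ (n ℕ.∸ k)) (truncate k f)           ≡⟨ Σ<-split k (n ℕ.∸ k) (truncate k f) ⟩
  Σ< k (truncate k f) + Σ< (n ℕ.∸ k) (λ j → truncate k f (k ℕ.+ j))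
    ≡⟨ cong₂ _+_ (Σ<-cong k λ j j<k → truncate-< f j<k)
         (trans (Σ<-cong (n ℕ.∸ k) λ j _ → truncate-≥ f (ℕ.m≤m+n k j)) (trans (Σ<-const (n ℕ.∸ k) 0ℚ) (ℚ.*-zeroʳ ⟦ n ℕ.∸ k ⟧))) ⟩
  Σ< k f + 0ℚ                                   ≡⟨ ℚ.+-identityʳ (Σ< k f) ⟩
  Σ< k f                                        ∎
  where open ≡-Reasoning

Σ<-strict : ∀ {k n} f → k ℕ.< n → (∀ j → j ℕ.< n → 0ℚ < f j) → Σ< k f < Σ< n f
Σ<-strict {k} {n} f k<n f>0 with l , refl ← ℕ.m≤n⇒∃[o]m+o≡n k<n =
  subst (Σ< k f <_) (trans (sym (Σ<-split k (suc l) f)) (cong (λ n → Σ< n f) (ℕ.+-suc k l)))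
    (subst (_< Σ< k f + rest) (ℚ.+-identityʳ (Σ< k f)) (ℚ.+-monoʳ-< (Σ< k f)
      (Σ<-pos l λ j j<1+l → f>0 (k ℕ.+ j) (subst (k ℕ.+ j ℕ.<_) (ℕ.+-suc k l) (ℕ.+-monoʳ-< k j<1+l)))))
  where
  rest : ℚ
  rest = Σ< (suc l) (λ j → f (k ℕ.+ j))

-- Counting a box modulo a lattice

Σℕ : ℕ → (ℕ → ℕ) → ℕ
Σℕ zero    f = 0
Σℕ (suc n) f = Σℕ n f ℕ.+ f n

⟦Σℕ⟧ : ∀ n f → ⟦ Σℕ n f ⟧ ≡ Σ< n (λ j → ⟦ f j ⟧)
⟦Σℕ⟧ zero    f = fromℤ-0
⟦Σℕ⟧ (suc n) f = trans (⟦⟧-+ (Σℕ n f) (f n)) (cong (_+ ⟦ f n ⟧) (⟦Σℕ⟧ n f))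

box-size : ℕ → (ℕ → ℕ) → ℕ
box-size zero    b = 1
box-size (suc k) b = b 0 ℕ.* box-size k (b ∘ suc)

⟦box-size⟧ : ∀ k b → ⟦ box-size k b ⟧ ≡ Π< k (λ j → ⟦ b j ⟧)
⟦box-size⟧ zero    b = fromℤ-1
⟦box-size⟧ (suc k) b = trans (⟦⟧-* (b 0) (box-size k (b ∘ suc)))
  (trans (cong (⟦ b 0 ⟧ *_) (⟦box-size⟧ k (b ∘ suc))) (sym (Π<-head k (λ j → ⟦ b j ⟧))))

-- The mixed-radix digits enumerate the box of all u with u j < b j for j < k.
digit : ∀ k b → Fin (box-size k b) → ℕ → ℕ
digit zero    b x j       = 0
digit (suc k) b x zero    = toℕ (proj₁ (remQuot {b 0} (box-size k (b ∘ suc)) x))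
digit (suc k) b x (suc j) = digit k (b ∘ suc) (proj₂ (remQuot {b 0} (box-size k (b ∘ suc)) x)) j

digit-< : ∀ k b x j → j ℕ.< k → digit k b x j ℕ.< b j
digit-< (suc k) b x zero    _           = Fin.toℕ<n (proj₁ (remQuot {b 0} (box-size k (b ∘ suc)) x))
digit-< (suc k) b x (suc j) (ℕ.s≤s j<k) = digit-< k (b ∘ suc) (proj₂ (remQuot {b 0} (box-size k (b ∘ suc)) x)) j j<k

digit-injective : ∀ k b x y → (∀ j → j ℕ.< k → digit k b x j ≡ digit k b y j) → x ≡ y
digit-injective zero    b zero zero h = refl
digit-injective (suc k) b x y h = begin
  x                                                 ≡⟨ Fin.combine-remQuot {b 0} m x ⟨
  combine (proj₁ (remQuot {b 0} m x)) (proj₂ (remQuot {b 0} m x))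
    ≡⟨ cong₂ combine (Fin.toℕ-injective (h 0 ℕ.z<s)) (digit-injective k (b ∘ suc) _ _ λ j j<k → h (suc j) (ℕ.s≤s j<k)) ⟩
  combine (proj₁ (remQuot {b 0} m y)) (proj₂ (remQuot {b 0} m y)) ≡⟨ Fin.combine-remQuot {b 0} m y ⟩
  y                                                 ∎
  where
  open ≡-Reasoning
  m : ℕ
  m = box-size k (b ∘ suc)

-- The coordinates (1 + m) β − c, with c integral, are those of the integral point
-- (1 + m) p − ∑ c j v j, which must be p when it is interior.
UniqueMultiple : ℕ → (ℕ → ℚ) → Set
UniqueMultiple n β = ∀ (m : ℕ) (c : ℕ → ℚ) → (∀ j → IsInt (c j)) →
  Σ< n (λ j → (1ℚ + ⟦ m ⟧) * β j - c j) ≡ 1ℚ →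
  (∀ j → j ℕ.< n → 0ℚ < (1ℚ + ⟦ m ⟧) * β j - c j) →
  ∀ j → j ℕ.< n → (1ℚ + ⟦ m ⟧) * β j - c j ≡ β j

-- The box involves `suc k` of the `suc n` coordinates, so at least one is left outside; `g / N` is
-- the total of those left outside.
module Pigeonhole (n k : ℕ) (k<n : k ℕ.< n) (β : ℕ → ℚ) (β>0 : ∀ j → j ℕ.< suc n → 0ℚ < β j)
  (Σβ≡1 : Σ< (suc n) β ≡ 1ℚ) (unique : UniqueMultiple (suc n) β)
  (N : ℕ) (N≢0 : ℕ.NonZero N) (b : ℕ → ℕ) (Nβ : ∀ j → j ℕ.< suc n → ⟦ N ⟧ * β j ≡ ⟦ b j ⟧)
  (g : ℕ) (g≢0 : ℕ.NonZero g) (g≡ : ⟦ g ⟧ ≡ ⟦ N ⟧ * (1ℚ - Σ< (suc k) β)) where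

  private instance
    N-nonZero : ℕ.NonZero N
    N-nonZero = N≢0
    g-nonZero : ℕ.NonZero g
    g-nonZero = g≢0

  Box : Set
  Box = Fin (box-size (suc k) b)

  u : Box → ℕ → ℕ
  u = digit (suc k) b

  -- The entries of `N c − m b` with `m = ∑ c` add up to `m g`. For points with congruent digit sums
  -- modulo `g`, the difference of these quotients therefore recovers `m`.
  q : Box → ℕ
  q x = Σℕ (suc k) (u x) ℕ./ g

  -- Once `m` is the difference of the quotients, lattice equivalence says that each entry of
  -- `Δ + m b` is divisible by `N`; adding `b * q` to the digits turns this into a congruence
  -- between two numbers.
  shifted : Box → ℕ → ℕ
  shifted x j = u x (suc j) ℕ.+ b (suc j) ℕ.* q x

  -- A complete invariant of u modulo the lattice of all N c − (∑ c) b; the residue at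
  -- index 0 is determined by the others.
  code : Box → Fin (g ℕ.* N ℕ.^ k)
  code x = combine (Σℕ (suc k) (u x) ℕ.mod g) (funToFin {k} (λ j → shifted x (toℕ j) ℕ.mod N))

  mod-injective : ∀ {x y d} .⦃ _ : ℕ.NonZero d ⦄ → x ℕ.mod d ≡ y ℕ.mod d → x ℕ.% d ≡ y ℕ.% d
  mod-injective {x} {y} {d} eq = trans (sym (Fin.toℕ-fromℕ< (ℕ.m%n<n x d))) (trans (cong toℕ eq) (Fin.toℕ-fromℕ< (ℕ.m%n<n y d)))

  division : ∀ a d .⦃ _ : ℕ.NonZero d ⦄ → ⟦ a ⟧ ≡ ⟦ a ℕ.% d ⟧ + ⟦ a ℕ./ d ⟧ * ⟦ d ⟧
  division a d = trans (cong ⟦_⟧ (ℕ.m≡m%n+[m/n]*n a d))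
    (trans (⟦⟧-+ (a ℕ.% d) (a ℕ./ d ℕ.* d)) (cong (λ z → ⟦ a ℕ.% d ⟧ + z) (⟦⟧-* (a ℕ./ d) d)))

  difference : ∀ a a′ d .⦃ _ : ℕ.NonZero d ⦄ → a ℕ.% d ≡ a′ ℕ.% d →
    ⟦ a ⟧ - ⟦ a′ ⟧ ≡ (⟦ a ℕ./ d ⟧ - ⟦ a′ ℕ./ d ⟧) * ⟦ d ⟧
  difference a a′ d eq = trans
    (cong₂ _-_ (division a d) (trans (division a′ d) (cong (λ r → ⟦ r ⟧ + ⟦ a′ ℕ./ d ⟧ * ⟦ d ⟧) (sym eq))))
    (solve 4 (λ r x y d → (r :+ x :* d) :- (r :+ y :* d) := (x :- y) :* d) refl ⟦ a ℕ.% d ⟧ ⟦ a ℕ./ d ⟧ ⟦ a′ ℕ./ d ⟧ ⟦ d ⟧)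

  -- The order of the quotients makes `m` a natural number, so that `unique` applies to
  -- `a = (1 + m) β − c`. As `N a = N β − Δ` on the box indices, `a = β` there means that the digits
  -- agree.
  code-injective-≤ : ∀ x y → code x ≡ code y → q y ℕ.≤ q x → x ≡ y
  code-injective-≤ x y code≡ qy≤qx = digit-injective (suc k) b x y λ j j<K →
    ⟦⟧-injective (-⇒≡ (begin
      Δ j                                        ≡⟨ solve 2 (λ a d → d := a :- (a :- d)) refl (⟦ N ⟧ * β j) (Δ j) ⟩
      ⟦ N ⟧ * β j - (⟦ N ⟧ * β j - Δ j)          ≡⟨ cong (λ z → ⟦ N ⟧ * β j - z) (N*a j j<K) ⟨
      ⟦ N ⟧ * β j - ⟦ N ⟧ * a j                  ≡⟨ cong (λ z → ⟦ N ⟧ * β j - ⟦ N ⟧ * z) (unique m c c-int Σa≡1 a>0 j (ℕ.<-≤-trans j<K (ℕ.s≤s (ℕ.<⇒≤ k<n)))) ⟩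
      ⟦ N ⟧ * β j - ⟦ N ⟧ * β j                  ≡⟨ ℚ.+-inverseʳ (⟦ N ⟧ * β j) ⟩
      0ℚ                                         ∎))
    where
    open ≡-Reasoning
    Δ : ℕ → ℚ
    Δ j = ⟦ u x j ⟧ - ⟦ u y j ⟧
    m : ℕ
    m = q x ℕ.∸ q y
    m≡ : ⟦ m ⟧ ≡ ⟦ q x ⟧ - ⟦ q y ⟧
    m≡ = begin
      ⟦ m ⟧                      ≡⟨ solve 2 (λ m y → m := (m :+ y) :- y) refl ⟦ m ⟧ ⟦ q y ⟧ ⟩
      (⟦ m ⟧ + ⟦ q y ⟧) - ⟦ q y ⟧ ≡⟨ cong (_- ⟦ q y ⟧) (⟦⟧-+ m (q y)) ⟨
      ⟦ m ℕ.+ q y ⟧ - ⟦ q y ⟧    ≡⟨ cong (λ z → ⟦ z ⟧ - ⟦ q y ⟧) (ℕ.m∸n+n≡m qy≤qx) ⟩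
      ⟦ q x ⟧ - ⟦ q y ⟧          ∎
    split : Σℕ (suc k) (u x) ℕ.mod g ≡ Σℕ (suc k) (u y) ℕ.mod g ×
            funToFin {k} (λ j → shifted x (toℕ j) ℕ.mod N) ≡ funToFin {k} (λ j → shifted y (toℕ j) ℕ.mod N)
    split = Fin.combine-injective _ _ _ _ code≡
    ΣΔ : Σ< (suc k) Δ ≡ ⟦ m ⟧ * ⟦ g ⟧
    ΣΔ = begin
      Σ< (suc k) Δ       ≡⟨ Σ<-- (suc k) (λ j → ⟦ u x j ⟧) (λ j → ⟦ u y j ⟧) ⟩
      Σ< (suc k) (λ j → ⟦ u x j ⟧) - Σ< (suc k) (λ j → ⟦ u y j ⟧)
                         ≡⟨ cong₂ _-_ (⟦Σℕ⟧ (suc k) (u x)) (⟦Σℕ⟧ (suc k) (u y)) ⟨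
      ⟦ Σℕ (suc k) (u x) ⟧ - ⟦ Σℕ (suc k) (u y) ⟧
                         ≡⟨ difference (Σℕ (suc k) (u x)) (Σℕ (suc k) (u y)) g (mod-injective (proj₁ split)) ⟩
      (⟦ q x ⟧ - ⟦ q y ⟧) * ⟦ g ⟧ ≡⟨ cong (_* ⟦ g ⟧) m≡ ⟨
      ⟦ m ⟧ * ⟦ g ⟧      ∎
    X : ℕ → ℚ
    X j = ⟦ shifted x j ℕ./ N ⟧ - ⟦ shifted y j ℕ./ N ⟧
    residues : ∀ j → j ℕ.< k → shifted x j ℕ.% N ≡ shifted y j ℕ.% N
    residues j j<k = subst (λ j → shifted x j ℕ.% N ≡ shifted y j ℕ.% N) (Fin.toℕ-fromℕ< j<k) (mod-injective (begin
      shifted x (toℕ i) ℕ.mod N                                           ≡⟨ Fin.finToFun-funToFin (λ j → shifted x (toℕ j) ℕ.mod N) i ⟨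
      finToFun (funToFin {k} (λ j → shifted x (toℕ j) ℕ.mod N)) i         ≡⟨ cong (λ c → finToFun {N} {k} c i) (proj₂ split) ⟩
      finToFun (funToFin {k} (λ j → shifted y (toℕ j) ℕ.mod N)) i         ≡⟨ Fin.finToFun-funToFin (λ j → shifted y (toℕ j) ℕ.mod N) i ⟩
      shifted y (toℕ i) ℕ.mod N                                           ∎))
      where
      i : Fin k
      i = fromℕ< j<k
    N*X : ∀ j → j ℕ.< k → ⟦ N ⟧ * X j ≡ Δ (suc j) + (⟦ N ⟧ * β (suc j)) * ⟦ m ⟧
    N*X j j<k = begin
      ⟦ N ⟧ * X j                                   ≡⟨ ℚ.*-comm ⟦ N ⟧ (X j) ⟩
      X j * ⟦ N ⟧                                   ≡⟨ difference (shifted x j) (shifted y j) N (residues j j<k) ⟨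
      ⟦ shifted x j ⟧ - ⟦ shifted y j ⟧             ≡⟨ cong₂ _-_ (cast x) (cast y) ⟩
      (⟦ u x (suc j) ⟧ + ⟦ b (suc j) ⟧ * ⟦ q x ⟧) - (⟦ u y (suc j) ⟧ + ⟦ b (suc j) ⟧ * ⟦ q y ⟧)
        ≡⟨ solve 5 (λ a b c d e → (a :+ b :* c) :- (d :+ b :* e) := (a :- d) :+ b :* (c :- e)) refl ⟦ u x (suc j) ⟧ ⟦ b (suc j) ⟧ ⟦ q x ⟧ ⟦ u y (suc j) ⟧ ⟦ q y ⟧ ⟩
      Δ (suc j) + ⟦ b (suc j) ⟧ * (⟦ q x ⟧ - ⟦ q y ⟧) ≡⟨ cong₂ (λ z w → Δ (suc j) + z * w) (Nβ (suc j) (ℕ.s≤s (ℕ.<-trans j<k k<n))) m≡ ⟨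
      Δ (suc j) + (⟦ N ⟧ * β (suc j)) * ⟦ m ⟧       ∎
      where
      cast : ∀ z → ⟦ shifted z j ⟧ ≡ ⟦ u z (suc j) ⟧ + ⟦ b (suc j) ⟧ * ⟦ q z ⟧
      cast z = trans (⟦⟧-+ (u z (suc j)) (b (suc j) ℕ.* q z)) (cong (λ t → ⟦ u z (suc j) ⟧ + t) (⟦⟧-* (b (suc j)) (q z)))
    -- Entry `zero` is chosen to make `∑ c = m`; the relation `N c = Δ + m b` at that index then
    -- follows from the others and from `ΣΔ`.
    c : ℕ → ℚ
    c zero    = ⟦ m ⟧ - Σ< k X
    c (suc j) = truncate k X j
    X-int : ∀ j → IsInt (X j)
    X-int j = int-- (int-⟦⟧ (shifted x j ℕ./ N)) (int-⟦⟧ (shifted y j ℕ./ N))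
    c-int : ∀ j → IsInt (c j)
    c-int zero    = int-- (int-⟦⟧ m) (Σ<-int k λ j _ → X-int j)
    c-int (suc j) = truncate-int k X-int j
    N*c : ∀ j → j ℕ.< suc k → ⟦ N ⟧ * c j ≡ Δ j + (⟦ N ⟧ * β j) * ⟦ m ⟧
    N*c (suc j) (ℕ.s≤s j<k) = trans (cong (⟦ N ⟧ *_) (truncate-< X j<k)) (N*X j j<k)
    N*c zero    _ = begin
      ⟦ N ⟧ * (⟦ m ⟧ - Σ< k X)
        ≡⟨ solve 3 (λ N m x → N :* (m :- x) := N :* m :- N :* x) refl ⟦ N ⟧ ⟦ m ⟧ (Σ< k X) ⟩
      ⟦ N ⟧ * ⟦ m ⟧ - ⟦ N ⟧ * Σ< k X
        ≡⟨ cong (λ z → ⟦ N ⟧ * ⟦ m ⟧ - z) (begin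
             ⟦ N ⟧ * Σ< k X                ≡⟨ Σ<-*ˡ k ⟦ N ⟧ X ⟨
             Σ< k (λ j → ⟦ N ⟧ * X j)      ≡⟨ Σ<-cong k N*X ⟩
             Σ< k (λ j → Δ (suc j) + (⟦ N ⟧ * β (suc j)) * ⟦ m ⟧)
               ≡⟨ Σ<-cong k (λ j _ → solve 4 (λ d N b m → d :+ (N :* b) :* m := d :- (:- (N :* m)) :* b) refl (Δ (suc j)) ⟦ N ⟧ (β (suc j)) ⟦ m ⟧) ⟩
             Σ< k (λ j → Δ (suc j) - (- (⟦ N ⟧ * ⟦ m ⟧)) * β (suc j))
               ≡⟨ Σ<-- k (Δ ∘ suc) (λ j → (- (⟦ N ⟧ * ⟦ m ⟧)) * β (suc j)) ⟩
             Σ< k (Δ ∘ suc) - Σ< k (λ j → (- (⟦ N ⟧ * ⟦ m ⟧)) * β (suc j))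
               ≡⟨ cong (λ z → Σ< k (Δ ∘ suc) - z) (Σ<-*ˡ k (- (⟦ N ⟧ * ⟦ m ⟧)) (β ∘ suc)) ⟩
             Σ< k (Δ ∘ suc) - (- (⟦ N ⟧ * ⟦ m ⟧)) * Σ< k (β ∘ suc) ∎) ⟩
      ⟦ N ⟧ * ⟦ m ⟧ - (Σ< k (Δ ∘ suc) - (- (⟦ N ⟧ * ⟦ m ⟧)) * Σ< k (β ∘ suc))
        ≡⟨ solve 6 (λ N m d β d₀ β₀ → N :* m :- (d :- (:- (N :* m)) :* β)
              := ((m :* (N :* (con 1ℚ :- (β₀ :+ β)))) :- (d₀ :+ d)) :+ (d₀ :+ (N :* β₀) :* m))
              refl ⟦ N ⟧ ⟦ m ⟧ (Σ< k (Δ ∘ suc)) (Σ< k (β ∘ suc)) (Δ 0) (β 0) ⟩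
      ((⟦ m ⟧ * (⟦ N ⟧ * (1ℚ - (β 0 + Σ< k (β ∘ suc))))) - (Δ 0 + Σ< k (Δ ∘ suc))) + (Δ 0 + (⟦ N ⟧ * β 0) * ⟦ m ⟧)
        ≡⟨ cong (_+ (Δ 0 + (⟦ N ⟧ * β 0) * ⟦ m ⟧)) (≡⇒- (begin
             ⟦ m ⟧ * (⟦ N ⟧ * (1ℚ - (β 0 + Σ< k (β ∘ suc)))) ≡⟨ cong (λ z → ⟦ m ⟧ * (⟦ N ⟧ * (1ℚ - z))) (Σ<-head k β) ⟨
             ⟦ m ⟧ * (⟦ N ⟧ * (1ℚ - Σ< (suc k) β))           ≡⟨ cong (⟦ m ⟧ *_) g≡ ⟨
             ⟦ m ⟧ * ⟦ g ⟧                                   ≡⟨ ΣΔ ⟨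
             Σ< (suc k) Δ                                    ≡⟨ Σ<-head k Δ ⟩
             Δ 0 + Σ< k (Δ ∘ suc)                            ∎)) ⟩
      0ℚ + (Δ 0 + (⟦ N ⟧ * β 0) * ⟦ m ⟧)
        ≡⟨ ℚ.+-identityˡ (Δ 0 + (⟦ N ⟧ * β 0) * ⟦ m ⟧) ⟩
      Δ 0 + (⟦ N ⟧ * β 0) * ⟦ m ⟧ ∎
    a : ℕ → ℚ
    a j = (1ℚ + ⟦ m ⟧) * β j - c j
    N*a : ∀ j → j ℕ.< suc k → ⟦ N ⟧ * a j ≡ ⟦ N ⟧ * β j - Δ j
    N*a j j<K = begin
      ⟦ N ⟧ * ((1ℚ + ⟦ m ⟧) * β j - c j)
        ≡⟨ solve 4 (λ N m b c → N :* ((con 1ℚ :+ m) :* b :- c) := (N :* b :+ (N :* b) :* m) :- N :* c) refl ⟦ N ⟧ ⟦ m ⟧ (β j) (c j) ⟩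
      (⟦ N ⟧ * β j + (⟦ N ⟧ * β j) * ⟦ m ⟧) - ⟦ N ⟧ * c j
        ≡⟨ cong (λ z → (⟦ N ⟧ * β j + (⟦ N ⟧ * β j) * ⟦ m ⟧) - z) (N*c j j<K) ⟩
      (⟦ N ⟧ * β j + (⟦ N ⟧ * β j) * ⟦ m ⟧) - (Δ j + (⟦ N ⟧ * β j) * ⟦ m ⟧)
        ≡⟨ solve 3 (λ x y d → (x :+ y) :- (d :+ y) := x :- d) refl (⟦ N ⟧ * β j) ((⟦ N ⟧ * β j) * ⟦ m ⟧) (Δ j) ⟩
      ⟦ N ⟧ * β j - Δ j ∎
    Σa≡1 : Σ< (suc n) a ≡ 1ℚ
    Σa≡1 = begin
      Σ< (suc n) a
        ≡⟨ Σ<-- (suc n) (λ j → (1ℚ + ⟦ m ⟧) * β j) c ⟩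
      Σ< (suc n) (λ j → (1ℚ + ⟦ m ⟧) * β j) - Σ< (suc n) c
        ≡⟨ cong₂ _-_ (trans (Σ<-*ˡ (suc n) (1ℚ + ⟦ m ⟧) β) (cong ((1ℚ + ⟦ m ⟧) *_) Σβ≡1)) (Σ<-head n c) ⟩
      (1ℚ + ⟦ m ⟧) * 1ℚ - ((⟦ m ⟧ - Σ< k X) + Σ< n (truncate k X))
        ≡⟨ cong (λ z → (1ℚ + ⟦ m ⟧) * 1ℚ - ((⟦ m ⟧ - Σ< k X) + z)) (Σ<-truncate X (ℕ.<⇒≤ k<n)) ⟩
      (1ℚ + ⟦ m ⟧) * 1ℚ - ((⟦ m ⟧ - Σ< k X) + Σ< k X)
        ≡⟨ solve 2 (λ m x → (con 1ℚ :+ m) :* con 1ℚ :- ((m :- x) :+ x) := con 1ℚ) refl ⟦ m ⟧ (Σ< k X) ⟩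
      1ℚ ∎
    -- Here `N a j = (b j − u x j) + u y j`, and digits stay strictly below `b j`.
    a>0-below : ∀ j → j ℕ.< suc k → j ℕ.< suc n → 0ℚ < a j
    a>0-below j j<K j<1+n = *-cancel-<ˡ (0<⟦⟧ N) (subst (_< ⟦ N ⟧ * a j) (sym (ℚ.*-zeroʳ ⟦ N ⟧)) (subst (0ℚ <_) (sym N*a≡)
      (0<+ (<⇒0<- (⟦⟧-mono-< (digit-< (suc k) b x j j<K))) (0≤⟦⟧ (u y j)))))
      where
      N*a≡ : ⟦ N ⟧ * a j ≡ (⟦ b j ⟧ - ⟦ u x j ⟧) + ⟦ u y j ⟧
      N*a≡ = trans (N*a j j<K) (trans (cong (_- Δ j) (Nβ j j<1+n))
        (solve 3 (λ b x y → b :- (x :- y) := (b :- x) :+ y) refl ⟦ b j ⟧ ⟦ u x j ⟧ ⟦ u y j ⟧))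
    -- Nothing is subtracted outside the box indices; positivity rests on `m` being nonnegative.
    a>0-above : ∀ j → suc k ℕ.≤ j → j ℕ.< suc n → 0ℚ < a j
    a>0-above (suc j) (ℕ.s≤s k≤j) j<n = subst (0ℚ <_) (sym a≡) (0<* (0<+ 0<1 (0≤⟦⟧ m)) (β>0 (suc j) j<n))
      where
      a≡ : a (suc j) ≡ (1ℚ + ⟦ m ⟧) * β (suc j)
      a≡ = trans (cong (λ z → (1ℚ + ⟦ m ⟧) * β (suc j) - z) (truncate-≥ X k≤j))
        (ℚ.+-identityʳ ((1ℚ + ⟦ m ⟧) * β (suc j)))
    a>0 : ∀ j → j ℕ.< suc n → 0ℚ < a j
    a>0 j j<1+n with j ℕ.<? suc k
    ... | yes j<K = a>0-below j j<K j<1+n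
    ... | no  j≮K = a>0-above j (ℕ.≮⇒≥ j≮K) j<1+n

  code-injective : ∀ {x y} → code x ≡ code y → x ≡ y
  code-injective {x} {y} eq with ℕ.≤-total (q y) (q x)
  ... | inj₁ qy≤qx = code-injective-≤ x y eq qy≤qx
  ... | inj₂ qx≤qy = sym (code-injective-≤ y x (sym eq) qx≤qy)

  box≤ : box-size (suc k) b ℕ.≤ g ℕ.* N ℕ.^ k
  box≤ = Fin.injective⇒≤ {f = code} code-injective

⟦^⟧ : ∀ N k → ⟦ N ℕ.^ k ⟧ ≡ ⟦ N ⟧ ^ k
⟦^⟧ N zero    = fromℤ-1
⟦^⟧ N (suc k) = trans (⟦⟧-* N (N ℕ.^ k)) (trans (cong (⟦ N ⟧ *_) (⟦^⟧ N k)) (ℚ.*-comm ⟦ N ⟧ (⟦ N ⟧ ^ k)))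

-- Multiplied by `⟦ N ⟧ ^ suc k`, the claim compares the size `∏ b` of the box with the number
-- `g * N ^ k` of codes. For `k = suc n` the right side would be 0.
product-sum-≤ : ∀ n (β : ℕ → ℚ) → (∀ j → j ℕ.< suc n → 0ℚ < β j) → Σ< (suc n) β ≡ 1ℚ →
  UniqueMultiple (suc n) β → ∀ k → k ℕ.≤ n → Π< k β ≤ 1ℚ - Σ< k β
product-sum-≤ n β β>0 Σβ≡1 unique zero    _ = ℚ.≤-refl
product-sum-≤ n β β>0 Σβ≡1 unique (suc k) k<n with N , N≢0 , ints ← common-denominator (suc n) β =
  *-cancel-≤ˡ (0<^ (suc k) N>0) (begin
    ⟦ N ⟧ ^ suc k * Π< (suc k) β                ≡⟨ Π<-* (suc k) (λ _ → ⟦ N ⟧) β ⟨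
    Π< (suc k) (λ j → ⟦ N ⟧ * β j)              ≡⟨ Π<-cong (suc k) (λ j j<K → Nβ j (ℕ.<-trans j<K (ℕ.s≤s k<n))) ⟩
    Π< (suc k) (λ j → ⟦ b j ⟧)                  ≡⟨ ⟦box-size⟧ (suc k) b ⟨
    ⟦ box-size (suc k) b ⟧                      ≤⟨ ⟦⟧-mono-≤ (Pigeonhole.box≤ n k k<n β β>0 Σβ≡1 unique N N≢0 b Nβ g g≢0 (proj₂ gap)) ⟩
    ⟦ g ℕ.* N ℕ.^ k ⟧                           ≡⟨ trans (⟦⟧-* g (N ℕ.^ k)) (cong₂ _*_ (proj₂ gap) (⟦^⟧ N k)) ⟩
    (⟦ N ⟧ * (1ℚ - Σ< (suc k) β)) * ⟦ N ⟧ ^ k   ≡⟨ solve 3 (λ N r p → (N :* r) :* p := (p :* N) :* r) refl ⟦ N ⟧ (1ℚ - Σ< (suc k) β) (⟦ N ⟧ ^ k) ⟩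
    ⟦ N ⟧ ^ suc k * (1ℚ - Σ< (suc k) β)         ∎)
  where
  open ℚ.≤-Reasoning
  N>0 : 0ℚ < ⟦ N ⟧
  N>0 = 0<⟦⟧ N ⦃ N≢0 ⦄
  numerator : ∀ j → j ℕ.< suc n → ∃ λ k → ⟦ k ⟧ ≡ ⟦ N ⟧ * β j
  numerator j j<1+n = nonNeg-int (ints j j<1+n) (ℚ.<⇒≤ (0<* N>0 (β>0 j j<1+n)))
  b : ℕ → ℕ
  b j with j ℕ.<? suc n
  ... | yes j<1+n = proj₁ (numerator j j<1+n)
  ... | no  _     = 0
  Nβ : ∀ j → j ℕ.< suc n → ⟦ N ⟧ * β j ≡ ⟦ b j ⟧
  Nβ j j<1+n with j ℕ.<? suc n
  ... | yes j<1+n′ = sym (proj₂ (numerator j j<1+n′))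
  ... | no  j≮1+n  = ⊥-elim (j≮1+n j<1+n)
  rest>0 : 0ℚ < ⟦ N ⟧ * (1ℚ - Σ< (suc k) β)
  rest>0 = 0<* N>0 (<⇒0<- (subst (Σ< (suc k) β <_) Σβ≡1 (Σ<-strict β (ℕ.s≤s k<n) β>0)))
  gap : ∃ λ g → ⟦ g ⟧ ≡ ⟦ N ⟧ * (1ℚ - Σ< (suc k) β)
  gap = nonNeg-int
    (subst IsInt (trans (cong (λ z → ⟦ N ⟧ - z) (Σ<-*ˡ (suc k) ⟦ N ⟧ β)) (solve 2 (λ N s → N :- N :* s := N :* (con 1ℚ :- s)) refl ⟦ N ⟧ (Σ< (suc k) β)))
      (int-- (int-⟦⟧ N) (Σ<-int (suc k) λ j j<K → ints j (ℕ.<-trans j<K (ℕ.s≤s k<n)))))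
    (ℚ.<⇒≤ rest>0)
  g : ℕ
  g = proj₁ gap
  g≢0 : ℕ.NonZero g
  g≢0 = ℕ.≢-nonZero λ g≡0 → >⇒≢ rest>0 (trans (sym (proj₂ gap)) (trans (cong ⟦_⟧ g≡0) fromℤ-0))

-- The lower bound and its equality case

extend : ∀ {n} → (Fin n → ℚ) → ℕ → ℚ
extend {zero}  f j       = 0ℚ
extend {suc n} f zero    = f zero
extend {suc n} f (suc j) = extend (f ∘ suc) j

extend-toℕ : ∀ {n} (f : Fin n → ℚ) i → extend f (toℕ i) ≡ f i
extend-toℕ f zero    = refl
extend-toℕ f (suc i) = extend-toℕ (f ∘ suc) i

extend-< : ∀ {n} (f : Fin n → ℚ) {j} (j<n : j ℕ.< n) → extend f j ≡ f (fromℕ< j<n)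
extend-< f j<n = trans (cong (extend f) (sym (Fin.toℕ-fromℕ< j<n))) (extend-toℕ f (fromℕ< j<n))

∑-extend : ∀ {n} (f : Fin n → ℚ) → ∑ f ≡ Σ< n (extend f)
∑-extend {n} f = trans (∑-cong λ i → sym (extend-toℕ f i)) (∑-toℕ n (extend f))

scale-< : ∀ {d i j} → j ℕ.< toℕ i → scale d i j ≡ s j
scale-< {d} {i} {j} j<i with j ℕ.<ᵇ toℕ i | ℕ.<⇒<ᵇ j<i
... | true | _ = refl

scale-≥ : ∀ {d i j} → toℕ i ℕ.≤ j → scale d i j ≡ D d i
scale-≥ {d} {i} {j} i≤j with j ℕ.<ᵇ toℕ i in eq
... | true  = ⊥-elim (ℕ.<⇒≱ (ℕ.<ᵇ⇒< j (toℕ i) (subst T (sym eq) tt)) i≤j)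
... | false = refl

1/-cong : ∀ {m n} .⦃ _ : ℕ.NonZero m ⦄ .⦃ _ : ℕ.NonZero n ⦄ → m ≡ n → + 1 / m ≡ + 1 / n
1/-cong refl = refl

extremal-< : ∀ {d i j} → toℕ j ℕ.< toℕ i → extremal d i j ≡ 1/s (toℕ j)
extremal-< {d} {i} {j} j<i = 1/-cong ⦃ scale-nonZero {d} {i} {toℕ j} ⦄ ⦃ +1-nonZero (∏s (toℕ j)) ⦄ (scale-< {d} {i} j<i)

extremal-≥ : ∀ {d i j} → toℕ i ℕ.≤ toℕ j → extremal d i j ≡ bound d i
extremal-≥ {d} {i} {j} i≤j = 1/-cong ⦃ scale-nonZero {d} {i} {toℕ j} ⦄ ⦃ D-nonZero {d} {i} ⦄ (scale-≥ {d} {i} i≤j)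

D≡ : ∀ d i → D d i ≡ (d ℕ.∸ toℕ i ℕ.+ 1) ℕ.* ∏s (toℕ i)
D≡ d i = cong ((d ℕ.∸ toℕ i ℕ.+ 1) ℕ.*_) (ℕ.m+n∸n≡m (∏s (toℕ i)) 1)

D*bound : ∀ d i → ⟦ D d i ⟧ * bound d i ≡ 1ℚ
D*bound d i = 1/-inverse (D d i) ⦃ D-nonZero {d} {i} ⦄

0<bound : ∀ d i → 0ℚ < bound d i
0<bound d i = 0<1/ (D d i) ⦃ D-nonZero {d} {i} ⦄

-- The origin of `D d i`: the first `toℕ i` terms `1/s` leave the mass `Π< (toℕ i) 1/s`, which the
-- remaining `d ∸ toℕ i + 1` coordinates share equally in the extremal case.
multiplicity*bound : ∀ d i → ⟦ d ℕ.∸ toℕ i ℕ.+ 1 ⟧ * bound d i ≡ Π< (toℕ i) 1/s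
multiplicity*bound d i = begin
  ⟦ l ⟧ * bound d i                                    ≡⟨ ℚ.*-identityʳ (⟦ l ⟧ * bound d i) ⟨
  (⟦ l ⟧ * bound d i) * 1ℚ                             ≡⟨ cong ((⟦ l ⟧ * bound d i) *_) (∏s*Π1/s (toℕ i)) ⟨
  (⟦ l ⟧ * bound d i) * (⟦ ∏s (toℕ i) ⟧ * Π< (toℕ i) 1/s)
    ≡⟨ solve 4 (λ l b p q → (l :* b) :* (p :* q) := ((l :* p) :* b) :* q) refl ⟦ l ⟧ (bound d i) ⟦ ∏s (toℕ i) ⟧ (Π< (toℕ i) 1/s) ⟩
  ((⟦ l ⟧ * ⟦ ∏s (toℕ i) ⟧) * bound d i) * Π< (toℕ i) 1/s
    ≡⟨ cong (λ z → (z * bound d i) * Π< (toℕ i) 1/s) (trans (cong ⟦_⟧ (D≡ d i)) (⟦⟧-* l (∏s (toℕ i)))) ⟨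
  (⟦ D d i ⟧ * bound d i) * Π< (toℕ i) 1/s             ≡⟨ cong (_* Π< (toℕ i) 1/s) (D*bound d i) ⟩
  1ℚ * Π< (toℕ i) 1/s                                  ≡⟨ ℚ.*-identityˡ (Π< (toℕ i) 1/s) ⟩
  Π< (toℕ i) 1/s                                       ∎
  where
  open ≡-Reasoning
  l : ℕ
  l = d ℕ.∸ toℕ i ℕ.+ 1

module Bound (d : ℕ) (β : Fin (suc d) → ℚ) (β>0 : ∀ j → 0ℚ < β j) (Σβ≡1 : ∑ β ≡ 1ℚ)
  (decreasing : ∀ j k → j ≤ᶠ k → β k ≤ β j)
  (product-sum : ∀ k → k ℕ.≤ d → Π< k (extend β) ≤ 1ℚ - Σ< k (extend β)) (i : Fin (suc d)) where

  private
    x : ℕ → ℚ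
    x = extend β

    m l : ℕ
    m = toℕ i
    l = d ℕ.∸ m ℕ.+ 1

    m≤d : m ℕ.≤ d
    m≤d = Fin.toℕ≤pred[n] i

    m+l≡1+d : m ℕ.+ l ≡ suc d
    m+l≡1+d = trans (sym (ℕ.+-assoc m (d ℕ.∸ m) 1)) (trans (cong (ℕ._+ 1) (ℕ.m+[n∸m]≡n m≤d)) (ℕ.+-comm d 1))

    l>0 : 0ℚ < ⟦ l ⟧
    l>0 = 0<⟦⟧ l ⦃ +1-nonZero (d ℕ.∸ m) ⦄

    x-pos : ∀ j → j ℕ.< suc d → 0ℚ < x j
    x-pos j j<1+d = subst (0ℚ <_) (sym (extend-< β j<1+d)) (β>0 (fromℕ< j<1+d))

    x-decreasing : ∀ {j k} → j ℕ.≤ k → k ℕ.< suc d → x k ≤ x j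
    x-decreasing {j} {k} j≤k k<1+d = begin
      x k                ≡⟨ extend-< β k<1+d ⟩
      β (fromℕ< k<1+d)   ≤⟨ decreasing (fromℕ< j<1+d) (fromℕ< k<1+d) (ℕ.≤-trans (ℕ.≤-reflexive (Fin.toℕ-fromℕ< j<1+d)) (ℕ.≤-trans j≤k (ℕ.≤-reflexive (sym (Fin.toℕ-fromℕ< k<1+d))))) ⟩
      β (fromℕ< j<1+d)   ≡⟨ extend-< β j<1+d ⟨
      x j                ∎
      where
      open ℚ.≤-Reasoning
      j<1+d : j ℕ.< suc d
      j<1+d = ℕ.≤-<-trans j≤k k<1+d

    ps : ProductSum m x
    ps = record
      { pos         = λ j j<m → x-pos j (ℕ.<-trans j<m (ℕ.s≤s m≤d))
      ; decreasing  = λ j 1+j<m → x-decreasing (ℕ.n≤1+n j) (ℕ.<-trans 1+j<m (ℕ.s≤s m≤d))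
      ; product-sum = λ k k≤m → product-sum k (ℕ.≤-trans k≤m m≤d)
      }

    tail : ℚ
    tail = Σ< l (λ j → x (m ℕ.+ j))

    Σx+tail≡1 : Σ< m x + tail ≡ 1ℚ
    Σx+tail≡1 = begin
      Σ< m x + tail       ≡⟨ Σ<-split m l x ⟨
      Σ< (m ℕ.+ l) x      ≡⟨ cong (λ n → Σ< n x) m+l≡1+d ⟩
      Σ< (suc d) x        ≡⟨ ∑-extend β ⟨
      ∑ β                 ≡⟨ Σβ≡1 ⟩
      1ℚ                  ∎
      where open ≡-Reasoning

    tail-bounds : ∀ j → j ℕ.< l → x (m ℕ.+ j) ≤ x m
    tail-bounds j j<l = x-decreasing (ℕ.m≤m+n m j) (subst (m ℕ.+ j ℕ.<_) m+l≡1+d (ℕ.+-monoʳ-< m j<l))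

    tail≤ : tail ≤ ⟦ l ⟧ * x m
    tail≤ = subst (tail ≤_) (Σ<-const l (x m)) (Σ<-mono-≤ l tail-bounds)

    tail≡ : tail ≡ (Σ< m 1/s - Σ< m x) + Π< m 1/s
    tail≡ = begin
      tail                                          ≡⟨ solve 2 (λ a t → t := (a :+ t) :- a) refl (Σ< m x) tail ⟩
      (Σ< m x + tail) - Σ< m x                      ≡⟨ cong (_- Σ< m x) (trans Σx+tail≡1 (sym (Σ1/s+Π1/s≡1 m))) ⟩
      (Σ< m 1/s + Π< m 1/s) - Σ< m x                ≡⟨ solve 3 (λ a b c → (a :+ b) :- c := (a :- c) :+ b) refl (Σ< m 1/s) (Π< m 1/s) (Σ< m x) ⟩
      (Σ< m 1/s - Σ< m x) + Π< m 1/s                ∎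
      where open ≡-Reasoning

  -- The tail has at least the mass that Sylvester's sequence would leave to it, and none of its `l`
  -- entries exceeds `β i`.
  bound-≤ : bound d i ≤ β i
  bound-≤ = *-cancel-≤ˡ l>0 (begin
    ⟦ l ⟧ * bound d i                ≡⟨ multiplicity*bound d i ⟩
    Π< m 1/s                         ≤⟨ p≤q+p (Π< m 1/s) (≤⇒0≤- (sylvester-≤ m ps m ℕ.≤-refl)) ⟩
    (Σ< m 1/s - Σ< m x) + Π< m 1/s   ≡⟨ tail≡ ⟨
    tail                             ≤⟨ tail≤ ⟩
    ⟦ l ⟧ * x m                      ≡⟨ cong (⟦ l ⟧ *_) (extend-toℕ β i) ⟩
    ⟦ l ⟧ * β i                      ∎)
    where open ℚ.≤-Reasoning

  -- Equality makes both estimates behind `bound-≤` tight: the prefix sum attains the Sylvester sum,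
  -- and every tail entry attains the maximum `x m`.
  bound-equality : β i ≡ bound d i → ∀ j → β j ≡ extremal d i j
  bound-equality eq j with toℕ j ℕ.<? m
  ... | yes j<m = begin
      β j              ≡⟨ extend-toℕ β j ⟨
      x (toℕ j)        ≡⟨ sylvester-equality m ps (λ k k<m → sylvester-≤ m ps k (ℕ.<⇒≤ k<m)) Σ≥ (toℕ j) j<m ⟩
      1/s (toℕ j)      ≡⟨ extremal-< {d} {i} {j} j<m ⟨
      extremal d i j   ∎
    where
    open ≡-Reasoning
    Σ≥ : Σ< m 1/s ≤ Σ< m x
    Σ≥ = 0≤-⇒≤ (ℚ.≤-trans (≤⇒0≤- (ℚ.≤-trans tail≤ (ℚ.≤-reflexive (trans (cong (⟦ l ⟧ *_) (trans (extend-toℕ β i) eq)) (multiplicity*bound d i)))))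
      (ℚ.≤-reflexive (trans (cong (λ z → Π< m 1/s - z) tail≡)
        (solve 3 (λ p a b → p :- ((a :- b) :+ p) := b :- a) refl (Π< m 1/s) (Σ< m 1/s) (Σ< m x)))))
  ... | no  j≮m = begin
      β j                        ≡⟨ extend-toℕ β j ⟨
      x (toℕ j)                  ≡⟨ cong x (ℕ.m+[n∸m]≡n m≤j) ⟨
      x (m ℕ.+ (toℕ j ℕ.∸ m))    ≡⟨ Σ<-mono-≡ l tail-bounds tail≥ (toℕ j ℕ.∸ m) j∸m<l ⟩
      x m                        ≡⟨ trans (extend-toℕ β i) eq ⟩
      bound d i                  ≡⟨ extremal-≥ {d} {i} {j} m≤j ⟨
      extremal d i j             ∎
    where
    open ≡-Reasoning
    m≤j : m ℕ.≤ toℕ j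
    m≤j = ℕ.≮⇒≥ j≮m
    j∸m<l : toℕ j ℕ.∸ m ℕ.< l
    j∸m<l = ℕ.+-cancelˡ-< m _ _ (ℕ.≤-trans (ℕ.≤-reflexive (cong suc (ℕ.m+[n∸m]≡n m≤j))) (ℕ.≤-trans (Fin.toℕ<n j) (ℕ.≤-reflexive (sym m+l≡1+d))))
    tail≥ : Σ< l (λ _ → x m) ≤ tail
    tail≥ = ℚ.≤-trans (ℚ.≤-reflexive (trans (Σ<-const l (x m)) (trans (cong (⟦ l ⟧ *_) (trans (extend-toℕ β i) eq)) (multiplicity*bound d i))))
      (ℚ.≤-trans (p≤q+p (Π< m 1/s) (≤⇒0≤- (sylvester-≤ m ps m ℕ.≤-refl))) (ℚ.≤-reflexive (sym tail≡)))

-- Integral simplices with one interior integral point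

coordinates-cong : ∀ {n d} {v : Fin n → ℚ^ d} {a b x} → (∀ i → a i ≡ b i) → Coordinates v a x → Coordinates v b x
coordinates-cong {v = v} h A = coordinates
  (trans (sym (∑-cong h)) (total A))
  (λ k → trans (sym (∑-cong λ i → cong (_* lookup (v i) k) (h i))) (point A k))

permute-coordinates : ∀ {n d} {v : Fin n → ℚ^ d} {b x} (π : Permutation′ n) →
  Coordinates v b x → Coordinates (v ∘ (π ⟨$⟩ʳ_)) (b ∘ (π ⟨$⟩ʳ_)) x
permute-coordinates {v = v} {b} π B = coordinates
  (trans (sym (sum-permute b π)) (total B))
  (λ k → trans (sym (sum-permute (λ i → b i * lookup (v i) k) π)) (point B k))

∑-unpermute : ∀ {n} (c f : Fin n → ℚ) (π : Permutation′ n) →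
  ∑ (λ i → c (π ⟨$⟩ˡ i) * f i) ≡ ∑ (λ j → c j * f (π ⟨$⟩ʳ j))
∑-unpermute c f π = trans (sum-permute (λ i → c (π ⟨$⟩ˡ i) * f i) π)
  (∑-cong λ j → cong (λ z → c z * f (π ⟨$⟩ʳ j)) (inverseˡ π))

∑-unpermute′ : ∀ {n} (c : Fin n → ℚ) (π : Permutation′ n) → ∑ (λ i → c (π ⟨$⟩ˡ i)) ≡ ∑ c
∑-unpermute′ c π = trans (sum-permute (λ i → c (π ⟨$⟩ˡ i)) π) (∑-cong {x = λ j → c (π ⟨$⟩ˡ (π ⟨$⟩ʳ j))} λ j → cong c (inverseˡ π {j}))

unpermute-coordinates : ∀ {n d} {v : Fin n → ℚ^ d} {c x} (π : Permutation′ n) →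
  Coordinates (v ∘ (π ⟨$⟩ʳ_)) c x → Coordinates v (c ∘ (π ⟨$⟩ˡ_)) x
unpermute-coordinates {v = v} {c} π C = coordinates
  (trans (∑-unpermute′ c π) (total C))
  (λ k → trans (∑-unpermute c (λ i → lookup (v i) k) π) (point C k))

conv-permute : ∀ {n d} (v : Fin n → ℚ^ d) (π : Permutation′ n) x → conv v x → conv (v ∘ (π ⟨$⟩ʳ_)) x
conv-permute v π x (c , c≥0 , C) =
  c ∘ (π ⟨$⟩ʳ_) , (λ i → c≥0 (π ⟨$⟩ʳ i)) , toBarycentric (permute-coordinates π (fromBarycentric v c x C))

conv-unpermute : ∀ {n d} (v : Fin n → ℚ^ d) (π : Permutation′ n) x → conv (v ∘ (π ⟨$⟩ʳ_)) x → conv v x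
conv-unpermute v π x (c , c≥0 , C) =
  c ∘ (π ⟨$⟩ˡ_) , (λ i → c≥0 (π ⟨$⟩ˡ i)) , toBarycentric (unpermute-coordinates {v = v} π (fromBarycentric (v ∘ (π ⟨$⟩ʳ_)) c x C))

independent-permute : ∀ {n d} (v : Fin n → ℚ^ d) (π : Permutation′ n) →
  AffinelyIndependent v → AffinelyIndependent (v ∘ (π ⟨$⟩ʳ_))
independent-permute v π indep c ∑c≡0 comb≡0 i = trans (cong c (sym (inverseˡ π)))
  (indep (c ∘ (π ⟨$⟩ˡ_)) (trans (∑-unpermute′ c π) ∑c≡0)
    (lookup-ext λ k → trans (combination-lookup (c ∘ (π ⟨$⟩ˡ_)) v k)
      (trans (∑-unpermute c (λ i → lookup (v i) k) π)
        (trans (sym (combination-lookup c (v ∘ (π ⟨$⟩ʳ_)) k)) (cong (λ x → lookup x k) comb≡0))))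
    (π ⟨$⟩ʳ i))

interior-mono : ∀ {d} (P Q : Subset d) → (∀ x → P x → Q x) → ∀ x → Interior P x → Interior Q x
interior-mono P Q P⊆Q x (ε , 0<ε , ball) = ε , 0<ε , λ y near → P⊆Q y (ball y near)

-- Relabelling keeps the point set, so the same list of interior points serves. It allows the
-- coordinates to be taken as sorted, or a chosen vertex to come first.
permute : ∀ {d k} → 𝒮 d k → Permutation′ (suc d) → 𝒮 d k
permute S π with zs , zs! , len , mem ← 𝒮.interiorPoints S = record
  { vertexℤ        = 𝒮.vertexℤ S ∘ (π ⟨$⟩ʳ_)
  ; independent    = independent-permute v π (𝒮.independent S)
  ; interiorPoints = zs , zs! , len , λ z → mk⇔
      (λ z∈zs → interior-mono (conv v) (conv vπ) (conv-permute v π) (ι z) (Equivalence.to (mem z) z∈zs))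
      (λ int → Equivalence.from (mem z) (interior-mono (conv vπ) (conv v) (conv-unpermute v π) (ι z) int))
  }
  where
  v vπ : Fin _ → ℚ^ _
  v  = 𝒮.vertex S
  vπ = v ∘ (π ⟨$⟩ʳ_)

ι-lookup : ∀ {d} (z : ℤ^ d) k → lookup (ι z) k ≡ fromℤ (lookup z k)
ι-lookup z k = trans (lookup-map k (_/ 1) z) (sym (fromℤ≡/1 (lookup z k)))

ι-int : ∀ {d} (z : ℤ^ d) k → IsInt (lookup (ι z) k)
ι-int z k = lookup z k , sym (ι-lookup z k)

int⇒lattice : ∀ {d} {x : ℚ^ d} → (∀ k → IsInt (lookup x k)) → ℤ-lattice d x
int⇒lattice {d} {x} h = tabulate (λ k → proj₁ (h k)) , lookup-ext λ k →
  trans (ι-lookup (tabulate (λ k → proj₁ (h k))) k)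
    (trans (cong fromℤ (lookup∘tabulate (λ k → proj₁ (h k)) k)) (proj₂ (h k)))

unique-interior-point : ∀ {d} (S : 𝒮 d 1) {z w} →
  Interior (𝒮.points S) (ι z) → Interior (𝒮.points S) (ι w) → z ≡ w
unique-interior-point S {z} {w} z-int w-int with 𝒮.interiorPoints S
... | (y ∷ []) , _ , refl , mem = only (Equivalence.from (mem z) z-int) (Equivalence.from (mem w) w-int)
  where
  only : ∀ {z w} → z ∈ (y ∷ []) → w ∈ (y ∷ []) → z ≡ w
  only (here refl) (here refl) = refl

-- a lies in the lattice of (not necessarily normalized) coordinates of integral points.
Integral : ∀ {n d} → (Fin n → ℚ^ d) → (Fin n → ℚ) → Set
Integral v a = ∀ k → IsInt (∑ (λ j → a j * lookup (v j) k))

module UniquePoint {d} (S : 𝒮 d 1) {p : ℤ^ d} (p-int : Interior (𝒮.points S) (ι p))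
  {b : Fin (suc d) → ℚ} (B : Coordinates (𝒮.vertex S) b (ι p)) where

  open 𝒮 S

  b>0 : ∀ j → 0ℚ < b j
  b>0 = interior⇒positive independent p-int B

  -- Integrality puts the point with coordinates `a` into the lattice and positivity puts it into
  -- the interior, so it is `p`; affine independence then identifies the coordinates.
  unique : ∀ a → Integral vertex a → ∑ a ≡ 1ℚ → (∀ j → 0ℚ < a j) → ∀ j → a j ≡ b j
  unique a a-int ∑a≡1 a>0 = barycentric-unique independent A B
    where
    x : ℚ^ d
    x = combination a vertex
    x-lattice : ℤ-lattice d x
    x-lattice = int⇒lattice λ k → subst IsInt (sym (combination-lookup a vertex k)) (a-int k)
    A′ : Coordinates vertex a x
    A′ = coordinates ∑a≡1 λ k → sym (combination-lookup a vertex k)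
    x≡p : x ≡ ι p
    x≡p = trans (sym (proj₂ x-lattice)) (cong ι (unique-interior-point S
      (subst (Interior points) (sym (proj₂ x-lattice)) (positive⇒interior independent A′ a>0)) p-int))
    A : Coordinates vertex a (ι p)
    A = subst (Coordinates vertex a) x≡p A′

  integral-b : Integral vertex b
  integral-b k = subst IsInt (sym (point B k)) (ι-int p k)

  integral-int : ∀ c → (∀ j → IsInt (c j)) → Integral vertex c
  integral-int c c-int k = ∑-int λ j → int-* (c-int j) (ι-int (vertexℤ j) k)

  integral-- : ∀ a c → Integral vertex a → Integral vertex c → Integral vertex (λ j → a j - c j)
  integral-- a c A C k = subst IsInt
    (trans (sym (∑-- (λ j → a j * lookup (vertex j) k) (λ j → c j * lookup (vertex j) k)))
      (∑-cong λ j → solve 3 (λ a c v → a :* v :- c :* v := (a :- c) :* v) refl (a j) (c j) (lookup (vertex j) k)))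
    (int-- (A k) (C k))

  integral-* : ∀ m a → IsInt m → Integral vertex a → Integral vertex (λ j → m * a j)
  integral-* m a M A k = subst IsInt
    (trans (sym (∑-*ˡ m (λ j → a j * lookup (vertex j) k)))
      (∑-cong λ j → sym (ℚ.*-assoc m (a j) (lookup (vertex j) k))))
    (int-* M (A k))

  unique-multiple : UniqueMultiple (suc d) (extend b)
  unique-multiple m c c-int Σ≡1 a>0 j j<1+d = begin
    (1ℚ + ⟦ m ⟧) * extend b j - c j                         ≡⟨ cong (λ j → (1ℚ + ⟦ m ⟧) * extend b j - c j) (Fin.toℕ-fromℕ< j<1+d) ⟨
    (1ℚ + ⟦ m ⟧) * extend b (toℕ i) - c (toℕ i)             ≡⟨ cong (λ z → (1ℚ + ⟦ m ⟧) * z - c (toℕ i)) (extend-toℕ b i) ⟩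
    a i                                                     ≡⟨ unique a (integral-- (λ j → (1ℚ + ⟦ m ⟧) * b j) (c ∘ toℕ) (integral-* (1ℚ + ⟦ m ⟧) b (int-+ int-1 (int-⟦⟧ m)) integral-b) (integral-int (c ∘ toℕ) (λ j → c-int (toℕ j))))
                                                                 (trans (∑-cong a≡) (trans (∑-toℕ (suc d) a′) Σ≡1)) (λ j → subst (0ℚ <_) (sym (a≡ j)) (a>0 (toℕ j) (Fin.toℕ<n j))) i ⟩
    b i                                                     ≡⟨ extend-< b j<1+d ⟨
    extend b j                                              ∎
    where
    open ≡-Reasoning
    i : Fin (suc d)
    i = fromℕ< j<1+d
    a : Fin (suc d) → ℚ
    a j = (1ℚ + ⟦ m ⟧) * b j - c (toℕ j)
    a′ : ℕ → ℚ
    a′ j = (1ℚ + ⟦ m ⟧) * extend b j - c j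
    a≡ : ∀ j → a j ≡ a′ (toℕ j)
    a≡ j = cong (λ z → (1ℚ + ⟦ m ⟧) * z - c (toℕ j)) (sym (extend-toℕ b j))

  product-sum : ∀ k → k ℕ.≤ d → Π< k (extend b) ≤ 1ℚ - Σ< k (extend b)
  product-sum = product-sum-≤ d (extend b)
    (λ j j<1+d → subst (0ℚ <_) (sym (extend-< b j<1+d)) (b>0 (fromℕ< j<1+d)))
    (trans (sym (∑-extend b)) (total B)) unique-multiple

-- Unimodular images

δ-coordinates : ∀ {n d} (v : Fin n → ℚ^ d) j → Coordinates v (δ j) (v j)
δ-coordinates v j = coordinates
  (trans (∑-cong λ l → sym (ℚ.*-identityʳ (δ j l))) (∑-δ j (λ _ → 1ℚ)))
  (λ k → ∑-δ j (λ l → lookup (v l) k))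

vertex∈conv : ∀ {n d} (v : Fin n → ℚ^ d) j → conv v (v j)
vertex∈conv v j = δ j , δ-nonNeg j , toBarycentric (δ-coordinates v j)

compose-coordinates : ∀ {m n d} {v : Fin n → ℚ^ d} {x : Fin m → ℚ^ d} {y a} {M : Fin m → Fin n → ℚ} →
  (∀ k → Coordinates v (M k) (x k)) → Coordinates x a y → Coordinates v (λ l → ∑ (λ k → a k * M k l)) y
compose-coordinates {m} {n} {d} {v} {x} {y} {a} {M} X A = coordinates
  (begin
    ∑ (λ l → ∑ (λ k → a k * M k l))   ≡⟨ ∑-swap (λ l k → a k * M k l) ⟩
    ∑ (λ k → ∑ (λ l → a k * M k l))   ≡⟨ ∑-cong (λ k → trans (∑-*ˡ (a k) (M k)) (trans (cong (a k *_) (total (X k))) (ℚ.*-identityʳ (a k)))) ⟩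
    ∑ a                               ≡⟨ total A ⟩
    1ℚ                                ∎)
  (λ r → begin
    ∑ (λ l → ∑ (λ k → a k * M k l) * lookup (v l) r)     ≡⟨ ∑-cong (λ l → sym (∑-*ʳ (λ k → a k * M k l) (lookup (v l) r))) ⟩
    ∑ (λ l → ∑ (λ k → (a k * M k l) * lookup (v l) r))   ≡⟨ ∑-swap (λ l k → (a k * M k l) * lookup (v l) r) ⟩
    ∑ (λ k → ∑ (λ l → (a k * M k l) * lookup (v l) r))
      ≡⟨ ∑-cong (λ k → trans (∑-cong λ l → ℚ.*-assoc (a k) (M k l) (lookup (v l) r))
           (trans (∑-*ˡ (a k) (λ l → M k l * lookup (v l) r)) (cong (a k *_) (point (X k) r)))) ⟩
    ∑ (λ k → a k * lookup (x k) r)                       ≡⟨ point A r ⟩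
    lookup y r                                           ∎)
  where open ≡-Reasoning

coordinates-functional : ∀ {n d} {v : Fin n → ℚ^ d} {a x y} → Coordinates v a x → Coordinates v a y → x ≡ y
coordinates-functional X Y = lookup-ext λ k → trans (sym (point X k)) (point Y k)

affine-coordinates : ∀ {n d} {φ : ℚ^ d → ℚ^ d} → IsAffine φ → ∀ {x : Fin n → ℚ^ d} {a y} →
  Coordinates x a y → Coordinates (φ ∘ x) a (φ y)
affine-coordinates {n} {d} {φ} (A , t , φ≡) {x} {a} {y} C = coordinates (total C) λ r → begin
  ∑ (λ j → a j * lookup (φ (x j)) r)
    ≡⟨ ∑-cong (λ j → trans (cong (a j *_) (row (x j) r)) (trans (ℚ.*-distribˡ-+ (a j) (linear (x j) r) (lookup t r))
         (cong (_+ a j * lookup t r) (sym (∑-*ˡ (a j) (λ c → A r c * lookup (x j) c)))))) ⟩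
  ∑ (λ j → ∑ (λ c → a j * (A r c * lookup (x j) c)) + a j * lookup t r)
    ≡⟨ ∑-+ (λ j → ∑ (λ c → a j * (A r c * lookup (x j) c))) (λ j → a j * lookup t r) ⟩
  ∑ (λ j → ∑ (λ c → a j * (A r c * lookup (x j) c))) + ∑ (λ j → a j * lookup t r)
    ≡⟨ cong₂ _+_ (∑-swap (λ j c → a j * (A r c * lookup (x j) c)))
         (trans (∑-*ʳ a (lookup t r)) (trans (cong (_* lookup t r) (total C)) (ℚ.*-identityˡ (lookup t r)))) ⟩
  ∑ (λ c → ∑ (λ j → a j * (A r c * lookup (x j) c))) + lookup t r
    ≡⟨ cong (_+ lookup t r) (∑-cong λ c → trans
         (∑-cong λ j → solve 3 (λ a m x → a :* (m :* x) := m :* (a :* x)) refl (a j) (A r c) (lookup (x j) c))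
         (trans (∑-*ˡ (A r c) (λ j → a j * lookup (x j) c)) (cong (A r c *_) (point C c)))) ⟩
  linear y r + lookup t r
    ≡⟨ row y r ⟨
  lookup (φ y) r ∎
  where
  open ≡-Reasoning
  linear : ℚ^ d → Fin d → ℚ
  linear x r = ∑ (λ c → A r c * lookup x c)
  row : ∀ x r → lookup (φ x) r ≡ linear x r + lookup t r
  row x r = trans (cong (λ z → lookup z r) (φ≡ x)) (trans (lookup-zipWith _+_ r (tabulate (linear x)) t)
    (cong (_+ lookup t r) (lookup∘tabulate (linear x) r)))

positive-term : ∀ {n} (f : Fin n → ℚ) → 0ℚ < ∑ f → ∃ λ k → 0ℚ < f k
positive-term {n} f ∑f>0 with Fin.any? (λ k → 0ℚ ℚ.<? f k)
... | yes found = found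
... | no  none  = ⊥-elim (ℚ.<-irrefl refl (ℚ.<-≤-trans ∑f>0 (ℚ.≤-trans
        (∑-mono-≤ λ k → ℚ.≮⇒≥ λ 0<fk → none (k , 0<fk)) (ℚ.≤-reflexive (∑-0 n)))))

-- φ and its inverse on vertices are given by nonnegative matrices inverse to each other.
abstract
  vertex↦vertex : ∀ {m n d} {v : Fin n → ℚ^ d} {w : Fin m → ℚ^ d} {φ} → AffinelyIndependent v →
    IsAffine φ → Injective _≡_ _≡_ φ → image φ (conv v) ≐ conv w → ∀ j → ∃ λ k → w k ≡ φ (v j)
  vertex↦vertex {m} {n} {d} {v} {w} {φ} indep aff inj (img⊆ , ⊆img) j = k , trans (sym (φx≡w k)) (cong φ xk≡vj)
    where
    target : conv w (φ (v j))
    target = img⊆ (v j , vertex∈conv v j , refl)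
    M : Fin m → ℚ
    M = proj₁ target
    preimage : ∀ k → image φ (conv v) (w k)
    preimage k = ⊆img (vertex∈conv w k)
    x : Fin m → ℚ^ d
    x k = proj₁ (preimage k)
    φx≡w : ∀ k → φ (x k) ≡ w k
    φx≡w k = proj₂ (proj₂ (preimage k))
    M′ : Fin m → Fin n → ℚ
    M′ k = proj₁ (proj₁ (proj₂ (preimage k)))
    M′≥0 : ∀ k l → 0ℚ ≤ M′ k l
    M′≥0 k = proj₁ (proj₂ (proj₁ (proj₂ (preimage k))))
    M′-coordinates : ∀ k → Coordinates v (M′ k) (x k)
    M′-coordinates k = fromBarycentric v (M′ k) (x k) (proj₂ (proj₂ (proj₁ (proj₂ (preimage k)))))
    M-coordinates : Coordinates w M (φ (v j))
    M-coordinates = fromBarycentric w M (φ (v j)) (proj₂ (proj₂ target))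
    X : Coordinates x M (combination M x)
    X = coordinates (total M-coordinates) (λ r → sym (combination-lookup M x r))
    φX : Coordinates w M (φ (combination M x))
    φX = coordinates (total M-coordinates) (λ r → trans
      (∑-cong λ k → cong (λ z → M k * lookup z r) (sym (φx≡w k))) (point (affine-coordinates aff X) r))
    vj : Coordinates x M (v j)
    vj = subst (Coordinates x M) (inj (coordinates-functional φX M-coordinates)) X
    product : ∀ l → ∑ (λ k → M k * M′ k l) ≡ δ j l
    product = barycentric-unique indep (compose-coordinates M′-coordinates vj) (δ-coordinates v j)
    -- A vertex `w k` that contributes to `φ (v j)`. For `l` other than `j`, the nonnegative terms
    -- `M k * M′ k l` add up to `δ j l = 0`, so the preimage of `w k` has no weight away from `v j`.
    choice : ∃ λ k → 0ℚ < M k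
    choice = positive-term M (subst (0ℚ <_) (sym (total M-coordinates)) 0<1)
    k : Fin m
    k = proj₁ choice
    off-diagonal : ∀ l → j ≢ l → M′ k l ≡ 0ℚ
    off-diagonal l j≢l = *≡0 (>⇒≢ (proj₂ choice)) (ℚ.≤-antisym
      (ℚ.≤-trans (f≤∑f {f = λ k → M k * M′ k l} (λ k → 0≤* (proj₁ (proj₂ target) k) (M′≥0 k l)) k)
        (ℚ.≤-reflexive (trans (product l) (δ-≢ j≢l))))
      (0≤* (ℚ.<⇒≤ (proj₂ choice)) (M′≥0 k l)))
    M′kj≡1 : M′ k j ≡ 1ℚ
    M′kj≡1 = trans (sym (∑-single (M′ k) j off-diagonal)) (total (M′-coordinates k))
    xk≡vj : x k ≡ v j
    xk≡vj = lookup-ext λ r → begin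
      lookup (x k) r                          ≡⟨ point (M′-coordinates k) r ⟨
      ∑ (λ l → M′ k l * lookup (v l) r)       ≡⟨ ∑-single (λ l → M′ k l * lookup (v l) r) j (λ l j≢l → trans (cong (_* lookup (v l) r) (off-diagonal l j≢l)) (ℚ.*-zeroˡ (lookup (v l) r))) ⟩
      M′ k j * lookup (v j) r                 ≡⟨ trans (cong (_* lookup (v j) r) M′kj≡1) (ℚ.*-identityˡ (lookup (v j) r)) ⟩
      lookup (v j) r                          ∎
      where open ≡-Reasoning

vertex-injective : ∀ {n d} {v : Fin n → ℚ^ d} → AffinelyIndependent v → ∀ {j l} → v j ≡ v l → j ≡ l
vertex-injective {v = v} indep {j} {l} vj≡vl with j Fin.≟ l
... | yes j≡l = j≡l
... | no  j≢l = ⊥-elim (ℚ.1≢0 (trans (sym (δ-≡ j))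
  (trans (barycentric-unique indep (δ-coordinates v j) (subst (Coordinates v (δ l)) (sym vj≡vl) (δ-coordinates v l)) j) (δ-≢ (j≢l ∘ sym)))))

-- Moving each weight `a j` to the index `g j` gives coordinates with respect to `w`; by injectivity
-- of `g` no two weights merge, and uniqueness compares the result with `c`.
reindex-coordinates : ∀ {n d} {v w : Fin n → ℚ^ d} {a c x} → AffinelyIndependent w →
  (g : Fin n → Fin n) → Injective _≡_ _≡_ g → (∀ j → w (g j) ≡ v j) →
  Coordinates v a x → Coordinates w c x → ∀ j → a j ≡ c (g j)
reindex-coordinates {v = v} {w} {a} {c} {x} indep g g-inj w∘g A C j = begin
  a j                                  ≡⟨ ℚ.*-identityʳ (a j) ⟨
  a j * 1ℚ                             ≡⟨ cong (a j *_) (δ-≡ (g j)) ⟨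
  a j * δ (g j) (g j)                  ≡⟨ ∑-single (λ l → a l * δ (g l) (g j)) j (λ l j≢l → trans (cong (a l *_) (δ-≢ (j≢l ∘ sym ∘ g-inj))) (ℚ.*-zeroʳ (a l))) ⟨
  ∑ (λ l → a l * δ (g l) (g j))        ≡⟨ barycentric-unique indep
                                            (compose-coordinates (λ l → subst (Coordinates w (δ (g l))) (w∘g l) (δ-coordinates w (g l))) A) C (g j) ⟩
  c (g j)                              ∎
  where open ≡-Reasoning

-- The simplices `T₁ d i` and what equivalence to them implies

module Target (d : ℕ) (i : Fin (suc d)) where

  w : Fin (suc d) → ℚ^ d
  w j = ι (T₁-vertex d i j)

  w-suc-lookup : ∀ j k → lookup (w (suc j)) k ≡ δ k j * ⟦ scale d i (toℕ j) ⟧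
  w-suc-lookup j k = trans (ι-lookup (T₁-vertex d i (suc j)) k)
    (trans (cong fromℤ (lookup∘tabulate (λ k → if does (k Fin.≟ j) then + scale d i (toℕ j) else + 0) k)) entry)
    where
    entry : fromℤ (if does (k Fin.≟ j) then + scale d i (toℕ j) else + 0) ≡ δ k j * ⟦ scale d i (toℕ j) ⟧
    entry with does (k Fin.≟ j)
    ... | true  = sym (ℚ.*-identityˡ ⟦ scale d i (toℕ j) ⟧)
    ... | false = trans fromℤ-0 (sym (ℚ.*-zeroˡ ⟦ scale d i (toℕ j) ⟧))

  w-point : ∀ (c : Fin (suc d) → ℚ) k → ∑ (λ j → c j * lookup (w j) k) ≡ c (suc k) * ⟦ scale d i (toℕ k) ⟧
  w-point c k = begin
    c zero * lookup (w zero) k + ∑ (λ j → c (suc j) * lookup (w (suc j)) k)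
      ≡⟨ cong₂ _+_
           (trans (cong (c zero *_) (trans (ι-lookup (T₁-vertex d i zero) k) (trans (cong fromℤ (lookup-replicate k (+ 0))) fromℤ-0))) (ℚ.*-zeroʳ (c zero)))
           (∑-cong λ j → trans (cong (c (suc j) *_) (w-suc-lookup j k))
             (solve 3 (λ c δ s → c :* (δ :* s) := δ :* (c :* s)) refl (c (suc j)) (δ k j) ⟦ scale d i (toℕ j) ⟧)) ⟩
    0ℚ + ∑ (λ j → δ k j * (c (suc j) * ⟦ scale d i (toℕ j) ⟧))
      ≡⟨ trans (ℚ.+-identityˡ _) (∑-δ k (λ j → c (suc j) * ⟦ scale d i (toℕ j) ⟧)) ⟩
    c (suc k) * ⟦ scale d i (toℕ k) ⟧ ∎
    where open ≡-Reasoning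

  0<scale : ∀ j → 0ℚ < ⟦ scale d i j ⟧
  0<scale j = 0<⟦⟧ (scale d i j) ⦃ scale-nonZero {d} {i} {j} ⦄

  1/scale : ℕ → ℚ
  1/scale j = _/_ (+ 1) (scale d i j) ⦃ scale-nonZero {d} {i} {j} ⦄

  scale*1/scale : ∀ j → ⟦ scale d i j ⟧ * 1/scale j ≡ 1ℚ
  scale*1/scale j = 1/-inverse (scale d i j) ⦃ scale-nonZero {d} {i} {j} ⦄

  w-independent : AffinelyIndependent w
  w-independent c ∑c≡0 comb≡0 = λ where
      (suc k) → c-suc k
      zero    → begin
        c zero                       ≡⟨ ℚ.+-identityʳ (c zero) ⟨
        c zero + 0ℚ                  ≡⟨ cong (λ z → c zero + z) (trans (∑-cong c-suc) (∑-0 d)) ⟨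
        c zero + ∑ (c ∘ suc)         ≡⟨ ∑c≡0 ⟩
        0ℚ                           ∎
    where
    open ≡-Reasoning
    c-suc : ∀ k → c (suc k) ≡ 0ℚ
    c-suc k = *≡0 (>⇒≢ (0<scale (toℕ k))) (begin
      ⟦ scale d i (toℕ k) ⟧ * c (suc k)  ≡⟨ ℚ.*-comm ⟦ scale d i (toℕ k) ⟧ (c (suc k)) ⟩
      c (suc k) * ⟦ scale d i (toℕ k) ⟧  ≡⟨ w-point c k ⟨
      ∑ (λ j → c j * lookup (w j) k)     ≡⟨ combination-lookup c w k ⟨
      lookup (combination c w) k         ≡⟨ cong (λ x → lookup x k) comb≡0 ⟩
      lookup (replicate d 0ℚ) k          ≡⟨ lookup-replicate k 0ℚ ⟩
      0ℚ                                 ∎)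

  1/scale-< : ∀ {j} → j ℕ.< toℕ i → 1/scale j ≡ 1/s j
  1/scale-< {j} j<i = 1/-cong ⦃ scale-nonZero {d} {i} {j} ⦄ ⦃ +1-nonZero (∏s j) ⦄ (scale-< {d} {i} j<i)

  1/scale-≥ : ∀ {j} → toℕ i ℕ.≤ j → 1/scale j ≡ bound d i
  1/scale-≥ {j} i≤j = 1/-cong ⦃ scale-nonZero {d} {i} {j} ⦄ ⦃ D-nonZero {d} {i} ⦄ (scale-≥ {d} {i} i≤j)

  center : ℤ^ d
  center = replicate d (+ 1)

  -- The vertices on the axes need the weights `1/scale` to produce the all-ones point; the origin
  -- takes the rest, which is one more copy of `bound d i`.
  weight : Fin (suc d) → ℚ
  weight zero    = bound d i
  weight (suc k) = 1/scale (toℕ k)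

  weight>0 : ∀ j → 0ℚ < weight j
  weight>0 zero    = 0<bound d i
  weight>0 (suc k) = 0<1/ (scale d i (toℕ k)) ⦃ scale-nonZero {d} {i} {toℕ k} ⦄

  center-coordinates : Coordinates w weight (ι center)
  center-coordinates = coordinates
    (begin
      bound d i + ∑ {d} (1/scale ∘ toℕ)                      ≡⟨ cong (λ z → bound d i + z) (∑-toℕ d 1/scale) ⟩
      bound d i + Σ< d 1/scale                               ≡⟨ cong (λ n → bound d i + Σ< n 1/scale) (ℕ.m+[n∸m]≡n m≤d) ⟨
      bound d i + Σ< (m ℕ.+ (d ℕ.∸ m)) 1/scale               ≡⟨ cong (λ z → bound d i + z) (Σ<-split m (d ℕ.∸ m) 1/scale) ⟩
      bound d i + (Σ< m 1/scale + Σ< (d ℕ.∸ m) (λ j → 1/scale (m ℕ.+ j)))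
        ≡⟨ cong₂ (λ y z → bound d i + (y + z)) (Σ<-cong m λ j → 1/scale-<)
             (trans (Σ<-cong (d ℕ.∸ m) λ j _ → 1/scale-≥ (ℕ.m≤m+n m j)) (Σ<-const (d ℕ.∸ m) (bound d i))) ⟩
      bound d i + (Σ< m 1/s + ⟦ d ℕ.∸ m ⟧ * bound d i)
        ≡⟨ solve 3 (λ b s l → b :+ (s :+ l :* b) := s :+ (l :+ con 1ℚ) :* b) refl (bound d i) (Σ< m 1/s) ⟦ d ℕ.∸ m ⟧ ⟩
      Σ< m 1/s + (⟦ d ℕ.∸ m ⟧ + 1ℚ) * bound d i
        ≡⟨ cong (λ z → Σ< m 1/s + z * bound d i) (trans (⟦⟧-+ (d ℕ.∸ m) 1) (cong (λ z → ⟦ d ℕ.∸ m ⟧ + z) fromℤ-1)) ⟨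
      Σ< m 1/s + ⟦ d ℕ.∸ m ℕ.+ 1 ⟧ * bound d i               ≡⟨ cong (λ z → Σ< m 1/s + z) (multiplicity*bound d i) ⟩
      Σ< m 1/s + Π< m 1/s                                    ≡⟨ Σ1/s+Π1/s≡1 m ⟩
      1ℚ                                                     ∎)
    (λ k → begin
      ∑ (λ j → weight j * lookup (w j) k)        ≡⟨ w-point weight k ⟩
      1/scale (toℕ k) * ⟦ scale d i (toℕ k) ⟧    ≡⟨ trans (ℚ.*-comm (1/scale (toℕ k)) ⟦ scale d i (toℕ k) ⟧) (scale*1/scale (toℕ k)) ⟩
      1ℚ                                         ≡⟨ trans (cong fromℤ (lookup-replicate k (+ 1))) fromℤ-1 ⟨
      fromℤ (lookup center k)                    ≡⟨ ι-lookup center k ⟨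
      lookup (ι center) k                        ∎)
    where
    open ≡-Reasoning
    m : ℕ
    m = toℕ i
    m≤d : m ℕ.≤ d
    m≤d = Fin.toℕ≤pred[n] i

-- The shift by one reflects that index `zero` of `T₁` is the origin, whose weight does not exceed
-- the bound.
shifted-pigeonhole : ∀ {m n} (h : Fin (suc m) → Fin (suc n)) → Injective _≡_ _≡_ h →
  ¬ (∀ j → ∃ λ k → h j ≡ suc k × toℕ k ℕ.< m)
shifted-pigeonhole {m} {n} h h-inj below = ℕ.<-irrefl refl (Fin.injective⇒≤ {f = f} f-inj)
  where
  f : Fin (suc m) → Fin m
  f j = fromℕ< (proj₂ (proj₂ (below j)))
  toℕ-f : ∀ j → toℕ (f j) ≡ toℕ (proj₁ (below j))
  toℕ-f j = Fin.toℕ-fromℕ< (proj₂ (proj₂ (below j)))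
  f-inj : Injective _≡_ _≡_ f
  f-inj {j} {l} eq = h-inj (trans (proj₁ (proj₂ (below j)))
    (trans (cong suc (Fin.toℕ-injective (trans (sym (toℕ-f j)) (trans (cong toℕ eq) (toℕ-f l)))))
      (sym (proj₁ (proj₂ (below l))))))

module Equivalent {d} (S : 𝒮 d 1) {p : ℤ^ d} (p-int : Interior (𝒮.points S) (ι p))
  {b : Fin (suc d) → ℚ} (B : Coordinates (𝒮.vertex S) b (ι p)) (i : Fin (suc d)) where

  open 𝒮 S
  open Target d i

  -- The preimage of the all-ones point is integral because φ preserves the lattice, and its
  -- coordinates are the positive weights carried back along the vertex matching `g`; so it is an
  -- interior integral point, that is, `p`.
  relabelling : UnimodularlyEquivalent points (T₁ d i) →
    ∃ λ (g : Fin (suc d) → Fin (suc d)) → Injective _≡_ _≡_ g × (∀ j → b j ≡ weight (g j))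
  relabelling (φ , aff , (inj , _) , (_ , lattice⊆) , img) = g , g-inj , b≡
    where
    g : Fin (suc d) → Fin (suc d)
    g j = proj₁ (vertex↦vertex {v = vertex} {w} {φ} independent aff inj img j)
    w∘g : ∀ j → w (g j) ≡ φ (vertex j)
    w∘g j = proj₂ (vertex↦vertex {v = vertex} {w} {φ} independent aff inj img j)
    g-inj : Injective _≡_ _≡_ g
    g-inj {j} {l} gj≡gl = vertex-injective {v = vertex} independent (inj (trans (sym (w∘g j)) (trans (cong w gj≡gl) (w∘g l))))
    source : image φ points (ι center)
    source = proj₂ img (weight , (λ j → ℚ.<⇒≤ (weight>0 j)) , toBarycentric center-coordinates)
    lattice-source : image φ (ℤ-lattice d) (ι center)
    lattice-source = lattice⊆ (center , refl)
    x : ℚ^ d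
    x = proj₁ source
    φx≡center : φ x ≡ ι center
    φx≡center = proj₂ (proj₂ source)
    a : Fin (suc d) → ℚ
    a = proj₁ (proj₁ (proj₂ source))
    A : Coordinates vertex a x
    A = fromBarycentric vertex a x (proj₂ (proj₂ (proj₁ (proj₂ source))))
    a≡ : ∀ j → a j ≡ weight (g j)
    a≡ = reindex-coordinates {w = w} w-independent g g-inj w∘g
      (subst (Coordinates (φ ∘ vertex) a) φx≡center (affine-coordinates aff A)) center-coordinates
    q : ℤ^ d
    q = proj₁ (proj₁ (proj₂ lattice-source))
    ιq≡x : ι q ≡ x
    ιq≡x = trans (proj₂ (proj₁ (proj₂ lattice-source))) (inj (trans (proj₂ (proj₂ lattice-source)) (sym φx≡center)))
    q≡p : q ≡ p
    q≡p = unique-interior-point S (subst (Interior points) (sym ιq≡x)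
      (positive⇒interior independent A (λ j → subst (0ℚ <_) (sym (a≡ j)) (weight>0 (g j))))) p-int
    b≡ : ∀ j → b j ≡ weight (g j)
    b≡ j = trans (barycentric-unique independent B (subst (Coordinates vertex a) (trans (sym ιq≡x) (cong ι q≡p)) A) j) (a≡ j)

  -- Only toℕ i of the weights exceed the bound, so b 0, …, b i cannot all do so.
  ≤-bound : UnimodularlyEquivalent points (T₁ d i) → (∀ j k → j ≤ᶠ k → b k ≤ b j) → b i ≤ bound d i
  ≤-bound equiv decreasing = ≤-bound′ (relabelling equiv)
    where
    m<1+d : suc (toℕ i) ℕ.≤ suc d
    m<1+d = Fin.toℕ<n i
    heavy-weight : ∀ j → bound d i < weight j → ∃ λ k → j ≡ suc k × toℕ k ℕ.< toℕ i
    heavy-weight zero    h = ⊥-elim (ℚ.<-irrefl refl h)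
    heavy-weight (suc k) h with toℕ k ℕ.<? toℕ i
    ... | yes k<i = k , refl , k<i
    ... | no  k≮i = ⊥-elim (ℚ.<-irrefl (sym (1/scale-≥ (ℕ.≮⇒≥ k≮i))) h)
    ≤-bound′ : (∃ λ (g : Fin (suc d) → Fin (suc d)) → Injective _≡_ _≡_ g × (∀ j → b j ≡ weight (g j))) → b i ≤ bound d i
    ≤-bound′ (g , g-inj , b≡) = ℚ.≮⇒≥ λ bound<bi → shifted-pigeonhole (λ j → g (inject≤ j m<1+d))
      (λ {j} {l} eq → Fin.inject≤-injective m<1+d m<1+d j l (g-inj eq))
      (λ j → heavy-weight (g (inject≤ j m<1+d)) (ℚ.<-≤-trans bound<bi
        (ℚ.≤-trans (decreasing (inject≤ j m<1+d) i (ℕ.≤-trans (ℕ.≤-reflexive (Fin.toℕ-inject≤ j m<1+d)) (ℕ.≤-pred (Fin.toℕ<n j))))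
          (ℚ.≤-reflexive (b≡ (inject≤ j m<1+d))))))

unimodular-⊆ : ∀ {d} (P P′ Q : Subset d) → (∀ x → P x → P′ x) → (∀ x → P′ x → P x) →
  UnimodularlyEquivalent P Q → UnimodularlyEquivalent P′ Q
unimodular-⊆ P P′ Q P⊆P′ P′⊆P (φ , aff , bij , lat , (img⊆ , ⊆img)) = φ , aff , bij , lat ,
  (λ { (x , x∈P′ , eq) → img⊆ (x , P′⊆P x x∈P′ , eq) }) ,
  (λ y∈Q → let x , x∈P , eq = ⊆img y∈Q in x , P⊆P′ x x∈P , eq)

-- Simplices with extremal coordinates

extend-int : ∀ {n} (f : Fin n → ℚ) → (∀ i → IsInt (f i)) → ∀ j → IsInt (extend f j)
extend-int {zero}  f h j       = int-0
extend-int {suc n} f h zero    = h zero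
extend-int {suc n} f h (suc j) = extend-int (f ∘ suc) (h ∘ suc) j

s∣∏s : ∀ {j} n → j ℕ.< n → ∃ λ t → ∏s n ≡ s j ℕ.* t
s∣∏s {j} (suc n) j<1+n with ℕ.m<1+n⇒m<n∨m≡n j<1+n
... | inj₁ j<n with t , eq ← s∣∏s n j<n = t ℕ.* s n , trans (cong (ℕ._* s n) eq) (ℕ.*-assoc (s j) t (s n))
... | inj₂ refl = ∏s n , ℕ.*-comm (∏s n) (s n)

Congruent : ℚ → ℚ → ℕ → Set
Congruent z K n = ∃ λ c → IsInt c × z ≡ K + ⟦ n ⟧ * c

-- ∏s n ≡ -1 modulo s n, and ∏s n ≡ 0 modulo all earlier s j.
chinese-remainder : ∀ n (z : ℕ → ℚ) → (∀ j → IsInt (z j)) →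
  ∃ λ K → IsInt K × (∀ j → j ℕ.< n → Congruent (z j) K (s j))
chinese-remainder zero    z z-int = 0ℚ , int-0 , λ _ ()
chinese-remainder (suc n) z z-int with K , K-int , cong-K ← chinese-remainder n z z-int =
  K′ , int-+ K-int (int-* (int-⟦⟧ (∏s n)) e-int) , cong-K′
  where
  e K′ : ℚ
  e  = K - z n
  K′ = K + ⟦ ∏s n ⟧ * e
  e-int : IsInt e
  e-int = int-- K-int (z-int n)
  open ≡-Reasoning
  cong-K′ : ∀ j → j ℕ.< suc n → Congruent (z j) K′ (s j)
  cong-K′ j j<1+n with ℕ.m<1+n⇒m<n∨m≡n j<1+n
  ... | inj₂ refl = - e , int-neg e-int , (begin
          z n                                       ≡⟨ solve 3 (λ K p z → z := (K :+ p :* (K :- z)) :+ (p :+ con 1ℚ) :* (:- (K :- z))) refl K ⟦ ∏s n ⟧ (z n) ⟩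
          K′ + (⟦ ∏s n ⟧ + 1ℚ) * - e                ≡⟨ cong (λ t → K′ + t * - e) (⟦s⟧ n) ⟨
          K′ + ⟦ s n ⟧ * - e                        ∎)
  ... | inj₁ j<n with c , c-int , eq ← cong-K j j<n | t , ∏≡ ← s∣∏s n j<n =
          c - ⟦ t ⟧ * e , int-- c-int (int-* (int-⟦⟧ t) e-int) , (begin
          z j                                       ≡⟨ eq ⟩
          K + ⟦ s j ⟧ * c                           ≡⟨ solve 5 (λ K s c t e → K :+ s :* c := (K :+ (s :* t) :* e) :+ s :* (c :- t :* e)) refl K ⟦ s j ⟧ c ⟦ t ⟧ e ⟩
          (K + (⟦ s j ⟧ * ⟦ t ⟧) * e) + ⟦ s j ⟧ * (c - ⟦ t ⟧ * e)
            ≡⟨ cong (λ p → (K + p * e) + ⟦ s j ⟧ * (c - ⟦ t ⟧ * e)) (trans (cong ⟦_⟧ ∏≡) (⟦⟧-* (s j) t)) ⟨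
          K′ + ⟦ s j ⟧ * (c - ⟦ t ⟧ * e)            ∎)

finite-chinese-remainder : ∀ {d} (z : Fin d → ℚ) → (∀ k → IsInt (z k)) →
  ∃ λ K → IsInt K × (∀ k → Congruent (z k) K (s (toℕ k)))
finite-chinese-remainder {d} z z-int with K , K-int , congs ← chinese-remainder d (extend z) (extend-int z z-int) =
  K , K-int , λ k → subst (λ x → Congruent x K (s (toℕ k))) (extend-toℕ z k) (congs (toℕ k) (Fin.toℕ<n k))

-- The vertices are labelled to match `T₁ d (fromℕ d)`: vertex `zero` has the coordinate left over
-- by the `1/s` and goes to the origin, while `suc k` goes to the vertex on axis `k`.
module Converse {d} (S : 𝒮 d 1) {p : ℤ^ d} (p-int : Interior (𝒮.points S) (ι p))
  {b : Fin (suc d) → ℚ} (B : Coordinates (𝒮.vertex S) b (ι p)) (b-suc : ∀ k → b (suc k) ≡ 1/s (toℕ k)) where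

  open 𝒮 S
  open UniquePoint S p-int B
  open Target d (fromℕ d) using (w; w-point; w-independent)

  private
    σ : Fin d → ℚ
    σ k = ⟦ s (toℕ k) ⟧

    σ>0 : ∀ k → 0ℚ < σ k
    σ>0 k = 0<⟦⟧ (s (toℕ k)) ⦃ +1-nonZero (∏s (toℕ k)) ⦄

    r : Fin d → ℚ
    r k = 1/s (toℕ k)

    σ*r : ∀ k → σ k * r k ≡ 1ℚ
    σ*r k = s*1/s (toℕ k)

    σ*b : ∀ k → σ k * b (suc k) ≡ 1ℚ
    σ*b k = trans (cong (σ k *_) (b-suc k)) (σ*r k)

    scale≡s : ∀ k → scale d (fromℕ d) (toℕ k) ≡ s (toℕ k)
    scale≡s k = scale-< {d} {fromℕ d} (subst (toℕ k ℕ.<_) (sym (Fin.toℕ-fromℕ d)) (Fin.toℕ<n k))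

    -- The barycentric coordinates of `y` in the target simplex; used as weights on the vertices of
    -- `S` they define `ψ`, the inverse of the equivalence.
    coef : ℚ^ d → Fin (suc d) → ℚ
    coef y zero    = 1ℚ - ∑ (λ k → lookup y k * r k)
    coef y (suc k) = lookup y k * r k

    ∑coef≡1 : ∀ y → ∑ (coef y) ≡ 1ℚ
    ∑coef≡1 y = solve 1 (λ t → (con 1ℚ :- t) :+ t := con 1ℚ) refl (∑ (λ k → lookup y k * r k))

    target-coordinates : ∀ y → Coordinates w (coef y) y
    target-coordinates y = coordinates (∑coef≡1 y) λ k → begin
      ∑ (λ j → coef y j * lookup (w j) k)                  ≡⟨ w-point (coef y) k ⟩
      (lookup y k * r k) * ⟦ scale d (fromℕ d) (toℕ k) ⟧   ≡⟨ cong (λ n → (lookup y k * r k) * ⟦ n ⟧) (scale≡s k) ⟩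
      (lookup y k * r k) * σ k                             ≡⟨ solve 3 (λ y r s → (y :* r) :* s := y :* (s :* r)) refl (lookup y k) (r k) (σ k) ⟩
      lookup y k * (σ k * r k)                             ≡⟨ trans (cong (lookup y k *_) (σ*r k)) (ℚ.*-identityʳ (lookup y k)) ⟩
      lookup y k                                           ∎
      where open ≡-Reasoning

    ψ : ℚ^ d → ℚ^ d
    ψ y = combination (coef y) vertex

    ψ-coordinates : ∀ y → Coordinates vertex (coef y) (ψ y)
    ψ-coordinates y = coordinates (∑coef≡1 y) λ k → sym (combination-lookup (coef y) vertex k)

    -- An integral correction whose entry `zero` makes the total `K - 1`, so that subtracting it
    -- from `K` times `b` gives coordinates of sum 1.
    shift : ℚ → (Fin d → ℚ) → Fin (suc d) → ℚ
    shift K n zero    = (K + ∑ n) - 1ℚ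
    shift K n (suc k) = - n k

    shift-int : ∀ K n → IsInt K → (∀ k → IsInt (n k)) → ∀ j → IsInt (shift K n j)
    shift-int K n K-int n-int zero    = int-- (int-+ K-int (∑-int n-int)) int-1
    shift-int K n K-int n-int (suc k) = int-neg (n-int k)

    ∑shift : ∀ K n → ∑ (shift K n) ≡ K - 1ℚ
    ∑shift K n = trans (cong (λ t → ((K + ∑ n) - 1ℚ) + t) (∑-neg n))
      (solve 2 (λ K t → ((K :+ t) :- con 1ℚ) :+ (:- t) := K :- con 1ℚ) refl K (∑ n))

    ∑-suc : ∀ (a : Fin (suc d) → ℚ) → ∑ a ≡ 1ℚ → a zero ≡ 1ℚ - ∑ (a ∘ suc)
    ∑-suc a ∑a≡1 = trans (solve 2 (λ x t → x := (x :+ t) :- t) refl (a zero) (∑ (a ∘ suc))) (cong (_- ∑ (a ∘ suc)) ∑a≡1)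

    -- Modulo integers, `x / s k` depends only on `x` modulo `s k`. One multiple `K b` can thus
    -- match prescribed numerators at all indices `suc k` at once.
    congruent-b : ∀ {x} K k → (c : Congruent x K (s (toℕ k))) → x * r k ≡ K * b (suc k) + proj₁ c
    congruent-b {x} K k (n , _ , eq) = begin
      x * r k                        ≡⟨ cong (_* r k) eq ⟩
      (K + σ k * n) * r k            ≡⟨ solve 4 (λ K s n r → (K :+ s :* n) :* r := K :* r :+ (s :* r) :* n) refl K (σ k) n (r k) ⟩
      K * r k + (σ k * r k) * n      ≡⟨ cong₂ (λ y t → K * y + t) (sym (b-suc k)) (trans (cong (_* n) (σ*r k)) (ℚ.*-identityˡ n)) ⟩
      K * b (suc k) + n              ∎
      where open ≡-Reasoning

  module _ (M : Fin (suc d) → Fin d → ℚ) (m : Fin (suc d) → ℚ) (coords : ∀ x → Coordinates vertex (affine M m x) x) where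

    private
      α : ℚ^ d → Fin (suc d) → ℚ
      α = affine M m

      φ : ℚ^ d → ℚ^ d
      φ x = tabulate λ k → σ k * α x (suc k)

      φ-lookup : ∀ x k → lookup (φ x) k ≡ σ k * α x (suc k)
      φ-lookup x k = lookup∘tabulate (λ k → σ k * α x (suc k)) k

      φ-affine : IsAffine φ
      φ-affine = (λ k c → σ k * M (suc k) c) , tabulate (λ k → σ k * m (suc k)) , λ x → lookup-ext λ k → begin
        lookup (φ x) k
          ≡⟨ φ-lookup x k ⟩
        σ k * (∑ (λ c → M (suc k) c * lookup x c) + m (suc k))
          ≡⟨ ℚ.*-distribˡ-+ (σ k) (∑ (λ c → M (suc k) c * lookup x c)) (m (suc k)) ⟩
        σ k * ∑ (λ c → M (suc k) c * lookup x c) + σ k * m (suc k)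
          ≡⟨ cong (_+ σ k * m (suc k)) (trans (sym (∑-*ˡ (σ k) (λ c → M (suc k) c * lookup x c)))
               (∑-cong λ c → sym (ℚ.*-assoc (σ k) (M (suc k) c) (lookup x c)))) ⟩
        linear x k + σ k * m (suc k)
          ≡⟨ cong₂ _+_ (lookup∘tabulate (linear x) k) (lookup∘tabulate (λ k → σ k * m (suc k)) k) ⟨
        lookup (tabulate (linear x)) k + lookup (tabulate (λ k → σ k * m (suc k))) k
          ≡⟨ lookup-zipWith _+_ k (tabulate (linear x)) (tabulate (λ k → σ k * m (suc k))) ⟨
        lookup (zipWith _+_ (tabulate (linear x)) (tabulate (λ k → σ k * m (suc k)))) k ∎
        where
        open ≡-Reasoning
        linear : ℚ^ d → Fin d → ℚ
        linear x k = ∑ (λ c → (σ k * M (suc k) c) * lookup x c)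

      coef-φ-suc : ∀ x k → coef (φ x) (suc k) ≡ α x (suc k)
      coef-φ-suc x k = begin
        lookup (φ x) k * r k           ≡⟨ cong (_* r k) (φ-lookup x k) ⟩
        (σ k * α x (suc k)) * r k      ≡⟨ solve 3 (λ s a r → (s :* a) :* r := a :* (s :* r)) refl (σ k) (α x (suc k)) (r k) ⟩
        α x (suc k) * (σ k * r k)      ≡⟨ trans (cong (α x (suc k) *_) (σ*r k)) (ℚ.*-identityʳ (α x (suc k))) ⟩
        α x (suc k)                    ∎
        where open ≡-Reasoning

      coef-φ : ∀ x j → coef (φ x) j ≡ α x j
      coef-φ x zero    = trans (cong (λ t → 1ℚ - t) (∑-cong (coef-φ-suc x))) (sym (∑-suc (α x) (total (coords x))))
      coef-φ x (suc k) = coef-φ-suc x k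

      φ∘ψ : ∀ y → φ (ψ y) ≡ y
      φ∘ψ y = lookup-ext λ k → begin
        lookup (φ (ψ y)) k            ≡⟨ φ-lookup (ψ y) k ⟩
        σ k * α (ψ y) (suc k)         ≡⟨ cong (σ k *_) (barycentric-unique independent (coords (ψ y)) (ψ-coordinates y) (suc k)) ⟩
        σ k * (lookup y k * r k)      ≡⟨ solve 3 (λ s y r → s :* (y :* r) := y :* (s :* r)) refl (σ k) (lookup y k) (r k) ⟩
        lookup y k * (σ k * r k)      ≡⟨ trans (cong (lookup y k *_) (σ*r k)) (ℚ.*-identityʳ (lookup y k)) ⟩
        lookup y k                    ∎
        where open ≡-Reasoning

      φ-injective : Injective _≡_ _≡_ φ
      φ-injective {x} {y} φx≡φy = coordinates-functional (coords x)
        (coordinates-cong (λ j → trans (sym (coef-φ y j)) (trans (cong (λ z → coef z j) (sym φx≡φy)) (coef-φ x j))) (coords y))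

      φ-surjective : Surjective _≡_ _≡_ φ
      φ-surjective y = ψ y , λ { refl → φ∘ψ y }

      -- The Chinese remainder theorem gives one `K` with `K b` and `coef y` congruent modulo
      -- integers at every `suc k`; the entry `zero` follows because the totals agree. So `ψ y` is
      -- an integral combination of `p` and the vertices.
      ψ-lattice : ∀ y → ℤ-lattice d y → ℤ-lattice d (ψ y)
      ψ-lattice y (z , refl) with K , K-int , congs ← finite-chinese-remainder (lookup y) (ι-int z) =
        int⇒lattice λ k → subst IsInt (trans (∑-cong λ j → cong (_* lookup (vertex j) k) (sym (coef≡ j))) (sym (combination-lookup (coef y) vertex k)))
          (integral-- (λ j → K * b j) (shift K n) (integral-* K b K-int integral-b) (integral-int (shift K n) (shift-int K n K-int n-int)) k)
        where
        n : Fin d → ℚ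
        n k = proj₁ (congs k)
        n-int : ∀ k → IsInt (n k)
        n-int k = proj₁ (proj₂ (congs k))
        open ≡-Reasoning
        coef-suc : ∀ k → coef y (suc k) ≡ K * b (suc k) - - n k
        coef-suc k = trans (congruent-b K k (congs k)) (solve 2 (λ x n → x :+ n := x :- (:- n)) refl (K * b (suc k)) (n k))
        coef≡ : ∀ j → coef y j ≡ K * b j - shift K n j
        coef≡ (suc k) = coef-suc k
        coef≡ zero    = begin
          coef y zero                                  ≡⟨ ∑-suc (coef y) (∑coef≡1 y) ⟩
          1ℚ - ∑ (coef y ∘ suc)                        ≡⟨ cong (λ t → 1ℚ - t) (∑-cong coef-suc) ⟩
          1ℚ - ∑ (λ k → K * b (suc k) - shift K n (suc k)) ≡⟨ ∑-suc (λ j → K * b j - shift K n j) (begin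
              ∑ (λ j → K * b j - shift K n j)          ≡⟨ ∑-- (λ j → K * b j) (shift K n) ⟩
              ∑ (λ j → K * b j) - ∑ (shift K n)        ≡⟨ cong₂ _-_ (trans (∑-*ˡ K b) (cong (K *_) (total B))) (∑shift K n) ⟩
              K * 1ℚ - (K - 1ℚ)                        ≡⟨ solve 1 (λ K → K :* con 1ℚ :- (K :- con 1ℚ) := con 1ℚ) refl K ⟩
              1ℚ                                       ∎) ⟨
          K * b zero - shift K n zero                  ∎

      -- Otherwise the fractional parts of φ x would produce a second interior integral point.
      φ-lattice : ∀ x → ℤ-lattice d x → ℤ-lattice d (φ x)
      φ-lattice x (z , refl) with K , K-int , congs ← finite-chinese-remainder
          (λ k → proj₁ (integer-part (lookup (φ x) k))) (λ k → proj₁ (proj₂ (integer-part (lookup (φ x) k)))) =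
        int⇒lattice λ k → subst IsInt (sym (φ≡f k)) (proj₁ (proj₂ (integer-part (lookup (φ x) k))))
        where
        f n : Fin d → ℚ
        f k = proj₁ (integer-part (lookup (φ x) k))
        n k = proj₁ (congs k)
        n-int : ∀ k → IsInt (n k)
        n-int k = proj₁ (proj₂ (congs k))
        -- With `K` congruent to the floors `f`, the entry at `suc k` becomes 1 minus the fractional
        -- part of the `k`-th entry of `φ x`, divided by `s k`. It lies above 0 and is at most
        -- `b (suc k)`, so the entry `zero` is at least `b zero`; equality with `b` means that the
        -- fractional parts vanish.
        a : Fin (suc d) → ℚ
        a j = ((1ℚ + K) * b j - α x j) - shift K n j
        open ≡-Reasoning
        a-suc : ∀ k → σ k * a (suc k) ≡ (f k + 1ℚ) - lookup (φ x) k
        a-suc k = begin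
          σ k * (((1ℚ + K) * b (suc k) - α x (suc k)) - - n k)
            ≡⟨ solve 5 (λ s K b a n → s :* (((con 1ℚ :+ K) :* b :- a) :- (:- n)) := (s :* (K :* b :+ n) :+ s :* b) :- s :* a) refl (σ k) K (b (suc k)) (α x (suc k)) (n k) ⟩
          (σ k * (K * b (suc k) + n k) + σ k * b (suc k)) - σ k * α x (suc k)
            ≡⟨ cong₂ (λ t u → (σ k * t + u) - σ k * α x (suc k)) (sym (congruent-b K k (congs k))) (σ*b k) ⟩
          (σ k * (f k * r k) + 1ℚ) - σ k * α x (suc k)
            ≡⟨ cong₂ (λ t u → (t + 1ℚ) - u) (trans (solve 3 (λ s f r → s :* (f :* r) := f :* (s :* r)) refl (σ k) (f k) (r k)) (trans (cong (f k *_) (σ*r k)) (ℚ.*-identityʳ (f k)))) (sym (φ-lookup x k)) ⟩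
          (f k + 1ℚ) - lookup (φ x) k ∎
        ∑a≡1 : ∑ a ≡ 1ℚ
        ∑a≡1 = begin
          ∑ a                                                       ≡⟨ ∑-- (λ j → (1ℚ + K) * b j - α x j) (shift K n) ⟩
          ∑ (λ j → (1ℚ + K) * b j - α x j) - ∑ (shift K n)          ≡⟨ cong₂ _-_ (∑-- (λ j → (1ℚ + K) * b j) (α x)) (∑shift K n) ⟩
          (∑ (λ j → (1ℚ + K) * b j) - ∑ (α x)) - (K - 1ℚ)           ≡⟨ cong₂ (λ t u → (t - u) - (K - 1ℚ)) (trans (∑-*ˡ (1ℚ + K) b) (cong ((1ℚ + K) *_) (total B))) (total (coords x)) ⟩
          ((1ℚ + K) * 1ℚ - 1ℚ) - (K - 1ℚ)                           ≡⟨ solve 1 (λ K → ((con 1ℚ :+ K) :* con 1ℚ :- con 1ℚ) :- (K :- con 1ℚ) := con 1ℚ) refl K ⟩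
          1ℚ                                                        ∎
        a-suc>0 : ∀ k → 0ℚ < a (suc k)
        a-suc>0 k = *-cancel-<ˡ (σ>0 k) (subst (_< σ k * a (suc k)) (sym (ℚ.*-zeroʳ (σ k)))
          (subst (0ℚ <_) (sym (a-suc k)) (<⇒0<- (proj₂ (proj₂ (proj₂ (integer-part (lookup (φ x) k))))))))
        a-suc≤b : ∀ k → a (suc k) ≤ b (suc k)
        a-suc≤b k = *-cancel-≤ˡ (σ>0 k) (0≤-⇒≤ (subst (0ℚ ≤_) (sym (trans (cong₂ _-_ (σ*b k) (a-suc k))
          (solve 2 (λ f y → con 1ℚ :- ((f :+ con 1ℚ) :- y) := y :- f) refl (f k) (lookup (φ x) k))))
          (≤⇒0≤- (proj₁ (proj₂ (proj₂ (integer-part (lookup (φ x) k))))))))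
        a>0 : ∀ j → 0ℚ < a j
        a>0 (suc k) = a-suc>0 k
        a>0 zero    = ℚ.<-≤-trans (b>0 zero) (subst₂ _≤_ (sym (∑-suc b (total B))) (sym (∑-suc a ∑a≡1))
          (ℚ.+-monoʳ-≤ 1ℚ (ℚ.neg-antimono-≤ (∑-mono-≤ a-suc≤b))))
        α-integral : Integral vertex (α x)
        α-integral k = subst IsInt (sym (point (coords x) k)) (ι-int z k)
        a≡b : ∀ j → a j ≡ b j
        a≡b = unique a (integral-- (λ j → (1ℚ + K) * b j - α x j) (shift K n)
          (integral-- (λ j → (1ℚ + K) * b j) (α x) (integral-* (1ℚ + K) b (int-+ int-1 K-int) integral-b) α-integral)
          (integral-int (shift K n) (shift-int K n K-int n-int))) ∑a≡1 a>0
        φ≡f : ∀ k → lookup (φ x) k ≡ f k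
        φ≡f k = begin
          lookup (φ x) k                                       ≡⟨ solve 2 (λ f y → y := (f :+ con 1ℚ) :- ((f :+ con 1ℚ) :- y)) refl (f k) (lookup (φ x) k) ⟩
          (f k + 1ℚ) - ((f k + 1ℚ) - lookup (φ x) k)           ≡⟨ cong (λ t → (f k + 1ℚ) - t) (trans (sym (a-suc k)) (trans (cong (σ k *_) (a≡b (suc k))) (σ*b k))) ⟩
          (f k + 1ℚ) - 1ℚ                                      ≡⟨ solve 1 (λ f → (f :+ con 1ℚ) :- con 1ℚ := f) refl (f k) ⟩
          f k                                                  ∎

      image-lattice : image φ (ℤ-lattice d) ≐ ℤ-lattice d
      image-lattice = (λ { {y} (x , x∈ℤ , eq) → subst (ℤ-lattice d) eq (φ-lattice x x∈ℤ) }) ,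
                      (λ {y} y∈ℤ → ψ y , ψ-lattice y y∈ℤ , φ∘ψ y)

      image-points : image φ points ≐ T₁ d (fromℕ d)
      image-points = (λ { {y} (x , (c , c≥0 , C) , eq) → coef y ,
                          (λ j → subst (0ℚ ≤_) (trans (barycentric-unique independent (fromBarycentric vertex c x C) (coords x) j)
                            (trans (sym (coef-φ x j)) (cong (λ y → coef y j) eq))) (c≥0 j)) ,
                          toBarycentric (target-coordinates y) }) ,
                     (λ { {y} (c , c≥0 , C) → ψ y ,
                          (coef y , (λ j → subst (0ℚ ≤_) (barycentric-unique {v = w} w-independent (fromBarycentric w c y C) (target-coordinates y) j) (c≥0 j)) ,
                            toBarycentric (ψ-coordinates y)) ,
                          φ∘ψ y })

    unimodular′ : UnimodularlyEquivalent points (T₁ d (fromℕ d))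
    unimodular′ = φ , φ-affine , (φ-injective , φ-surjective) , image-lattice , image-points

  unimodular : UnimodularlyEquivalent points (T₁ d (fromℕ d))
  unimodular with M , m , coords ← barycentric-coordinates vertex independent = unimodular′ M m coords

toℕ-punchIn-fromℕ : ∀ d (k : Fin d) → toℕ (punchIn (fromℕ d) k) ≡ toℕ k
toℕ-punchIn-fromℕ (suc d) zero    = refl
toℕ-punchIn-fromℕ (suc d) (suc k) = cong suc (toℕ-punchIn-fromℕ d k)

-- The last vertex of the sorted simplex corresponds to the origin, which `T₁` lists first.
last-first : ∀ d → Permutation′ (suc d)
last-first d = insert zero (fromℕ d) idₚ

toℕ-last-first : ∀ d k → toℕ (last-first d ⟨$⟩ʳ suc k) ≡ toℕ k
toℕ-last-first d k = trans (cong toℕ (insert-punchIn zero (fromℕ d) idₚ k)) (toℕ-punchIn-fromℕ d k)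

permute-interior : ∀ {d k} (S : 𝒮 d k) π p → Interior (𝒮.points S) (ι p) → Interior (𝒮.points (permute S π)) (ι p)
permute-interior S π p = interior-mono (𝒮.points S) (𝒮.points (permute S π)) (conv-permute (𝒮.vertex S) π) (ι p)

extremal⇒unimodular : ∀ {d} (S : 𝒮 d 1) p → Interior (𝒮.points S) (ι p) → ∀ {β} →
  Coordinates (𝒮.vertex S) β (ι p) → (∀ j → β j ≡ extremal d (fromℕ d) j) →
  UnimodularlyEquivalent (𝒮.points S) (T₁ d (fromℕ d))
extremal⇒unimodular {d} S p p-int {β} B β≡ =
  unimodular-⊆ (𝒮.points (permute S τ)) (𝒮.points S) (T₁ d (fromℕ d)) (conv-unpermute (𝒮.vertex S) τ) (conv-permute (𝒮.vertex S) τ)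
    (Converse.unimodular (permute S τ) (permute-interior S τ p p-int) (permute-coordinates τ B) λ k →
      trans (β≡ (τ ⟨$⟩ʳ suc k)) (trans (extremal-< {d} {fromℕ d} {τ ⟨$⟩ʳ suc k} (τ-suc< k)) (cong 1/s (toℕ-last-first d k))))
  where
  τ : Permutation′ (suc d)
  τ = last-first d
  τ-suc< : ∀ k → toℕ (τ ⟨$⟩ʳ suc k) ℕ.< toℕ (fromℕ d)
  τ-suc< k = subst (ℕ._< toℕ (fromℕ d)) (sym (toℕ-last-first d k)) (subst (toℕ k ℕ.<_) (sym (Fin.toℕ-fromℕ d)) (Fin.toℕ<n k))

mainTheorem1 : (d : ℕ) (S : 𝒮 d 1) (i : Fin (suc d))
    (p : ℤ^ d) → Interior (𝒮.points S) (ι p) →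
    (b : Fin (suc d) → ℚ) → IsBarycentric (𝒮.vertex S) b (ι p) →
    (σ : Permutation′ (suc d)) (β : Fin (suc d) → ℚ) →
    (∀ j → β j ≡ b (σ ⟨$⟩ʳ j)) →
    (∀ j k → j ≤ᶠ k → β k ≤ β j) →
    (β i ≥ bound d i)
    × (UnimodularlyEquivalent (𝒮.points S) (T₁ d i) → β i ≡ bound d i)
    × ((β i ≡ bound d i) ⇔ (∀ j → β j ≡ extremal d i j))
    × (i ≡ fromℕ d → (β i ≡ bound d i) ⇔ UnimodularlyEquivalent (𝒮.points S) (T₁ d i))
mainTheorem1 d S i p p-int b isB σ β β≡ decreasing =
  bound-≤ , equivalent⇒equality , mk⇔ bound-equality (λ β≡extremal → trans (β≡extremal i) (extremal-≥ {d} {i} {i} ℕ.≤-refl)) ,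
  λ { refl → mk⇔ (λ eq → toS (extremal⇒unimodular Sσ p p-int′ B (bound-equality eq))) equivalent⇒equality }
  where
  -- With its vertices relabelled by `σ`, the simplex has the sorted β themselves as the coordinates
  -- of `p`.
  Sσ : 𝒮 d 1
  Sσ = permute S σ
  p-int′ : Interior (𝒮.points Sσ) (ι p)
  p-int′ = permute-interior S σ p p-int
  B : Coordinates (𝒮.vertex Sσ) β (ι p)
  B = coordinates-cong (λ j → sym (β≡ j)) (permute-coordinates σ (fromBarycentric (𝒮.vertex S) b (ι p) isB))
  open UniquePoint Sσ p-int′ B using (b>0; product-sum)
  open Bound d β b>0 (Coordinates.total B) decreasing product-sum i
  fromS : UnimodularlyEquivalent (𝒮.points S) (T₁ d i) → UnimodularlyEquivalent (𝒮.points Sσ) (T₁ d i)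
  fromS = unimodular-⊆ (𝒮.points S) (𝒮.points Sσ) (T₁ d i) (conv-permute (𝒮.vertex S) σ) (conv-unpermute (𝒮.vertex S) σ)
  toS : UnimodularlyEquivalent (𝒮.points Sσ) (T₁ d i) → UnimodularlyEquivalent (𝒮.points S) (T₁ d i)
  toS = unimodular-⊆ (𝒮.points Sσ) (𝒮.points S) (T₁ d i) (conv-unpermute (𝒮.vertex S) σ) (conv-permute (𝒮.vertex S) σ)
  equivalent⇒equality : UnimodularlyEquivalent (𝒮.points S) (T₁ d i) → β i ≡ bound d i
  equivalent⇒equality equiv = ℚ.≤-antisym (Equivalent.≤-bound Sσ p-int′ B i (fromS equiv) decreasing) bound-≤
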